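{- Let $\tau$ be a vocabulary consisting of a finite set $\bar a$ of (hard-wired) constant symbols, a finite set $\bar U$ of unary relation symbols, and a finite set $\bar R$ of binary relation symbols. Let $\mathcal{C}$ be a class of finite $\tau$-structures definable in CMSOL. Then the sequence $Sp_{\mathcal{C}}(n)$ is MC-finite.
   Context: Notation: $[n]=\{1,\ldots,n\}$; $\bar a=\{a_1,\ldots,a_{\ell_{\bar a}}\}$. Counting function with hard-wired constants: $Sp_{\mathcal{C}}(n)$ (also written $f_{\mathcal{C}}(n)$) is the number of structures in $\mathcal{C}$ with universe $[n+\ell_{\bar a}]$ in which $a_i$ is interpreted as $n+i$ for every $i\in[\ell_{\bar a}]$; that is, one counts only the possible interpretations of the relation symbols. MC-finite: an integer sequence $s(n)$ is MC-finite if for every positive integer $m$ it satisfies a linear recurrence with constant coefficients modulo $m$: there are $r(m),p(m)\in\mathbb{N}^+$ and integers $\alpha_0,\ldots,\alpha_{p(m)}$ (depending on $m$) such that $s(n+p(m)+1)\equiv\sum_{i=0}^{p(m)}\alpha_i\, s(n+i)\pmod m$ for all $n\ge r(m)$. Equivalently, for every $m$ the sequence $s(n)\bmod m$ is ultimately periodic. CMSOL: Monadic Second Order Logic (first order logic with equality, extended by unary relation variables and quantification over them), further extended by the modular counting quantifiers $\mathrm{C}_{m,r}x\,\phi(x)$, which hold in a structure with universe $A$ iff $|\{b\in A:\phi(b)\}|\equiv r\pmod m$. A class is CMSOL-definable if it is the class of finite structures satisfying some CMSOL sentence over $\tau$. -}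

module Defs where

open import Algebra.Properties.CommutativeMonoid.Sum using (sum)
open import Data.Fin using (Fin; toℕ; _↑ʳ_)
open import Data.Fin.Properties using (any?; all?) renaming (_≟_ to _≟ᶠ_)
open import Data.Fin.Subset using (Subset; inside; outside; _∈_; ∣_∣)
open import Data.Fin.Subset.Properties using (_∈?_; anySubset?)
open import Data.Integer using (ℤ; +_; _-_) renaming (_*_ to _*ᶻ_)
open import Data.Integer.Divisibility.Signed using (_∣_; _∣?_)
open import Data.Integer.Properties using (+-0-commutativeMonoid)
open import Data.List using (List; []; _∷_; length; filter; cartesianProductWith)
open import Data.List.Membership.Propositional using () renaming (_∈_ to _∈ˡ_)
open import Data.List.Membership.Propositional.Properties using (∈-cartesianProductWith⁺)
open import Data.List.Relation.Unary.All using ([]; _∷_)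
open import Data.List.Relation.Unary.AllPairs using ([]; _∷_)
open import Data.List.Relation.Unary.Any using (here; there)
open import Data.List.Relation.Unary.Unique.Propositional using (Unique)
open import Data.List.Relation.Unary.Unique.Propositional.Properties
  using (cartesianProductWith⁺)
open import Data.Nat using (ℕ; zero; suc; _+_; _≤_; _<_; NonZero)
open import Data.Product using (_×_; _,_; ∃-syntax; Σ-syntax)
open import Data.Sum using (_⊎_)
open import Data.Vec using (Vec; []; _∷_; lookup; tabulate)
open import Data.Vec.Functional using (Vector)
open import Function.Bundles using (_⇔_; mk⇔; Equivalence)
open import Relation.Binary.PropositionalEquality using (_≡_; refl)
open import Relation.Nullary using (Dec; ¬_; ¬?; _×-dec_; _⊎-dec_; _→-dec_)
open import Relation.Nullary.Decidable using (decidable-stable; map′)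
open import Relation.Unary using (Decidable)

infix  4 _≡_[mod_] _⊨_

_≡_[mod_] : ℤ → ℤ → ℕ → Set
a ≡ b [mod m ] = (+ m) ∣ (a - b)

-- The coefficients α are indexed 0, …, p.
MCFinite : (ℕ → ℤ) → Set
MCFinite s =
  ∀ (m : ℕ) → .{{NonZero m}} →
  ∃[ r ] ∃[ p ] 0 < r × 0 < p × (Σ[ α ∈ Vector ℤ (suc p) ]
    (∀ n → r ≤ n →
      s (n + p + 1) ≡ ∑ (λ i → α i *ᶻ s (n + toℕ i)) [mod m ]))
  where
  ∑ : ∀ {k} → Vector ℤ k → ℤ
  ∑ = sum +-0-commutativeMonoid

-- The symbols of each kind are numbered, so a vocabulary is given by how many
-- there are of each.
record Vocabulary : Set where
  field
    #constants : ℕ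
    #unary     : ℕ
    #binary    : ℕ

open Vocabulary public

-- The universe {1, …, N} is represented by Fin N.  Relations are stored as
-- tables rather than as functions, so that propositional equality of
-- interpretations is extensional, as is needed for counting them.  Row x of a
-- binary relation R is the set of all y such that R x y.
record Relations (τ : Vocabulary) (N : ℕ) : Set where
  constructor mkRelations
  field
    unary  : Vec (Subset N) (#unary τ)
    binary : Vec (Vec (Subset N) N) (#binary τ)

record Structure (τ : Vocabulary) (N : ℕ) : Set where
  constructor mkStructure
  field
    constants : Vec (Fin N) (#constants τ)
    relations : Relations τ N

  open Relations relations public

Class : Vocabulary → Set₁
Class τ = ∀ N → Structure τ N → Set

module _ (τ : Vocabulary) where

  infix  9 _≐_ _∈ᶠ_
  infixr 8 ¬ᶠ_ ∃ᶠ_ ∀ᶠ_ ∃ˢ_ ∀ˢ_ C[_,_]_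
  infixr 7 _∧ᶠ_
  infixr 6 _∨ᶠ_
  infixr 5 _⇒ᶠ_

  data Term (j : ℕ) : Set where
    var   : Fin j → Term j
    const : Fin (#constants τ) → Term j

  -- Formulas with j free element variables and k free set variables, both as
  -- de Bruijn indices.
  data Formula (j k : ℕ) : Set where
    _≐_      : Term j → Term j → Formula j k
    unaryᶠ   : Fin (#unary τ) → Term j → Formula j k
    binaryᶠ  : Fin (#binary τ) → Term j → Term j → Formula j k
    _∈ᶠ_     : Term j → Fin k → Formula j k
    ¬ᶠ_      : Formula j k → Formula j k
    _∧ᶠ_     : Formula j k → Formula j k → Formula j k
    _∨ᶠ_     : Formula j k → Formula j k → Formula j k
    _⇒ᶠ_     : Formula j k → Formula j k → Formula j k
    ∃ᶠ_ ∀ᶠ_  : Formula (suc j) k → Formula j k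
    ∃ˢ_ ∀ˢ_  : Formula j (suc k) → Formula j k
    C[_,_]_  : (m : ℕ) → .{{NonZero m}} → (r : ℕ) →
               Formula (suc j) k → Formula j k

  Sentence : Set
  Sentence = Formula 0 0

module _ {τ : Vocabulary} {N : ℕ} (M : Structure τ N) where

  open Structure M

  ⟦_⟧ : ∀ {j} → Term τ j → Vec (Fin N) j → Fin N
  ⟦ var x ⟧   v = lookup v x
  ⟦ const c ⟧ v = lookup constants c

  Sat : ∀ {j k} → Formula τ j k → Vec (Fin N) j → Vec (Subset N) k → Set
  Sat (s ≐ t)         v V = ⟦ s ⟧ v ≡ ⟦ t ⟧ v
  Sat (unaryᶠ U t)    v V = ⟦ t ⟧ v ∈ lookup unary U
  Sat (binaryᶠ R s t) v V = ⟦ t ⟧ v ∈ lookup (lookup binary R) (⟦ s ⟧ v)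
  Sat (t ∈ᶠ X)        v V = ⟦ t ⟧ v ∈ lookup V X
  Sat (¬ᶠ φ)          v V = ¬ Sat φ v V
  Sat (φ ∧ᶠ ψ)        v V = Sat φ v V × Sat ψ v V
  Sat (φ ∨ᶠ ψ)        v V = Sat φ v V ⊎ Sat ψ v V
  Sat (φ ⇒ᶠ ψ)        v V = Sat φ v V → Sat ψ v V
  Sat (∃ᶠ φ)          v V = ∃[ b ] Sat φ (b ∷ v) V
  Sat (∀ᶠ φ)          v V = ∀ b → Sat φ (b ∷ v) V
  Sat (∃ˢ φ)          v V = ∃[ S ] Sat φ v (S ∷ V)
  Sat (∀ˢ φ)          v V = ∀ S → Sat φ v (S ∷ V)
  -- S is the set { b : φ(b) }, which these equivalences determine uniquely.
  Sat (C[ m , r ] φ)  v V =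
    ∃[ S ] (∀ b → b ∈ S ⇔ Sat φ (b ∷ v) V) × + ∣ S ∣ ≡ + r [mod m ]

_⊨_ : ∀ {τ N} → Structure τ N → Sentence τ → Set
M ⊨ φ = Sat M φ [] []

CMSOLDefinable : ∀ {τ} → Class τ → Set
CMSOLDefinable {τ} C = ∃[ φ ] (∀ N (M : Structure τ N) → C N M ⇔ M ⊨ φ)

-- Quantification over elements and subsets of a finite universe is decidable,
-- so definable classes have decidable membership; counting relies on this.

allSubset? : ∀ {n} {P : Subset n → Set} → Decidable P → Dec (∀ S → P S)
allSubset? P? = map′
  (λ ¬∃¬P S → decidable-stable (P? S) (λ ¬PS → ¬∃¬P (S , ¬PS)))
  (λ { ∀P (S , ¬PS) → ¬PS (∀P S) })
  (¬? (anySubset? (λ S → ¬? (P? S))))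

_⇔-dec_ : ∀ {A B : Set} → Dec A → Dec B → Dec (A ⇔ B)
A? ⇔-dec B? = map′
  (λ (to , from) → mk⇔ to from)
  (λ e → Equivalence.to e , Equivalence.from e)
  ((A? →-dec B?) ×-dec (B? →-dec A?))

module _ {τ : Vocabulary} {N : ℕ} (M : Structure τ N) where

  open Structure M

  sat? : ∀ {j k} (φ : Formula τ j k) v V → Dec (Sat M φ v V)
  sat? (s ≐ t)         v V = ⟦_⟧ M s v ≟ᶠ ⟦_⟧ M t v
  sat? (unaryᶠ U t)    v V = ⟦_⟧ M t v ∈? lookup unary U
  sat? (binaryᶠ R s t) v V = ⟦_⟧ M t v ∈? lookup (lookup binary R) (⟦_⟧ M s v)
  sat? (t ∈ᶠ X)        v V = ⟦_⟧ M t v ∈? lookup V X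
  sat? (¬ᶠ φ)          v V = ¬? (sat? φ v V)
  sat? (φ ∧ᶠ ψ)        v V = sat? φ v V ×-dec sat? ψ v V
  sat? (φ ∨ᶠ ψ)        v V = sat? φ v V ⊎-dec sat? ψ v V
  sat? (φ ⇒ᶠ ψ)        v V = sat? φ v V →-dec sat? ψ v V
  sat? (∃ᶠ φ)          v V = any? (λ b → sat? φ (b ∷ v) V)
  sat? (∀ᶠ φ)          v V = all? (λ b → sat? φ (b ∷ v) V)
  sat? (∃ˢ φ)          v V = anySubset? (λ S → sat? φ v (S ∷ V))
  sat? (∀ˢ φ)          v V = allSubset? (λ S → sat? φ v (S ∷ V))
  sat? (C[ m , r ] φ)  v V = anySubset? (λ S →
    all? (λ b → (b ∈? S) ⇔-dec sat? φ (b ∷ v) V)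
      ×-dec ((+ m) ∣? (+ ∣ S ∣ - + r)))

definable⇒decidable : ∀ {τ} {C : Class τ} → CMSOLDefinable C →
                      ∀ N → Decidable (C N)
definable⇒decidable (φ , C⇔φ) N M =
  map′ (Equivalence.from (C⇔φ N M)) (Equivalence.to (C⇔φ N M)) (sat? M φ [] [])

allVecs : ∀ {A : Set} → List A → ∀ n → List (Vec A n)
allVecs xs zero    = [] ∷ []
allVecs xs (suc n) = cartesianProductWith _∷_ xs (allVecs xs n)

allSubsets : ∀ N → List (Subset N)
allSubsets = allVecs (inside ∷ outside ∷ [])

allRelations : ∀ τ N → List (Relations τ N)
allRelations τ N = cartesianProductWith mkRelations
  (allVecs (allSubsets N) (#unary τ))
  (allVecs (allVecs (allSubsets N) N) (#binary τ))

-- In the universe {1, …, n + ℓ} the i-th constant denotes n + i.  With indices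
-- starting from 0 on both sides this is again the element n + i.
hardWired : ∀ {τ} n → Relations τ (n + #constants τ) →
            Structure τ (n + #constants τ)
hardWired n = mkStructure (tabulate (n ↑ʳ_))

Sp : ∀ {τ} (C : Class τ) → (∀ N → Decidable (C N)) → ℕ → ℕ
Sp {τ} C C? n = length
  (filter (λ R → C? (n + #constants τ) (hardWired n R))
          (allRelations τ (n + #constants τ)))

-- Every interpretation of the relation symbols occurs exactly once in
-- allRelations, so Sp is indeed the number of structures.

allVecs-complete : ∀ {A : Set} {xs : List A} → (∀ x → x ∈ˡ xs) →
                   ∀ {n} (v : Vec A n) → v ∈ˡ allVecs xs n
allVecs-complete c []      = here refl
allVecs-complete c (x ∷ v) =
  ∈-cartesianProductWith⁺ _∷_ (c x) (allVecs-complete c v)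

allVecs-unique : ∀ {A : Set} {xs : List A} → Unique xs →
                 ∀ n → Unique (allVecs xs n)
allVecs-unique u zero    = [] ∷ []
allVecs-unique u (suc n) =
  cartesianProductWith⁺ _∷_ (λ { refl → refl , refl }) u (allVecs-unique u n)

allSubsets-complete : ∀ {N} (S : Subset N) → S ∈ˡ allSubsets N
allSubsets-complete =
  allVecs-complete λ { inside → here refl ; outside → there (here refl) }

allSubsets-unique : ∀ N → Unique (allSubsets N)
allSubsets-unique = allVecs-unique (((λ ()) ∷ []) ∷ [] ∷ [])

allRelations-complete : ∀ {τ N} (R : Relations τ N) → R ∈ˡ allRelations τ N
allRelations-complete (mkRelations us bs) = ∈-cartesianProductWith⁺ mkRelations
  (allVecs-complete allSubsets-complete us)
  (allVecs-complete (allVecs-complete allSubsets-complete) bs)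

allRelations-unique : ∀ τ N → Unique (allRelations τ N)
allRelations-unique τ N = cartesianProductWith⁺ mkRelations
  (λ { refl → refl , refl })
  (allVecs-unique (allSubsets-unique N) (#unary τ))
  (allVecs-unique (allVecs-unique (allSubsets-unique N) N) (#binary τ))

{-# OPTIONS --safe #-}
module Submission where

-- By a Feferman–Vaught argument, the CMSOL-type of a structure obtained by
-- substituting structures for the points of A depends only on A and on the
-- types of the substituted structures, and there are finitely many types.  For
-- a word of types w, let g w count the binary relations on |w| points labelled
-- by w that yield a model.  Unary predicates, loops and constants are absorbed
-- into the labels, so Sp n is a sum of values of g.
--
-- Consider blocks of prime sizes, all of whose points are labelled t, and let
-- a cyclic group rotate each block.  A structure fixed by the rotation of a
-- block has this block as a module, which collapses to a single point.  Hence,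
-- counting the structures that are fixed by no rotation gives, by inclusion and
-- exclusion, an expression g (t^M ++ w) - (values of g at shorter words).  Since
-- the relations are binary, being moved by a rotation is witnessed on a pair of
-- blocks; so if there are enough blocks for every prime factor of m, a subgroup
-- of order m acts freely on the orbit of every such structure, and the
-- expression vanishes modulo m.
--
-- A functional satisfying these recurrences modulo m is determined by its values
-- on short words, so there are finitely many of them.  Passing from n to n + 1
-- is a linear map on these functionals, hence Sp is ultimately periodic modulo m.

open import Defs
import Data.Integer.Properties as ℤₚ
open import Algebra.Properties.CommutativeMonoid.Sum ℤₚ.+-0-commutativeMonoid using () renaming (sum to sumᵛ)
open import Data.Bool using (Bool; true; false; not; _∧_; _∨_; if_then_else_) renaming (_≟_ to _≟ᵇ_)
open import Data.Empty using (⊥; ⊥-elim)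
open import Data.Fin as Fin using (Fin; zero; suc; toℕ; _↑ʳ_; remQuot; funToFin; finToFun)
open import Data.Fin.Properties using (toℕ-injective; toℕ-fromℕ<; toℕ<n) renaming (_≟_ to _≟ᶠ_)
import Data.Fin.Properties as Finₚ
open import Data.Fin.Subset using (Subset; ∣_∣)
import Data.Fin.Subset as Subset
open import Data.Integer using (ℤ; +_)
import Data.Integer as ℤ
import Data.Integer.Divisibility.Signed as ℤ∣
open import Data.Integer.Tactic.RingSolver using (solve-∀)
open import Data.List using (List; []; _∷_; _++_; length; filter; cartesianProductWith; allFin)
import Data.List as List
open import Data.List.Membership.Propositional using (_∈_; _∉_)
open import Data.List.Membership.Propositional.Properties
open import Data.List.Membership.Propositional.Properties.WithK using (unique∧set⇒bag)
import Data.List.Properties as Listₚ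
open import Data.List.Relation.Binary.BagAndSetEquality using (∼bag⇒↭)
open import Data.List.Relation.Binary.Permutation.Homogeneous using (onIndices)
open import Data.List.Relation.Binary.Permutation.Propositional as ↭ using (_↭_; ↭-sym; ↭-trans; ↭-refl)
import Data.List.Relation.Binary.Permutation.Propositional.Properties as ↭ₚ
import Data.List.Relation.Binary.Permutation.Setoid.Properties as ↭ₛₚ
open import Data.List.Relation.Unary.All as All using (All; []; _∷_)
import Data.List.Relation.Unary.All.Properties as Allₚ
open import Data.List.Relation.Unary.AllPairs using ([]; _∷_)
open import Data.List.Relation.Unary.Any as Any using (Any; here; there)
import Data.List.Relation.Unary.Any.Properties as Anyₚ
open import Data.List.Relation.Unary.Unique.Propositional using (Unique)
import Data.List.Relation.Unary.Unique.Propositional.Properties as Uniqueₚ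
open import Data.Nat
open import Data.Nat.Coprimality using (Coprime; coprime-Bézout)
open import Data.Nat.DivMod using (_mod_; m<n⇒m%n≡m; [m+n]%n≡m%n; m%n<n; %-distribˡ-+; m%n%n≡m%n; %-remove-+ˡ; m≡m%n+[m/n]*n)
import Data.Nat.Divisibility as ℕ∣
open import Data.Nat.GCD using (module Bézout)
open import Data.Nat.ListAction using (sum; product)
import Data.Nat.ListAction.Properties as Sumₚ
open import Data.Nat.Primality using (Prime; prime⇒irreducible; prime⇒nonZero; prime⇒nonTrivial)
open import Data.Nat.Primality.Factorisation using (factorise)
import Data.Nat.Properties as ℕₚ
open import Data.Nat.Solver using (module +-*-Solver)
open import Data.Product
open import Data.Sum using (_⊎_; inj₁; inj₂; [_,_]′)
import Data.Sum as Sum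
open import Data.Sum.Properties using (inj₁-injective; inj₂-injective)
open import Data.Unit using (⊤; tt)
open import Data.Vec using (Vec; []; _∷_; lookup; tabulate)
import Data.Vec as Vec
import Data.Vec.Properties as Vecₚ
open import Function using (_∘_; id; case_of_; _⇔_; mk⇔)
open import Function using () renaming (const to constant)
open import Function.Bundles using (Equivalence; Inverse)
open import Relation.Binary.PropositionalEquality
open import Relation.Nullary
open import Relation.Nullary.Decidable
open import Relation.Nullary.Reflects using (¬-reflects; _×-reflects_; _⊎-reflects_; _→-reflects_)
open import Relation.Unary using (Decidable)

-- Finite sets and counting

-- Being fixed by no single rotation does not make the whole group act freely: if the only edges
-- form a cyclically invariant perfect matching between two blocks of equal size, turning both
-- blocks together fixes the structure although turning either one moves it. The subgroup therefore
-- has to depend on the structure. If the rotation of block `i` moves a structure, this shows on the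
-- entries between `i` and some `j`, which is another block, `i` itself or the points outside all
-- blocks, and at most two rotations act on these entries. Choosing one block for each prime factor,
-- always away from the blocks and partners chosen before, makes the stabilizer conditions
-- triangular, so that the exponents vanish one after the other. Every choice rules out at most two
-- blocks, so twice as many blocks of each size as there are prime factors suffice.
--
-- Words range over all types, not only over types of single points, because the point replacing a
-- collapsed block can have any type.

record Finite : Set₁ where
  field
    El       : Set
    elements : List El
    unique   : Unique elements
    complete : ∀ x → x ∈ elements

  size : ℕ
  size = length elements

  index : El → Fin size
  index x = Any.index (complete x)

  at : Fin size → El
  at = List.lookup elements

  at-index : ∀ x → at (index x) ≡ x
  at-index x = sym (Anyₚ.lookup-index (complete x))

  index-injective : ∀ {x y} → index x ≡ index y → x ≡ y
  index-injective {x} {y} eq =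
    trans (sym (at-index x)) (trans (cong at eq) (at-index y))

  index-at : ∀ i → index (at i) ≡ i
  index-at i = lookup-injective unique (at-index (at i))
    where
    lookup-injective : ∀ {xs : List El} → Unique xs → ∀ {i j} →
                       List.lookup xs i ≡ List.lookup xs j → i ≡ j
    lookup-injective (_ ∷ _) {zero} {zero} _ = refl
    lookup-injective (x≢ ∷ _) {zero} {suc j} eq =
      ⊥-elim (All.lookup x≢ (∈-lookup j) eq)
    lookup-injective (x≢ ∷ _) {suc i} {zero} eq =
      ⊥-elim (All.lookup x≢ (∈-lookup i) (sym eq))
    lookup-injective (_ ∷ u) {suc i} {suc j} eq = cong suc (lookup-injective u eq)

  infix 4 _≟E_

  abstract
    _≟E_ : (x y : El) → Dec (x ≡ y)
    x ≟E y = map′ index-injective (cong index) (index x ≟ᶠ index y)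

    ∃? : ∀ {P : El → Set} → Decidable P → Dec (∃ P)
    ∃? P? = map′ Any.satisfied (λ (x , px) → Any.map (λ { refl → px }) (complete x))
                 (Any.any? P? elements)

    ∀? : ∀ {P : El → Set} → Decidable P → Dec (∀ x → P x)
    ∀? P? = map′ (λ all x → All.lookup all (complete x)) (λ f → All.universal f _)
                 (All.all? P? elements)

open Finite public

fin : ℕ → Finite
fin n = record
  { El = Fin n ; elements = allFin n
  ; unique = Uniqueₚ.allFin⁺ n ; complete = ∈-allFin }

bool : Finite
bool = record
  { El = Bool ; elements = true ∷ false ∷ []
  ; unique = ((λ ()) ∷ []) ∷ [] ∷ []
  ; complete = λ { true → here refl ; false → there (here refl) } }

infixr 4 _⊕_
infixr 5 _⊗_

_⊕_ : Finite → Finite → Finite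
I ⊕ J = record
  { El = El I ⊎ El J
  ; elements = List.map inj₁ (elements I) ++ List.map inj₂ (elements J)
  ; unique = Uniqueₚ.++⁺ (Uniqueₚ.map⁺ inj₁-injective (unique I))
                         (Uniqueₚ.map⁺ inj₂-injective (unique J)) disjoint
  ; complete = λ { (inj₁ x) → ∈-++⁺ˡ (∈-map⁺ inj₁ (complete I x))
                 ; (inj₂ y) → ∈-++⁺ʳ _ (∈-map⁺ inj₂ (complete J y)) } }
  where
  disjoint : ∀ {v} → v ∈ List.map inj₁ (elements I) × v ∈ List.map inj₂ (elements J) → ⊥
  disjoint (p , q) with ∈-map⁻ inj₁ p | ∈-map⁻ inj₂ q
  ... | _ , _ , refl | _ , _ , ()

_⊗_ : Finite → Finite → Finite
I ⊗ J = record
  { El = El I × El J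
  ; elements = cartesianProductWith _,_ (elements I) (elements J)
  ; unique = Uniqueₚ.cartesianProductWith⁺ _,_ (λ { refl → refl , refl }) (unique I) (unique J)
  ; complete = λ (x , y) → ∈-cartesianProductWith⁺ _,_ (complete I x) (complete J y) }

vec : Finite → ℕ → Finite
vec X n = record
  { El = Vec (El X) n ; elements = allVecs (elements X) n
  ; unique = allVecs-unique (unique X) n ; complete = allVecs-complete (complete X) }

Table : Finite → Finite → Finite
Table I X = vec X (size I)

module _ {I X : Finite} where

  infixl 9 _!_

  _!_ : El (Table I X) → El I → El X
  v ! i = lookup v (index I i)

  tab : (El I → El X) → El (Table I X)
  tab f = tabulate (f ∘ at I)

  !-tab : ∀ f i → tab f ! i ≡ f i
  !-tab f i = trans (Vecₚ.lookup∘tabulate (f ∘ at I) (index I i)) (cong f (at-index I i))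

  tab-cong : ∀ {f g} → (∀ i → f i ≡ g i) → tab f ≡ tab g
  tab-cong eq = Vecₚ.tabulate-cong (eq ∘ at I)

  tab-! : ∀ v → tab (v !_) ≡ v
  tab-! v = trans (Vecₚ.tabulate-cong (λ i → cong (lookup v) (index-at I i)))
                  (Vecₚ.tabulate∘lookup v)

  !-ext : ∀ {u v} → (∀ i → u ! i ≡ v ! i) → u ≡ v
  !-ext {u} {v} eq = trans (sym (tab-! u)) (trans (tab-cong eq) (tab-! v))

  abstract
    -- Functions are searched through their tables, which represent them only up to pointwise
    -- equality; hence the hypothesis that `P` respects it.
    ∃-function? : {P : (El I → El X) → Set} → (∀ {f g} → (∀ i → f i ≡ g i) → P f → P g) →
                  Decidable P → Dec (∃ P)
    ∃-function? resp P? =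
      map′ (λ (v , p) → v !_ , p)
           (λ (f , p) → tab f , resp (λ i → sym (!-tab f i)) p)
           (∃? (Table I X) (λ v → P? (v !_)))

infix 4 _≃_

record _≃_ (I J : Finite) : Set where
  field
    to      : El I → El J
    from    : El J → El I
    from-to : ∀ x → from (to x) ≡ x
    to-from : ∀ y → to (from y) ≡ y

  to-injective : ∀ {x y} → to x ≡ to y → x ≡ y
  to-injective {x} {y} eq = trans (sym (from-to x)) (trans (cong from eq) (from-to y))

open _≃_ public

≃-refl : ∀ {I} → I ≃ I
≃-refl = record { to = id ; from = id ; from-to = λ _ → refl ; to-from = λ _ → refl }

≃-sym : ∀ {I J} → I ≃ J → J ≃ I
≃-sym π = record { to = from π ; from = to π ; from-to = to-from π ; to-from = from-to π }

≃-trans : ∀ {I J K} → I ≃ J → J ≃ K → I ≃ K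
≃-trans π ρ = record
  { to = to ρ ∘ to π ; from = from π ∘ from ρ
  ; from-to = λ x → trans (cong (from π) (from-to ρ _)) (from-to π x)
  ; to-from = λ y → trans (cong (to ρ) (to-from π _)) (to-from ρ y) }

infixr 4 _⊕≃_

_⊕≃_ : ∀ {I J I′ J′} → I ≃ I′ → J ≃ J′ → (I ⊕ J) ≃ (I′ ⊕ J′)
π ⊕≃ ρ = record
  { to = Sum.map (to π) (to ρ) ; from = Sum.map (from π) (from ρ)
  ; from-to = λ { (inj₁ x) → cong inj₁ (from-to π x) ; (inj₂ y) → cong inj₂ (from-to ρ y) }
  ; to-from = λ { (inj₁ x) → cong inj₁ (to-from π x) ; (inj₂ y) → cong inj₂ (to-from ρ y) } }

⊕-swap : ∀ {I J K} → (I ⊕ J ⊕ K) ≃ (J ⊕ I ⊕ K)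
⊕-swap = record
  { to = swap′ ; from = swap′ ; from-to = involutive ; to-from = involutive }
  where
  swap′ : ∀ {A B C : Set} → A ⊎ B ⊎ C → B ⊎ A ⊎ C
  swap′ (inj₁ x)        = inj₂ (inj₁ x)
  swap′ (inj₂ (inj₁ y)) = inj₁ y
  swap′ (inj₂ (inj₂ z)) = inj₂ (inj₂ z)

  involutive : ∀ {A B C : Set} (x : A ⊎ B ⊎ C) → swap′ (swap′ x) ≡ x
  involutive (inj₁ x)        = refl
  involutive (inj₂ (inj₁ y)) = refl
  involutive (inj₂ (inj₂ z)) = refl

∑ : (I : Finite) → (El I → ℕ) → ℕ
∑ I f = sum (List.map f (elements I))

∑-cong : ∀ I {f g : El I → ℕ} → (∀ i → f i ≡ g i) → ∑ I f ≡ ∑ I g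
∑-cong I eq = cong sum (Listₚ.map-cong eq (elements I))

∑-≃ : ∀ {I J} (π : I ≃ J) (f : El J → ℕ) → ∑ I (f ∘ to π) ≡ ∑ J f
∑-≃ {I} {J} π f = trans (cong sum (Listₚ.map-∘ (elements I)))
  (Sumₚ.sum-↭ (↭ₚ.map⁺ f (∼bag⇒↭ (unique∧set⇒bag
    (Uniqueₚ.map⁺ (to-injective π) (unique I)) (unique J)
    (mk⇔ (λ _ → complete J _)
         (λ _ → subst (_∈ _) (to-from π _) (∈-map⁺ (to π) (complete I _))))))))

∑-⊕ : ∀ I J (f : El (I ⊕ J) → ℕ) → ∑ (I ⊕ J) f ≡ ∑ I (f ∘ inj₁) + ∑ J (f ∘ inj₂)
∑-⊕ I J f = begin
  sum (List.map f (List.map inj₁ (elements I) ++ List.map inj₂ (elements J)))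
    ≡⟨ cong sum (Listₚ.map-++ f (List.map inj₁ (elements I)) _) ⟩
  sum (List.map f (List.map inj₁ (elements I)) ++ List.map f (List.map inj₂ (elements J)))
    ≡⟨ Sumₚ.sum-++ (List.map f (List.map inj₁ (elements I))) _ ⟩
  sum (List.map f (List.map inj₁ (elements I))) + sum (List.map f (List.map inj₂ (elements J)))
    ≡⟨ cong₂ (λ u v → sum u + sum v) (Listₚ.map-∘ (elements I)) (Listₚ.map-∘ (elements J)) ⟨
  ∑ I (f ∘ inj₁) + ∑ J (f ∘ inj₂) ∎
  where open ≡-Reasoning

module _ {A B : Set} (R : A → B → Set)
         (R-injective : ∀ {x x′ y} → R x y → R x′ y → x ≡ x′) where

  -- Deleting the partner of the head from `ys` leaves the partners of the other elements in place,
  -- by injectivity. A relation instead of a function allows the partner to be read off from the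
  -- membership proof.
  length-≤ : ∀ {xs ys} → Unique xs → (∀ {x} → x ∈ xs → ∃[ y ] y ∈ ys × R x y) →
             length xs ≤ length ys
  length-≤ {[]} _ _ = z≤n
  length-≤ {x ∷ xs} (x≢ ∷ u) f with f (here refl)
  ... | y , y∈ , r with ∈-∃++ y∈
  ... | as , bs , refl = begin
    suc (length xs)         ≤⟨ s≤s (length-≤ u g) ⟩
    suc (length (as ++ bs)) ≡⟨ Listₚ.length-++-sucʳ as y bs ⟨
    length (as ++ y ∷ bs)   ∎
    where
    open ℕₚ.≤-Reasoning

    g : ∀ {x′} → x′ ∈ xs → ∃[ y′ ] y′ ∈ as ++ bs × R x′ y′
    g x′∈ with f (there x′∈)
    ... | y′ , y′∈ , r′ with ∈-++⁻ as y′∈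
    ... | inj₁ p            = y′ , ∈-++⁺ˡ p , r′
    ... | inj₂ (there p)    = y′ , ∈-++⁺ʳ as p , r′
    ... | inj₂ (here refl)  = ⊥-elim (All.lookup x≢ x′∈ (R-injective r r′))

count : (X : Finite) {P : El X → Set} → Decidable P → ℕ
count X P? = length (filter P? (elements X))

module _ (X Y : Finite) {P : El X → Set} {Q : El Y → Set} (P? : Decidable P) (Q? : Decidable Q) where

  count-≤ : (R : El X → El Y → Set) → (∀ {x x′ y} → R x y → R x′ y → x ≡ x′) →
            (∀ x → P x → ∃[ y ] Q y × R x y) → count X P? ≤ count Y Q?
  count-≤ R R-inj f = length-≤ R R-inj (Uniqueₚ.filter⁺ P? (unique X))
    (λ x∈ → let y , q , r = f _ (proj₂ (∈-filter⁻ P? {xs = elements X} x∈))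
            in y , ∈-filter⁺ Q? (complete Y y) q , r)

count-bijection : (X Y : Finite) {P : El X → Set} {Q : El Y → Set}
  (P? : Decidable P) (Q? : Decidable Q) (f : El X → El Y) (g : El Y → El X) →
  (∀ x → P x → Q (f x) × g (f x) ≡ x) → (∀ y → Q y → P (g y) × f (g y) ≡ y) →
  count X P? ≡ count Y Q?
count-bijection X Y {P} {Q} P? Q? f g fwd bwd = ℕₚ.≤-antisym
  (count-≤ X Y P? Q? (λ x y → g y ≡ x) (λ { refl eq → eq })
    (λ x p → f x , fwd x p))
  (count-≤ Y X Q? P? (λ y x → f x ≡ y) (λ { refl eq → eq })
    (λ y q → g y , bwd y q))

module _ (X : Finite) {P Q : El X → Set} (P? : Decidable P) (Q? : Decidable Q) where

  count-cong : (∀ x → P x ⇔ Q x) → count X P? ≡ count X Q?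
  count-cong eq = count-bijection X X P? Q? id id
    (λ x p → Equivalence.to (eq x) p , refl) (λ x q → Equivalence.from (eq x) q , refl)

  count-split : count X P? ≡ count X (λ x → P? x ×-dec Q? x) + count X (λ x → P? x ×-dec ¬? (Q? x))
  count-split = go (elements X)
    where
    go : ∀ xs → length (filter P? xs) ≡
         length (filter (λ x → P? x ×-dec Q? x) xs) + length (filter (λ x → P? x ×-dec ¬? (Q? x)) xs)
    go [] = refl
    go (x ∷ xs) with does (P? x) | does (Q? x)
    ... | false | _     = go xs
    ... | true  | true  = cong suc (go xs)
    ... | true  | false = trans (cong suc (go xs)) (sym (ℕₚ.+-suc _ _))

count-empty : ∀ X {P : El X → Set} (P? : Decidable P) → (∀ x → ¬ P x) → count X P? ≡ 0
count-empty X P? ¬P = cong length (Listₚ.filter-none P? (All.universal ¬P (elements X)))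

-- Recognition by finite algebras of types

module TypeAlgebras (b : ℕ) where

  Bin : Set
  Bin = Vec Bool b

  Arrangement : Finite → Set
  Arrangement I = El I → El I → Bin

  Agree : ∀ {I J} → (El I → El J) → Arrangement I → Arrangement J → Set
  Agree π A A′ = ∀ x y → x ≢ y → A x y ≡ A′ (π x) (π y)

  -- P is a module of A: its points relate to the outside in the same way.
  record Collapses {P I} (A : Arrangement (P ⊕ I)) (A′ : Arrangement (fin 1 ⊕ I)) : Set where
    field
      out-out : ∀ i j → A (inj₂ i) (inj₂ j) ≡ A′ (inj₂ i) (inj₂ j)
      in-out  : ∀ x j → A (inj₁ x) (inj₂ j) ≡ A′ (inj₁ zero) (inj₂ j)
      out-in  : ∀ i y → A (inj₂ i) (inj₁ y) ≡ A′ (inj₂ i) (inj₁ zero)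

  open Collapses public

  restrict : ∀ P I → Arrangement (P ⊕ I) → Arrangement P
  restrict P I A x y = A (inj₁ x) (inj₁ y)

  -- T is a finite set of types of structures.  F I A t is the type of the
  -- structure obtained from A by substituting for every point x a structure of
  -- type t x; hence the entries of A on the diagonal are irrelevant.
  record Algebra : Set₁ where
    field
      T  : Finite
      F  : (I : Finite) → Arrangement I → (El I → El T) → El T
      F-≃ : ∀ {I J} (π : I ≃ J) {A A′ t t′} → Agree {I} {J} (to π) A A′ →
            (∀ x → t x ≡ t′ (to π x)) → F I A t ≡ F J A′ t′
      F-collapse : ∀ P I {A A′} t → Collapses {P} {I} A A′ →
        F (P ⊕ I) A t ≡ F (fin 1 ⊕ I) A′ [ constant (F P (restrict P I A) (t ∘ inj₁)) , t ∘ inj₂ ]′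

    F-cong : ∀ I {A t t′} → (∀ x → t x ≡ t′ x) → F I A t ≡ F I A t′
    F-cong I = F-≃ (≃-refl {I}) (λ _ _ _ → refl)

  record Recognizer (Γ : Set) : Set₁ where
    field
      algebra : Algebra
    open Algebra algebra public
    field
      sing : Γ → El T
      acc  : El T → Bool

    accepts : (I : Finite) → Arrangement I → (El I → Γ) → Bool
    accepts I A γ = acc (F I A (sing ∘ γ))

  open Recognizer public using (accepts)

  module _ {Γ : Set} (R : Recognizer Γ) where
    open Recognizer R hiding (accepts)

    complement : Recognizer Γ
    complement = record { algebra = algebra ; sing = sing ; acc = not ∘ acc }

    comap : {Γ′ : Set} → (Γ′ → Γ) → Recognizer Γ′
    comap f = record { algebra = algebra ; sing = sing ∘ f ; acc = acc }

  module _ {Γ : Set} (_∙_ : Bool → Bool → Bool) (R S : Recognizer Γ) where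
    private
      module R = Recognizer R
      module S = Recognizer S

    combine : Recognizer Γ
    combine = record
      { algebra = record
        { T = R.T ⊗ S.T
        ; F = λ I A t → R.F I A (proj₁ ∘ t) , S.F I A (proj₂ ∘ t)
        ; F-≃ = λ π agree eq → cong₂ _,_ (R.F-≃ π agree (cong proj₁ ∘ eq))
                                         (S.F-≃ π agree (cong proj₂ ∘ eq))
        ; F-collapse = λ P I t col → cong₂ _,_
            (trans (R.F-collapse P I (proj₁ ∘ t) col)
                   (R.F-cong (fin 1 ⊕ I) λ { (inj₁ _) → refl ; (inj₂ _) → refl }))
            (trans (S.F-collapse P I (proj₂ ∘ t) col)
                   (S.F-cong (fin 1 ⊕ I) λ { (inj₁ _) → refl ; (inj₂ _) → refl }))
        }
      ; sing = λ γ → R.sing γ , S.sing γ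
      ; acc = λ (t , u) → R.acc t ∙ S.acc u
      }

  ⟦_⟧₀₁ : Bool → ℕ
  ⟦ true ⟧₀₁  = 1
  ⟦ false ⟧₀₁ = 0

  -- red is the projection of (ℕ, +) onto a finite quotient monoid.
  module _ {Γ : Set} {k : ℕ} (red : ℕ → Fin k)
           (red-+ : ∀ a c → red (toℕ (red a) + c) ≡ red (a + c))
           (P : Γ → Bool) (Q : Fin k → Bool) where

    private
      red-∑ : ∀ I (f : El I → ℕ) → red (∑ I (toℕ ∘ red ∘ f)) ≡ red (∑ I f)
      red-∑ I f = trans (cong red (sym (ℕₚ.+-identityʳ _)))
        (trans (go (elements I) 0) (cong red (ℕₚ.+-identityʳ _)))
        where
        open ≡-Reasoning
        -- `red-+` reduces only a left summand that stands at the front. The head is unreduced there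
        -- and then parked in the accumulator `c`.
        go : ∀ xs c → red (sum (List.map (toℕ ∘ red ∘ f) xs) + c) ≡ red (sum (List.map f xs) + c)
        go [] c = refl
        go (x ∷ xs) c = begin
          red (toℕ (red (f x)) + s′ + c)   ≡⟨ cong red (ℕₚ.+-assoc (toℕ (red (f x))) s′ c) ⟩
          red (toℕ (red (f x)) + (s′ + c)) ≡⟨ red-+ (f x) (s′ + c) ⟩
          red (f x + (s′ + c))             ≡⟨ cong red (x+[s+c] (f x) s′ c) ⟩
          red (s′ + (f x + c))             ≡⟨ go xs (f x + c) ⟩
          red (s + (f x + c))              ≡⟨ cong red (x+[s+c] (f x) s c) ⟨
          red (f x + (s + c))              ≡⟨ cong red (ℕₚ.+-assoc (f x) s c) ⟨
          red (f x + s + c)                ∎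
          where
          s′ = sum (List.map (toℕ ∘ red ∘ f) xs)
          s  = sum (List.map f xs)
          x+[s+c] : ∀ x s c → x + (s + c) ≡ s + (x + c)
          x+[s+c] x s c = trans (sym (ℕₚ.+-assoc x s c))
            (trans (cong (_+ c) (ℕₚ.+-comm x s)) (ℕₚ.+-assoc s x c))

    counting′ : Recognizer Γ
    counting′ = record
      { algebra = record
        { T = fin k
        ; F = λ I A t → red (∑ I (toℕ ∘ t))
        ; F-≃ = λ {I} {J} π {t = t} {t′} agree eq → cong red
            (trans (∑-cong I (cong toℕ ∘ eq)) (∑-≃ {I} {J} π (toℕ ∘ t′)))
        ; F-collapse = λ P I t _ → begin
            red (∑ (P ⊕ I) (toℕ ∘ t))
              ≡⟨ cong red (∑-⊕ P I (toℕ ∘ t)) ⟩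
            red (∑ P (toℕ ∘ t ∘ inj₁) + ∑ I (toℕ ∘ t ∘ inj₂))
              ≡⟨ red-+ _ (∑ I (toℕ ∘ t ∘ inj₂)) ⟨
            red (toℕ (red (∑ P (toℕ ∘ t ∘ inj₁))) + ∑ I (toℕ ∘ t ∘ inj₂))
              ≡⟨ cong (λ z → red (z + ∑ I (toℕ ∘ t ∘ inj₂))) (ℕₚ.+-identityʳ _) ⟨
            red (toℕ (red (∑ P (toℕ ∘ t ∘ inj₁))) + 0 + ∑ I (toℕ ∘ t ∘ inj₂))
              ≡⟨ cong red (∑-⊕ (fin 1) I _) ⟨
            red (∑ (fin 1 ⊕ I) (toℕ ∘ [ constant (red (∑ P (toℕ ∘ t ∘ inj₁))) , t ∘ inj₂ ]′)) ∎
        }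
      ; sing = λ γ → red ⟦ P γ ⟧₀₁
      ; acc = Q
      }
      where open ≡-Reasoning

    accepts-counting′ : ∀ I A γ →
      accepts counting′ I A γ ≡ Q (red (∑ I (λ x → ⟦ P (γ x) ⟧₀₁)))
    accepts-counting′ I A γ = cong Q (red-∑ I (λ x → ⟦ P (γ x) ⟧₀₁))

  Agree-sym : ∀ {I J} (π : I ≃ J) {A A′} → Agree {I} {J} (to π) A A′ →
              Agree {J} {I} (from π) A′ A
  Agree-sym {I} {J} π {A} {A′} agree x y x≢y = sym (trans
    (agree (from π x) (from π y) (x≢y ∘ to-injective (≃-sym {I} {J} π)))
    (cong₂ A′ (to-from π x) (to-from π y)))

  Some : ∀ I → (El I → Bool) → Set
  Some I p = ∃[ x ] p x ≡ true

  some? : ∀ I p → Dec (Some I p)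
  some? I p = ∃? I (λ x → p x ≟ᵇ true)

  from-does : ∀ {X : Set} (d : Dec X) → does d ≡ true → X
  from-does (yes x) _ = x

  Some-⊕ : ∀ P I (p : El (P ⊕ I) → Bool) (p′ : El (fin 1 ⊕ I) → Bool) →
           p′ (inj₁ zero) ≡ does (some? P (p ∘ inj₁)) → (∀ i → p′ (inj₂ i) ≡ p (inj₂ i)) →
           Some (P ⊕ I) p ⇔ Some (fin 1 ⊕ I) p′
  Some-⊕ P I p p′ e₁ e₂ = mk⇔
    (λ { (inj₁ x , e) → inj₁ zero , trans e₁ (dec-true (some? P (p ∘ inj₁)) (x , e))
       ; (inj₂ i , e) → inj₂ i , trans (e₂ i) e })
    (λ { (inj₁ zero , e) → let x , e′ = from-does (some? P (p ∘ inj₁)) (trans (sym e₁) e)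
                           in inj₁ x , e′
       ; (inj₂ i , e) → inj₂ i , trans (sym (e₂ i)) e })

  Some-≃ : ∀ {I J} (π : I ≃ J) {p p′} → (∀ x → p x ≡ p′ (to π x)) → Some I p ⇔ Some J p′
  Some-≃ π {p} {p′} e = mk⇔
    (λ (x , px) → to π x , trans (sym (e x)) px)
    (λ (y , py) → from π y , trans (e (from π y)) (trans (cong p′ (to-from π y)) py))

  -- The relation holds between some point satisfying p and some point
  -- satisfying q.  It is given by l on the diagonal and by E elsewhere.
  module _ (E : Bin → Bool) where

    Edge : ∀ I → Arrangement I → (p q l : El I → Bool) → Set
    Edge I A p q l = Some I l ⊎
      ∃[ x ] ∃[ y ] x ≢ y × p x ≡ true × q y ≡ true × E (A x y) ≡ true

    edge? : ∀ I A p q l → Dec (Edge I A p q l)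
    edge? I A p q l = some? I l ⊎-dec ∃? I (λ x → ∃? I (λ y →
      ¬? (_≟E_ I x y) ×-dec (p x ≟ᵇ true) ×-dec (q y ≟ᵇ true) ×-dec (E (A x y) ≟ᵇ true)))

    Edge-to : ∀ {I J} (π : I ≃ J) {A A′} → Agree {I} {J} (to π) A A′ → ∀ {p q l p′ q′ l′} →
              (∀ x → p x ≡ p′ (to π x)) → (∀ x → q x ≡ q′ (to π x)) →
              (∀ x → l x ≡ l′ (to π x)) → Edge I A p q l → Edge J A′ p′ q′ l′
    Edge-to π agree ep eq el (inj₁ (x , e)) = inj₁ (to π x , trans (sym (el x)) e)
    Edge-to π agree ep eq el (inj₂ (x , y , x≢y , px , qy , e)) = inj₂
      ( to π x , to π y , x≢y ∘ to-injective π
      , trans (sym (ep x)) px , trans (sym (eq y)) qy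
      , trans (cong E (sym (agree x y x≢y))) e )

    Edge-≃ : ∀ {I J} (π : I ≃ J) {A A′} → Agree {I} {J} (to π) A A′ → ∀ {p q l p′ q′ l′} →
             (∀ x → p x ≡ p′ (to π x)) → (∀ x → q x ≡ q′ (to π x)) →
             (∀ x → l x ≡ l′ (to π x)) → Edge I A p q l ⇔ Edge J A′ p′ q′ l′
    Edge-≃ {I} {J} π {A} {A′} agree {p} {q} {l} {p′} {q′} {l′} ep eq el = mk⇔
      (Edge-to π agree ep eq el)
      (Edge-to (≃-sym {I} {J} π) (Agree-sym {I} {J} π agree)
        (back p p′ ep) (back q q′ eq) (back l l′ el))
      where
      back : ∀ p p′ → (∀ x → p x ≡ p′ (to π x)) → ∀ y → p′ y ≡ p (from π y)
      back p p′ e y = trans (cong p′ (sym (to-from π y))) (sym (e (from π y)))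

    -- Whether a point inside the module is related to one outside does not depend on the point
    -- inside. So all that matters about the module is whether it meets `p`, whether it meets `q`
    -- and whether it contains an edge itself; the last bit becomes the loop of the point replacing
    -- it. These are the three bits of `adjacency′`.
    Edge-⊕ : ∀ P I {A A′} → Collapses {P} {I} A A′ → ∀ p q l p′ q′ l′ →
      p′ (inj₁ zero) ≡ does (some? P (p ∘ inj₁)) → (∀ i → p′ (inj₂ i) ≡ p (inj₂ i)) →
      q′ (inj₁ zero) ≡ does (some? P (q ∘ inj₁)) → (∀ i → q′ (inj₂ i) ≡ q (inj₂ i)) →
      l′ (inj₁ zero) ≡ does (edge? P (restrict P I A) (p ∘ inj₁) (q ∘ inj₁) (l ∘ inj₁)) →
      (∀ i → l′ (inj₂ i) ≡ l (inj₂ i)) →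
      Edge (P ⊕ I) A p q l ⇔ Edge (fin 1 ⊕ I) A′ p′ q′ l′
    Edge-⊕ P I {A} {A′} col p q l p′ q′ l′ p₁ p₂ q₁ q₂ l₁ l₂ = mk⇔ fwd bwd
      where
      inner : Edge P (restrict P I A) (p ∘ inj₁) (q ∘ inj₁) (l ∘ inj₁) →
              Edge (fin 1 ⊕ I) A′ p′ q′ l′
      inner e = inj₁ (inj₁ zero , trans l₁ (dec-true (edge? P _ _ _ _) e))

      fwd : Edge (P ⊕ I) A p q l → Edge (fin 1 ⊕ I) A′ p′ q′ l′
      fwd (inj₁ (inj₁ x , e)) = inner (inj₁ (x , e))
      fwd (inj₁ (inj₂ i , e)) = inj₁ (inj₂ i , trans (l₂ i) e)
      fwd (inj₂ (inj₁ x , inj₁ y , x≢y , px , qy , e)) =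
        inner (inj₂ (x , y , x≢y ∘ cong inj₁ , px , qy , e))
      fwd (inj₂ (inj₁ x , inj₂ j , _ , px , qj , e)) =
        inj₂ (inj₁ zero , inj₂ j , (λ ()) , trans p₁ (dec-true (some? P _) (x , px))
             , trans (q₂ j) qj , trans (cong E (sym (in-out col x j))) e)
      fwd (inj₂ (inj₂ i , inj₁ y , _ , pi , qy , e)) =
        inj₂ (inj₂ i , inj₁ zero , (λ ()) , trans (p₂ i) pi
             , trans q₁ (dec-true (some? P _) (y , qy)) , trans (cong E (sym (out-in col i y))) e)
      fwd (inj₂ (inj₂ i , inj₂ j , i≢j , pi , qj , e)) =
        inj₂ (inj₂ i , inj₂ j , (λ { refl → i≢j refl }) , trans (p₂ i) pi
             , trans (q₂ j) qj , trans (cong E (sym (out-out col i j))) e)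

      bwd : Edge (fin 1 ⊕ I) A′ p′ q′ l′ → Edge (P ⊕ I) A p q l
      bwd (inj₁ (inj₁ zero , e)) with from-does (edge? P _ _ _ _) (trans (sym l₁) e)
      ... | inj₁ (x , lx) = inj₁ (inj₁ x , lx)
      ... | inj₂ (x , y , x≢y , px , qy , e′) =
        inj₂ (inj₁ x , inj₁ y , x≢y ∘ inj₁-injective , px , qy , e′)
      bwd (inj₁ (inj₂ i , e)) = inj₁ (inj₂ i , trans (sym (l₂ i)) e)
      bwd (inj₂ (inj₁ zero , inj₁ zero , x≢y , _)) = ⊥-elim (x≢y refl)
      bwd (inj₂ (inj₁ zero , inj₂ j , _ , px , qj , e))
        with from-does (some? P _) (trans (sym p₁) px)
      ... | x , px′ = inj₂ (inj₁ x , inj₂ j , (λ ()) , px′ , trans (sym (q₂ j)) qj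
                           , trans (cong E (in-out col x j)) e)
      bwd (inj₂ (inj₂ i , inj₁ zero , _ , pi , qy , e))
        with from-does (some? P _) (trans (sym q₁) qy)
      ... | y , qy′ = inj₂ (inj₂ i , inj₁ y , (λ ()) , trans (sym (p₂ i)) pi , qy′
                           , trans (cong E (out-in col i y)) e)
      bwd (inj₂ (inj₂ i , inj₂ j , i≢j , pi , qj , e)) =
        inj₂ (inj₂ i , inj₂ j , (λ { refl → i≢j refl }) , trans (sym (p₂ i)) pi
             , trans (sym (q₂ j)) qj , trans (cong E (out-out col i j)) e)

    adjacency′ : {Γ : Set} (P Q L : Γ → Bool) → Recognizer Γ
    adjacency′ P Q L = record
      { algebra = record
        { T = bool ⊗ bool ⊗ bool
        ; F = F
        ; F-≃ = λ {I} {J} π agree eq →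
            cong₂ _,_ (does-⇔ (Some-≃ {I} {J} π (cong proj₁ ∘ eq)) (some? I _) (some? J _))
            (cong₂ _,_ (does-⇔ (Some-≃ {I} {J} π (cong (proj₁ ∘ proj₂) ∘ eq)) (some? I _) (some? J _))
                       (does-⇔ (Edge-≃ {I} {J} π agree (cong proj₁ ∘ eq) (cong (proj₁ ∘ proj₂) ∘ eq)
                                         (cong (proj₂ ∘ proj₂) ∘ eq)) (edge? I _ _ _ _) (edge? J _ _ _ _)))
        ; F-collapse = collapse
        }
      ; sing = λ γ → P γ , Q γ , L γ
      ; acc = proj₂ ∘ proj₂
      }
      where
      F : (I : Finite) → Arrangement I → (El I → Bool × Bool × Bool) → Bool × Bool × Bool
      F I A t = does (some? I (proj₁ ∘ t)) , does (some? I (proj₁ ∘ proj₂ ∘ t))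
              , does (edge? I A (proj₁ ∘ t) (proj₁ ∘ proj₂ ∘ t) (proj₂ ∘ proj₂ ∘ t))

      collapse : ∀ P I {A A′} t → Collapses {P} {I} A A′ → F (P ⊕ I) A t ≡
        F (fin 1 ⊕ I) A′ [ constant (F P (restrict P I A) (t ∘ inj₁)) , t ∘ inj₂ ]′
      collapse P I {A} {A′} t col =
        cong₂ _,_ (does-⇔ (Some-⊕ P I p p′ refl (λ _ → refl))
                          (some? (P ⊕ I) p) (some? (fin 1 ⊕ I) p′))
        (cong₂ _,_ (does-⇔ (Some-⊕ P I q q′ refl (λ _ → refl))
                           (some? (P ⊕ I) q) (some? (fin 1 ⊕ I) q′))
                   (does-⇔ (Edge-⊕ P I col p q l p′ q′ l′ refl (λ _ → refl) refl (λ _ → refl)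
                                   refl (λ _ → refl))
                           (edge? (P ⊕ I) A p q l) (edge? (fin 1 ⊕ I) A′ p′ q′ l′)))
        where
        p = proj₁ ∘ t
        q = proj₁ ∘ proj₂ ∘ t
        l = proj₂ ∘ proj₂ ∘ t

        t′ : El (fin 1 ⊕ I) → Bool × Bool × Bool
        t′ = [ constant (F P (restrict P I A) (t ∘ inj₁)) , t ∘ inj₂ ]′

        p′ = proj₁ ∘ t′
        q′ = proj₁ ∘ proj₂ ∘ t′
        l′ = proj₂ ∘ proj₂ ∘ t′

    adjacency-reflects′ : ∀ {Γ} (P Q L : Γ → Bool) I A γ →
      Reflects (Edge I A (P ∘ γ) (Q ∘ γ) (L ∘ γ)) (accepts (adjacency′ P Q L) I A γ)
    adjacency-reflects′ P Q L I A γ = proof (edge? I A _ _ _)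

  module _ {Γ Γ′ : Set} (R : Recognizer Γ′) (extend : Bool → Γ → Γ′) where
    open Recognizer R hiding (accepts)

    private
      Sets : Finite
      Sets = Table T bool

      _∋_ : El Sets → El T → Set
      S ∋ t = _!_ {T} {bool} S t ≡ true

      collect : {P : El T → Set} → Decidable P → El Sets
      collect P? = tab {T} {bool} (λ t → does (P? t))

      collect-∋ : {P : El T → Set} (P? : Decidable P) → ∀ {t} → collect P? ∋ t → P t
      collect-∋ P? {t} e = from-does (P? t) (trans (sym (!-tab {T} {bool} _ t)) e)

      ∋-collect : {P : El T → Set} (P? : Decidable P) → ∀ {t} → P t → collect P? ∋ t
      ∋-collect P? {t} p = trans (!-tab {T} {bool} _ t) (dec-true (P? t) p)

      collect-cong : {P Q : El T → Set} (P? : Decidable P) (Q? : Decidable Q) →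
                     (∀ t → P t ⇔ Q t) → collect P? ≡ collect Q?
      collect-cong P? Q? eq = tab-cong {T} {bool} (λ t → does-⇔ (eq t) (P? t) (Q? t))

      -- The powerset construction, as in the determinization of automata: a point carries the set
      -- of types that it may have, depending on the guessed bits, and the result collects all types
      -- that some selection produces.
      Choice : ∀ I → Arrangement I → (El I → El Sets) → El T → Set
      Choice I A S t = ∃[ u ] (∀ x → S x ∋ u x) × F I A u ≡ t

      choice? : ∀ I A S → Decidable (Choice I A S)
      choice? I A S t = ∃-function? {I} {T}
        (λ eq (m , e) → (λ x → subst (S x ∋_) (eq x) (m x)) , trans (sym (F-cong I eq)) e)
        (λ u → ∀? I (λ x → _ ≟ᵇ true) ×-dec _≟E_ T (F I A u) t)

      Choice-to : ∀ {I J} (π : I ≃ J) {A A′ S S′ t} → Agree {J} {I} (from π) A′ A →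
        (∀ y → S (from π y) ≡ S′ y) → Choice I A S t → Choice J A′ S′ t
      Choice-to {I} {J} π {t = t} agree eq (u , m , e) = u ∘ from π ,
        (λ y → subst (_∋ u (from π y)) (eq y) (m (from π y))) ,
        trans (F-≃ (≃-sym {I} {J} π) agree (λ _ → refl)) e

      F′ : ∀ I → Arrangement I → (El I → El Sets) → El Sets
      F′ I A S = collect (choice? I A S)

      -- Selections inside and outside the module are independent. A type chosen for the replacing
      -- point is by definition the result of some selection inside, and the two selections are
      -- glued.
      collapse-⇔ : ∀ P I {A A′} S → Collapses {P} {I} A A′ → ∀ t →
        Choice (P ⊕ I) A S t ⇔
        Choice (fin 1 ⊕ I) A′ [ constant (F′ P (restrict P I A) (S ∘ inj₁)) , S ∘ inj₂ ]′ t
      collapse-⇔ P I {A} S col t = mk⇔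
        (λ (u , m , e) → [ constant (F P (restrict P I A) (u ∘ inj₁)) , u ∘ inj₂ ]′ ,
          (λ { (inj₁ _) → ∋-collect (choice? P (restrict P I A) (S ∘ inj₁)) (u ∘ inj₁ , m ∘ inj₁ , refl)
             ; (inj₂ i) → m (inj₂ i) }) ,
          trans (sym (F-collapse P I u col)) e)
        (λ (u , m , e) → let v , n , e′ = collect-∋ (choice? P (restrict P I A) (S ∘ inj₁)) (m (inj₁ zero)) in
          [ v , u ∘ inj₂ ]′ , (λ { (inj₁ x) → n x ; (inj₂ i) → m (inj₂ i) }) ,
          trans (F-collapse P I _ col)
            (trans (F-cong (fin 1 ⊕ I) λ { (inj₁ zero) → e′ ; (inj₂ _) → refl }) e))

      Accepting : El Sets → Set
      Accepting S = ∃[ t ] S ∋ t × acc t ≡ true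

      accepting? : Decidable Accepting
      accepting? S = ∃? T (λ t → (_ ≟ᵇ true) ×-dec (acc t ≟ᵇ true))

      Letter : Γ → El T → Set
      Letter γ t = ∃[ β ] sing (extend β γ) ≡ t

      letter? : ∀ γ → Decidable (Letter γ)
      letter? γ t = ∃? bool (λ β → _≟E_ T (sing (extend β γ)) t)

    existential′ : Recognizer Γ
    existential′ = record
      { algebra = record
        { T = Sets
        ; F = F′
        ; F-≃ = λ {I} {J} π {A} {A′} {S} {S′} agree eq → collect-cong (choice? I A S) (choice? J A′ S′) (λ t → mk⇔
            (Choice-to {I} {J} π {A} {A′} {S} {S′} (Agree-sym {I} {J} π agree)
              (λ y → trans (eq (from π y)) (cong S′ (to-from π y))))
            (Choice-to {J} {I} (≃-sym {I} {J} π) {A′} {A} {S′} {S} agree (sym ∘ eq)))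
        ; F-collapse = λ P I {A} {A′} S col → collect-cong (choice? (P ⊕ I) A S)
            (choice? (fin 1 ⊕ I) A′ [ constant (F′ P (restrict P I A) (S ∘ inj₁)) , S ∘ inj₂ ]′)
            (collapse-⇔ P I S col)
        }
      ; sing = λ γ → collect (letter? γ)
      ; acc = λ S → does (accepting? S)
      }

    accepts-existential′ : ∀ I A γ → accepts existential′ I A γ ≡ true ⇔
      (∃[ s ] accepts R I A (λ x → extend (s x) (γ x)) ≡ true)
    accepts-existential′ I A γ = mk⇔
      (λ e → let t , t∈ , a = from-does (accepting? S) e
                 u , m , e′ = collect-∋ (choice? I A U) t∈
                 letter = λ x → collect-∋ (letter? (γ x)) (m x)
             in (λ x → proj₁ (letter x)) ,
                trans (cong acc (trans (F-cong I (proj₂ ∘ letter)) e′)) a)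
      (λ (s , a) → dec-true (accepting? S)
        (F I A (λ x → sing (extend (s x) (γ x))) ,
         ∋-collect (choice? I A U)
           (_ , (λ x → ∋-collect (letter? (γ x)) (s x , refl)) , refl) , a))
      where
      U : El I → El Sets
      U x = collect (letter? (γ x))

      S : El Sets
      S = F′ I A U

  -- Abstract, since unfolding these recognizers is too expensive.
  abstract
    counting : {Γ : Set} {k : ℕ} (red : ℕ → Fin k) →
      (∀ a c → red (toℕ (red a) + c) ≡ red (a + c)) → (Γ → Bool) → (Fin k → Bool) → Recognizer Γ
    counting = counting′

    accepts-counting : ∀ {Γ k} (red : ℕ → Fin k) red-+ (P : Γ → Bool) Q I A γ →
      accepts (counting red red-+ P Q) I A γ ≡ Q (red (∑ I (λ x → ⟦ P (γ x) ⟧₀₁)))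
    accepts-counting = accepts-counting′

    adjacency : (Bin → Bool) → {Γ : Set} → (P Q L : Γ → Bool) → Recognizer Γ
    adjacency = adjacency′

    adjacency-reflects : ∀ E {Γ} (P Q L : Γ → Bool) I A γ →
      Reflects (Edge E I A (P ∘ γ) (Q ∘ γ) (L ∘ γ)) (accepts (adjacency E P Q L) I A γ)
    adjacency-reflects = adjacency-reflects′

    existential : {Γ Γ′ : Set} → Recognizer Γ′ → (Bool → Γ → Γ′) → Recognizer Γ
    existential = existential′

    accepts-existential : ∀ {Γ Γ′} (R : Recognizer Γ′) (extend : Bool → Γ → Γ′) I A γ →
      accepts (existential R extend) I A γ ≡ true ⇔
      (Σ[ s ∈ (El I → Bool) ] accepts R I A (λ x → extend (s x) (γ x)) ≡ true)
    accepts-existential = accepts-existential′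

-- Formulas are recognizable

reflects : ∀ {A : Set} {β} → A ⇔ β ≡ true → Reflects A β
reflects {β = true}  eq = ofʸ (Equivalence.from eq refl)
reflects {β = false} eq = ofⁿ λ a → case Equivalence.to eq a of λ ()

reflected : ∀ {A : Set} {β} → Reflects A β → A ⇔ β ≡ true
reflected (ofʸ a)  = mk⇔ (λ _ → refl) (λ _ → a)
reflected (ofⁿ ¬a) = mk⇔ (λ a → ⊥-elim (¬a a)) (λ ())

reflects-map : ∀ {A B : Set} {β} → A ⇔ B → Reflects A β → Reflects B β
reflects-map eq (ofʸ a)  = ofʸ (Equivalence.to eq a)
reflects-map eq (ofⁿ ¬a) = ofⁿ (¬a ∘ Equivalence.from eq)

⇔-reflects : ∀ {A B : Set} {α β} → Reflects A α → Reflects B β → Reflects (A ⇔ B) (does (α ≟ᵇ β))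
⇔-reflects (ofʸ a)  (ofʸ b)  = ofʸ (mk⇔ (λ _ → b) (λ _ → a))
⇔-reflects (ofʸ a)  (ofⁿ ¬b) = ofⁿ (λ eq → ¬b (Equivalence.to eq a))
⇔-reflects (ofⁿ ¬a) (ofʸ b)  = ofⁿ (λ eq → ¬a (Equivalence.from eq b))
⇔-reflects (ofⁿ ¬a) (ofⁿ ¬b) = ofʸ (mk⇔ (⊥-elim ∘ ¬a) (⊥-elim ∘ ¬b))

≡[mod]⇔% : ∀ m .{{_ : NonZero m}} a b → (+ a) ≡ (+ b) [mod m ] ⇔ a % m ≡ b % m
≡[mod]⇔% m a b = mk⇔ fwd bwd
  where
  open ≡-Reasoning

  step : ∀ a b → b ≤ a → (+ a) ≡ (+ b) [mod m ] → a % m ≡ b % m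
  step a b b≤a d = begin
    a % m           ≡⟨ cong (_% m) (ℕₚ.m∸n+n≡m b≤a) ⟨
    (a ∸ b + b) % m ≡⟨ %-remove-+ˡ b (ℤ∣.∣⇒∣ᵤ (subst (λ z → + m ℤ∣.∣ z)
                         (trans (ℤₚ.m-n≡m⊖n a b) (ℤₚ.⊖-≥ b≤a)) d)) ⟩
    b % m           ∎

  fwd : (+ a) ≡ (+ b) [mod m ] → a % m ≡ b % m
  fwd d with ℕₚ.≤-total b a
  ... | inj₁ b≤a = step a b b≤a d
  ... | inj₂ a≤b = sym (step b a a≤b (subst (λ z → + m ℤ∣.∣ z)
                     (flip-- (+ a) (+ b)) (ℤ∣.∣m⇒∣-m d)))
    where
    flip-- : ∀ x y → ℤ.- (x ℤ.- y) ≡ y ℤ.- x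
    flip-- = solve-∀

  bwd : a % m ≡ b % m → (+ a) ≡ (+ b) [mod m ]
  bwd eq = ℤ∣.divides (+ (a / m) ℤ.- + (b / m)) (begin
    + a ℤ.- + b
      ≡⟨ cong₂ ℤ._-_ (expand a) (expand b) ⟩
    (+ (a % m) ℤ.+ + (a / m) ℤ.* + m) ℤ.- (+ (b % m) ℤ.+ + (b / m) ℤ.* + m)
      ≡⟨ cong (λ z → (+ z ℤ.+ + (a / m) ℤ.* + m) ℤ.- (+ (b % m) ℤ.+ + (b / m) ℤ.* + m)) eq ⟩
    (+ (b % m) ℤ.+ + (a / m) ℤ.* + m) ℤ.- (+ (b % m) ℤ.+ + (b / m) ℤ.* + m)
      ≡⟨ factor (+ (b % m)) (+ (a / m)) (+ (b / m)) (+ m) ⟩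
    (+ (a / m) ℤ.- + (b / m)) ℤ.* + m ∎)
    where
    expand : ∀ a → + a ≡ + (a % m) ℤ.+ + (a / m) ℤ.* + m
    expand a = trans (cong +_ (m≡m%n+[m/n]*n a m))
      (cong (λ z → + (a % m) ℤ.+ z) (ℤₚ.pos-* (a / m) m))

    factor : ∀ r x y m → (r ℤ.+ x ℤ.* m) ℤ.- (r ℤ.+ y ℤ.* m) ≡ (x ℤ.- y) ℤ.* m
    factor = solve-∀

-- The quotient of (ℕ, +) in which all numbers from 2 on are identified; it is just fine enough to
-- recognize singletons.
saturate : ℕ → Fin 3
saturate 0             = zero
saturate 1             = suc zero
saturate (suc (suc _)) = suc (suc zero)

saturate-+ : ∀ a c → saturate (toℕ (saturate a) + c) ≡ saturate (a + c)
saturate-+ 0             c = refl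
saturate-+ 1             c = refl
saturate-+ (suc (suc _)) c = refl

is-one : Fin 3 → Bool
is-one i = does (i ≟ᶠ suc zero)

mod-+ : ∀ m .{{_ : NonZero m}} a c → (toℕ (a mod m) + c) mod m ≡ (a + c) mod m
mod-+ m a c = toℕ-injective (begin
  toℕ ((toℕ (a mod m) + c) mod m) ≡⟨ toℕ-fromℕ< _ ⟩
  (toℕ (a mod m) + c) % m         ≡⟨ cong (λ z → (z + c) % m) (toℕ-fromℕ< _) ⟩
  (a % m + c) % m                 ≡⟨ %-distribˡ-+ (a % m) c m ⟩
  (a % m % m + c % m) % m         ≡⟨ cong (λ z → (z + c % m) % m) (m%n%n≡m%n a m) ⟩
  (a % m + c % m) % m             ≡⟨ %-distribˡ-+ a c m ⟨
  (a + c) % m                     ≡⟨ toℕ-fromℕ< _ ⟨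
  toℕ ((a + c) mod m)             ∎)
  where open ≡-Reasoning

∑-fin-suc : ∀ n (f : Fin (suc n) → ℕ) → ∑ (fin (suc n)) f ≡ f zero + ∑ (fin n) (f ∘ suc)
∑-fin-suc n f = cong (λ xs → f zero + sum xs)
  (trans (Listₚ.map-tabulate suc f) (sym (Listₚ.map-tabulate id (f ∘ suc))))

module Semantics (τ : Vocabulary) where
  open TypeAlgebras (#binary τ)

  -- The colour of a point: its unary predicates, its loops, and for every
  -- constant, element variable and set variable, whether the point is (in) it.
  record Colour (j k : ℕ) : Set where
    constructor colour
    field
      unaries   : Vec Bool (#unary τ)
      loops     : Vec Bool (#binary τ)
      constants : Vec Bool (#constants τ)
      elems     : Vec Bool j
      sets      : Vec Bool k

  open Colour

  addElem : ∀ {j k} → Bool → Colour j k → Colour (suc j) k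
  addElem β (colour u l c e s) = colour u l c (β ∷ e) s

  addSet : ∀ {j k} → Bool → Colour j k → Colour j (suc k)
  addSet β (colour u l c e s) = colour u l c e (β ∷ s)

  denotedBy : ∀ {j k} → Term τ j → Colour j k → Bool
  denotedBy (var x)   γ = lookup (elems γ) x
  denotedBy (const c) γ = lookup (constants γ) c

  -- Without edges, `adjacency` is left with asking for a loop, and `P` takes the place of the loop
  -- predicate.
  some : {Γ : Set} → (Γ → Bool) → Recognizer Γ
  some P = adjacency (λ _ → false) (λ _ → false) (λ _ → false) P

  -- An element quantifier is a set quantifier restricted to singletons, so element variables become
  -- bits of the colour just like set variables.
  some-elem : {Γ Γ′ : Set} → Recognizer Γ′ → (Γ′ → Bool) → (Bool → Γ → Γ′) → Recognizer Γ
  some-elem R mark extend =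
    existential (combine _∧_ (counting saturate saturate-+ mark is-one) R) extend

  every-elem : {Γ Γ′ : Set} → Recognizer Γ′ → (Γ′ → Bool) → (Bool → Γ → Γ′) → Recognizer Γ
  every-elem R mark extend = complement (some-elem (complement R) mark extend)

  firstElem : ∀ {j k} → Colour (suc j) k → Bool
  firstElem γ = lookup (elems γ) zero

  -- The quantifier C[ m , r ] asserts the existence of a set that agrees with R
  -- everywhere and has size r modulo m.
  module _ {j k : ℕ} (m : ℕ) .{{_ : NonZero m}} (r : ℕ) (R : Recognizer (Colour (suc j) k)) where

    membership : Recognizer (Bool × Colour (suc j) k)
    membership = some (λ (σ , γ) → firstElem γ ∧ σ)

    addElem′ : Bool → Bool × Colour j k → Bool × Colour (suc j) k
    addElem′ β (σ , γ) = σ , addElem β γ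

    agreement : Recognizer (Bool × Colour (suc j) k)
    agreement = combine (λ x y → does (x ≟ᵇ y)) membership (comap R proj₂)

    same-size : Recognizer (Bool × Colour j k)
    same-size = counting (_mod m) (mod-+ m) proj₁ (λ i → does (toℕ i ≟ r % m))

    modular : Recognizer (Colour j k)
    modular = existential
      (combine _∧_ (every-elem agreement (firstElem ∘ proj₂) addElem′) same-size) _,_

  recognizer : ∀ {j k} → Formula τ j k → Recognizer (Colour j k)
  recognizer (s ≐ t) = some (λ γ → denotedBy s γ ∧ denotedBy t γ)
  recognizer (unaryᶠ U t) = some (λ γ → denotedBy t γ ∧ lookup (unaries γ) U)
  recognizer (binaryᶠ R s t) = adjacency (λ bits → lookup bits R) (denotedBy s) (denotedBy t)
    (λ γ → denotedBy s γ ∧ (denotedBy t γ ∧ lookup (loops γ) R))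
  recognizer (t ∈ᶠ X) = some (λ γ → denotedBy t γ ∧ lookup (sets γ) X)
  recognizer (¬ᶠ φ) = complement (recognizer φ)
  recognizer (φ ∧ᶠ ψ) = combine _∧_ (recognizer φ) (recognizer ψ)
  recognizer (φ ∨ᶠ ψ) = combine _∨_ (recognizer φ) (recognizer ψ)
  recognizer (φ ⇒ᶠ ψ) = combine (λ x y → not x ∨ y) (recognizer φ) (recognizer ψ)
  recognizer (∃ᶠ φ) = some-elem (recognizer φ) firstElem addElem
  recognizer (∀ᶠ φ) = every-elem (recognizer φ) firstElem addElem
  recognizer (∃ˢ φ) = existential (recognizer φ) addSet
  recognizer (∀ˢ φ) = complement (existential (complement (recognizer φ)) addSet)
  recognizer (C[ m , r ] φ) = modular m r (recognizer φ)

  accepts-cong : ∀ {Γ} (R : Recognizer Γ) I A {γ γ′} → (∀ x → γ x ≡ γ′ x) →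
                 accepts R I A γ ≡ accepts R I A γ′
  accepts-cong R I A eq = cong acc (F-cong I (cong sing ∘ eq))
    where open Recognizer R

  some-reflects : ∀ {Γ} (P : Γ → Bool) I A γ →
                  Reflects (∃[ x ] P (γ x) ≡ true) (accepts (some P) I A γ)
  some-reflects P I A γ = reflects-map
    (mk⇔ (λ { (inj₁ e) → e ; (inj₂ (_ , _ , _ , () , _)) }) inj₁)
    (adjacency-reflects (λ _ → false) (λ _ → false) (λ _ → false) P I A γ)

  existential-reflects : ∀ {Γ Γ′} (R : Recognizer Γ′) (extend : Bool → Γ → Γ′) N A γ →
    Reflects (∃[ S ] accepts R (fin N) A (λ x → extend (lookup S x) (γ x)) ≡ true)
             (accepts (existential R extend) (fin N) A γ)
  existential-reflects R extend N A γ = reflects-map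
    (mk⇔ (λ (s , a) → tabulate s , trans (accepts-cong R (fin N) A
            (λ x → cong (λ β → extend β (γ x)) (Vecₚ.lookup∘tabulate s x))) a)
         (λ (S , a) → lookup S , a))
    (reflects (mk⇔ (Equivalence.from eq) (Equivalence.to eq)))
    where eq = accepts-existential R extend (fin N) A γ

  ∑≡0⇔none : ∀ N (s : Fin N → Bool) → ∑ (fin N) (⟦_⟧₀₁ ∘ s) ≡ 0 ⇔ (∀ x → s x ≡ false)
  ∑≡0⇔none zero    s = mk⇔ (λ _ ()) (λ _ → refl)
  ∑≡0⇔none (suc N) s rewrite ∑-fin-suc N (⟦_⟧₀₁ ∘ s) with s zero in eq
  ... | true  = mk⇔ (λ ()) (λ f → case trans (sym eq) (f zero) of λ ())
  ... | false = mk⇔ (λ { e zero → eq ; e (suc x) → Equivalence.to (∑≡0⇔none N (s ∘ suc)) e x })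
                    (λ f → Equivalence.from (∑≡0⇔none N (s ∘ suc)) (f ∘ suc))

  ∑≡1⇔singleton : ∀ N (s : Fin N → Bool) →
    ∑ (fin N) (⟦_⟧₀₁ ∘ s) ≡ 1 ⇔ (∃[ e ] ∀ x → s x ≡ does (e ≟ᶠ x))
  ∑≡1⇔singleton zero    s = mk⇔ (λ ()) (λ ())
  ∑≡1⇔singleton (suc N) s rewrite ∑-fin-suc N (⟦_⟧₀₁ ∘ s) with s zero in eq
  ... | true  = mk⇔
    (λ e → zero , λ { zero → eq
                    ; (suc x) → Equivalence.to (∑≡0⇔none N (s ∘ suc)) (ℕₚ.suc-injective e) x })
    (λ { (zero , f) → cong suc (Equivalence.from (∑≡0⇔none N (s ∘ suc)) (f ∘ suc))
       ; (suc e , f) → case trans (sym eq) (f zero) of λ () })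
  ... | false = mk⇔
    (λ e → let e′ , f = Equivalence.to (∑≡1⇔singleton N (s ∘ suc)) e
           in suc e′ , λ { zero → eq ; (suc x) → f x })
    (λ { (zero , f) → case trans (sym eq) (f zero) of λ ()
       ; (suc e , f) → Equivalence.from (∑≡1⇔singleton N (s ∘ suc)) (e , f ∘ suc) })

  ∑-lookup : ∀ {N} (S : Subset N) → ∑ (fin N) (⟦_⟧₀₁ ∘ lookup S) ≡ ∣ S ∣
  ∑-lookup []                    = refl
  ∑-lookup {suc N} (true ∷ S)  = trans (∑-fin-suc N (⟦_⟧₀₁ ∘ lookup (true ∷ S))) (cong suc (∑-lookup S))
  ∑-lookup {suc N} (false ∷ S) = trans (∑-fin-suc N (⟦_⟧₀₁ ∘ lookup (false ∷ S))) (∑-lookup S)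

  saturate≡1 : ∀ n → saturate n ≡ suc zero ⇔ n ≡ 1
  saturate≡1 0             = mk⇔ (λ ()) (λ ())
  saturate≡1 1             = mk⇔ (λ _ → refl) (λ _ → refl)
  saturate≡1 (suc (suc _)) = mk⇔ (λ ()) (λ ())

  ∧-true : ∀ {x y} → x ∧ y ≡ true ⇔ (x ≡ true × y ≡ true)
  ∧-true {true}  = mk⇔ (λ e → refl , e) proj₂
  ∧-true {false} = mk⇔ (λ ()) (λ ())

  not-true : ∀ {x} → not x ≡ true ⇔ (¬ x ≡ true)
  not-true {true}  = mk⇔ (λ ()) (λ f → ⊥-elim (f refl))
  not-true {false} = mk⇔ (λ _ ()) (λ _ → refl)

  module _ {Γ Γ′ : Set} (mark : Γ′ → Bool) (extend : Bool → Γ → Γ′)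
           (mark-extend : ∀ β γ → mark (extend β γ) ≡ β)
           (N : ℕ) (A : Arrangement (fin N)) (γ : Fin N → Γ) where

    point : Fin N → Fin N → Γ′
    point e x = extend (does (e ≟ᶠ x)) (γ x)

    some-elem-reflects : (R : Recognizer Γ′) →
      Reflects (∃[ e ] accepts R (fin N) A (point e) ≡ true)
               (accepts (some-elem R mark extend) (fin N) A γ)
    some-elem-reflects R = reflects-map (mk⇔ fwd bwd)
      (reflects (mk⇔ (Equivalence.from eq) (Equivalence.to eq)))
      where
      Q = combine _∧_ (counting saturate saturate-+ mark is-one) R
      eq = accepts-existential Q extend (fin N) A γ

      marked : ∀ s → ∑ (fin N) (λ x → ⟦ mark (extend (s x) (γ x)) ⟧₀₁) ≡ ∑ (fin N) (⟦_⟧₀₁ ∘ s)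
      marked s = ∑-cong (fin N) (λ x → cong ⟦_⟧₀₁ (mark-extend (s x) (γ x)))

      fwd : _ → ∃[ e ] accepts R (fin N) A (point e) ≡ true
      fwd (s , a) with Equivalence.to ∧-true a
      ... | one , a′ with Equivalence.to (∑≡1⇔singleton N s) (trans (sym (marked s))
              (Equivalence.to (saturate≡1 _) (from-does (_ ≟ᶠ suc zero)
                (trans (sym (accepts-counting saturate saturate-+ mark is-one (fin N) A _)) one))))
      ... | e , f = e , trans (accepts-cong R (fin N) A
                          (λ x → cong (λ β → extend β (γ x)) (sym (f x)))) a′

      bwd : (∃[ e ] accepts R (fin N) A (point e) ≡ true) →
            ∃[ s ] accepts Q (fin N) A (λ x → extend (s x) (γ x)) ≡ true
      bwd (e , a) = (λ x → does (e ≟ᶠ x)) , Equivalence.from ∧-true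
        ( trans (accepts-counting saturate saturate-+ mark is-one (fin N) A _)
            (dec-true (_ ≟ᶠ suc zero) (cong saturate (trans (marked _)
              (Equivalence.from (∑≡1⇔singleton N _) (e , λ _ → refl)))))
        , a )

    every-elem-reflects : (R : Recognizer Γ′) →
      Reflects (∀ e → accepts R (fin N) A (point e) ≡ true)
               (accepts (every-elem R mark extend) (fin N) A γ)
    every-elem-reflects R = reflects-map
      (mk⇔ (λ ¬∃ e → decidable-stable (_ ≟ᵇ true) (λ ¬a → ¬∃ (e , Equivalence.from not-true ¬a)))
           (λ all (e , a) → Equivalence.to not-true a (all e)))
      (¬-reflects (some-elem-reflects (complement R)))

  module _ {N : ℕ} (M : Structure τ N) where
    open Structure M using (unary; binary) renaming (constants to named)

    arrangement : Arrangement (fin N)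
    arrangement x y = Vec.map (λ R → lookup (lookup R x) y) binary

    colouring : ∀ {j k} → Vec (Fin N) j → Vec (Subset N) k → Fin N → Colour j k
    colouring v V x = colour
      (Vec.map (λ U → lookup U x) unary) (Vec.map (λ R → lookup (lookup R x) x) binary)
      (Vec.map (λ e → does (e ≟ᶠ x)) named) (Vec.map (λ e → does (e ≟ᶠ x)) v)
      (Vec.map (λ S → lookup S x) V)

    denoted : ∀ {j k} (t : Term τ j) v (V : Vec (Subset N) k) x →
              denotedBy t (colouring v V x) ≡ does (⟦_⟧ M t v ≟ᶠ x)
    denoted (var i)   v V x = Vecₚ.lookup-map i _ v
    denoted (const c) v V x = Vecₚ.lookup-map c _ named

    denoted⇔ : ∀ {j k} (t : Term τ j) v (V : Vec (Subset N) k) x →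
               denotedBy t (colouring v V x) ≡ true ⇔ ⟦_⟧ M t v ≡ x
    denoted⇔ t v V x = mk⇔ (λ e → from-does (_ ≟ᶠ x) (trans (sym (denoted t v V x)) e))
                           (λ e → trans (denoted t v V x) (dec-true (_ ≟ᶠ x) e))

    ∈⇔lookup : ∀ {n} {S : Subset n} {x} → (x Subset.∈ S) ⇔ lookup S x ≡ true
    ∈⇔lookup {S = S} {x} = mk⇔ Vecₚ.[]=⇒lookup (Vecₚ.lookup⇒[]= x S)

    -- Exactly one point is denoted by `t`, so asking for some denoted point with `P` is the same as
    -- asking for `P` at the value of `t`. This turns atomic formulas into instances of `some`.
    at-term : ∀ {j k} (t : Term τ j) v (V : Vec (Subset N) k) (P : Fin N → Bool) {Q : Set} →
      P (⟦_⟧ M t v) ≡ true ⇔ Q →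
      (∃[ x ] denotedBy t (colouring v V x) ∧ P x ≡ true) ⇔ Q
    at-term t v V P eq = mk⇔
      (λ (x , e) → let d , p = Equivalence.to ∧-true e in
         Equivalence.to eq (subst (λ z → P z ≡ true) (sym (Equivalence.to (denoted⇔ t v V x) d)) p))
      (λ q → _ , Equivalence.from ∧-true
         (Equivalence.from (denoted⇔ t v V _) refl , Equivalence.from eq q))

    module _ {j k : ℕ} (m : ℕ) .{{_ : NonZero m}} (r : ℕ) (R : Recognizer (Colour (suc j) k))
             (v : Vec (Fin N) j) (V : Vec (Subset N) k) {P : Fin N → Set}
             (R-reflects : ∀ e → Reflects (P e) (accepts R (fin N) arrangement (colouring (e ∷ v) V)))
             where

      with-set : Subset N → Fin N → Bool × Colour j k
      with-set S x = lookup S x , colouring v V x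

      membership-reflects : ∀ S e → Reflects (e Subset.∈ S)
        (accepts (membership m r R) (fin N) arrangement (λ x → lookup S x , colouring (e ∷ v) V x))
      membership-reflects S e = reflects-map (mk⇔
        (λ (x , a) → let d , s = Equivalence.to ∧-true a in Equivalence.from ∈⇔lookup
           (trans (cong (lookup S) (from-does (e ≟ᶠ x) d)) s))
        (λ m → e , Equivalence.from ∧-true (dec-true (e ≟ᶠ e) refl , Equivalence.to ∈⇔lookup m)))
        (some-reflects (λ (σ , γ) → firstElem γ ∧ σ) (fin N) arrangement
          (λ x → lookup S x , colouring (e ∷ v) V x))

      agreement-reflects : ∀ S e → Reflects (e Subset.∈ S ⇔ P e)
        (accepts (agreement m r R) (fin N) arrangement (λ x → lookup S x , colouring (e ∷ v) V x))
      agreement-reflects S e = ⇔-reflects (membership-reflects S e) (R-reflects e)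

      defined-reflects : ∀ S → Reflects (∀ e → e Subset.∈ S ⇔ P e)
        (accepts (every-elem (agreement m r R) (firstElem ∘ proj₂) (addElem′ m r R))
                 (fin N) arrangement (with-set S))
      defined-reflects S = reflects-map
        (mk⇔ (λ a e → Equivalence.from (reflected (agreement-reflects S e)) (a e))
             (λ a e → Equivalence.to (reflected (agreement-reflects S e)) (a e)))
        (every-elem-reflects (firstElem ∘ proj₂) (addElem′ m r R) (λ _ _ → refl) N arrangement
          (with-set S) (agreement m r R))

      same-size-reflects : ∀ S → Reflects (+ ∣ S ∣ ≡ + r [mod m ])
        (accepts (same-size m r R) (fin N) arrangement (with-set S))
      same-size-reflects S = subst (Reflects _)
        (sym (accepts-counting (_mod m) (mod-+ m) proj₁ (λ i → does (toℕ i ≟ r % m))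
          (fin N) arrangement (with-set S)))
        (reflects-map
          (mk⇔ (λ e → Equivalence.from (≡[mod]⇔% m ∣ S ∣ r) (trans (sym card%) e))
               (λ e → trans card% (Equivalence.to (≡[mod]⇔% m ∣ S ∣ r) e)))
          (proof (toℕ (∑ (fin N) (⟦_⟧₀₁ ∘ lookup S) mod m) ≟ r % m)))
        where
        card% : toℕ (∑ (fin N) (⟦_⟧₀₁ ∘ lookup S) mod m) ≡ ∣ S ∣ % m
        card% = trans (toℕ-fromℕ< _) (cong (_% m) (∑-lookup S))

      defined : Recognizer (Bool × Colour j k)
      defined = every-elem (agreement m r R) (firstElem ∘ proj₂) (addElem′ m r R)

      both-⇔ : ∀ S → accepts (combine _∧_ defined (same-size m r R)) (fin N) arrangement (with-set S) ≡ true
        ⇔ ((∀ e → e Subset.∈ S ⇔ P e) × + ∣ S ∣ ≡ + r [mod m ])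
      both-⇔ S = mk⇔
        (λ a → let d , c = Equivalence.to (∧-true {x} {y}) a in
           Equivalence.from (reflected (defined-reflects S)) d ,
           Equivalence.from (reflected (same-size-reflects S)) c)
        (λ (d , c) → Equivalence.from (∧-true {x} {y})
           ( Equivalence.to (reflected (defined-reflects S)) d
           , Equivalence.to (reflected (same-size-reflects S)) c))
        where
        x = accepts defined (fin N) arrangement (with-set S)
        y = accepts (same-size m r R) (fin N) arrangement (with-set S)

      modular-reflects : Reflects (∃[ S ] (∀ e → e Subset.∈ S ⇔ P e) × + ∣ S ∣ ≡ + r [mod m ])
        (accepts (modular m r R) (fin N) arrangement (colouring v V))
      modular-reflects = reflects-map
        (mk⇔ (λ (S , a) → S , Equivalence.to (both-⇔ S) a)
             (λ (S , a) → S , Equivalence.from (both-⇔ S) a))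
        (existential-reflects (combine _∧_ defined (same-size m r R))
          _,_ N arrangement (colouring v V))

    sat-reflects : ∀ {j k} (φ : Formula τ j k) v V →
      Reflects (Sat M φ v V) (accepts (recognizer φ) (fin N) arrangement (colouring v V))
    sat-reflects (s ≐ t) v V = reflects-map
      (at-term s v V (λ x → denotedBy t (colouring v V x))
        (mk⇔ (sym ∘ Equivalence.to (denoted⇔ t v V _)) (Equivalence.from (denoted⇔ t v V _) ∘ sym)))
      (some-reflects (λ γ → denotedBy s γ ∧ denotedBy t γ) (fin N) arrangement (colouring v V))
    sat-reflects (unaryᶠ U t) v V = reflects-map
      (at-term t v V (λ x → lookup (Colour.unaries (colouring v V x)) U)
        (mk⇔ (λ e → Equivalence.from ∈⇔lookup (trans (sym (Vecₚ.lookup-map U _ unary)) e))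
             (λ m → trans (Vecₚ.lookup-map U _ unary) (Equivalence.to ∈⇔lookup m))))
      (some-reflects (λ γ → denotedBy t γ ∧ lookup (unaries γ) U) (fin N) arrangement (colouring v V))
    sat-reflects (binaryᶠ R s t) v V = reflects-map (mk⇔ fwd bwd)
      (adjacency-reflects E (denotedBy s) (denotedBy t) L (fin N) arrangement (colouring v V))
      where
      E : Bin → Bool
      E bits = lookup bits R

      L : Colour _ _ → Bool
      L γ = denotedBy s γ ∧ (denotedBy t γ ∧ lookup (Colour.loops γ) R)

      p q l : Fin N → Bool
      p x = denotedBy s (colouring v V x)
      q x = denotedBy t (colouring v V x)
      l x = p x ∧ (q x ∧ lookup (Colour.loops (colouring v V x)) R)

      related : ∀ x y → E (arrangement x y) ≡ true ⇔ (y Subset.∈ lookup (lookup binary R) x)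
      related x y = mk⇔
        (λ e → Equivalence.from ∈⇔lookup (trans (sym (Vecₚ.lookup-map R _ binary)) e))
        (λ m → trans (Vecₚ.lookup-map R _ binary) (Equivalence.to ∈⇔lookup m))

      fwd : Edge E (fin N) arrangement p q l → Sat M (binaryᶠ R s t) v V
      fwd (inj₁ (x , e)) with Equivalence.to ∧-true e
      ... | px , e′ with Equivalence.to ∧-true e′
      ... | qx , lx with Equivalence.to (denoted⇔ s v V x) px | Equivalence.to (denoted⇔ t v V x) qx
      ... | refl | eq = subst (λ z → z Subset.∈ _) (sym eq) (Equivalence.to (related x x) lx)
      fwd (inj₂ (x , y , _ , px , qy , e))
        with Equivalence.to (denoted⇔ s v V x) px | Equivalence.to (denoted⇔ t v V y) qy
      ... | refl | refl = Equivalence.to (related x y) e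

      bwd : Sat M (binaryᶠ R s t) v V → Edge E (fin N) arrangement p q l
      -- Edges are only sought between distinct points. If both terms denote the same point, the
      -- loop stored in its colour is the witness.
      bwd m with ⟦_⟧ M s v ≟ᶠ ⟦_⟧ M t v
      ... | no s≢t = inj₂ (_ , _ , s≢t , Equivalence.from (denoted⇔ s v V _) refl
                          , Equivalence.from (denoted⇔ t v V _) refl
                          , Equivalence.from (related _ _) m)
      ... | yes s≡t = inj₁ (_ , Equivalence.from ∧-true
              ( Equivalence.from (denoted⇔ s v V _) refl
              , Equivalence.from ∧-true
                  ( Equivalence.from (denoted⇔ t v V _) (sym s≡t)
                  , Equivalence.from (related _ _) (subst (λ z → z Subset.∈ _) (sym s≡t) m))))
    sat-reflects (t ∈ᶠ X) v V = reflects-map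
      (at-term t v V (λ x → lookup (Colour.sets (colouring v V x)) X)
        (mk⇔ (λ e → Equivalence.from ∈⇔lookup (trans (sym (Vecₚ.lookup-map X _ V)) e))
             (λ m → trans (Vecₚ.lookup-map X _ V) (Equivalence.to ∈⇔lookup m))))
      (some-reflects (λ γ → denotedBy t γ ∧ lookup (sets γ) X) (fin N) arrangement (colouring v V))
    sat-reflects (¬ᶠ φ) v V = ¬-reflects (sat-reflects φ v V)
    sat-reflects (φ ∧ᶠ ψ) v V = sat-reflects φ v V ×-reflects sat-reflects ψ v V
    sat-reflects (φ ∨ᶠ ψ) v V = sat-reflects φ v V ⊎-reflects sat-reflects ψ v V
    sat-reflects (φ ⇒ᶠ ψ) v V = sat-reflects φ v V →-reflects sat-reflects ψ v V
    sat-reflects (∃ᶠ φ) v V = reflects-map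
      (mk⇔ (λ (e , a) → e , Equivalence.from (reflected (sat-reflects φ (e ∷ v) V)) a)
           (λ (e , a) → e , Equivalence.to (reflected (sat-reflects φ (e ∷ v) V)) a))
      (some-elem-reflects firstElem addElem (λ _ _ → refl) N arrangement (colouring v V)
        (recognizer φ))
    sat-reflects (∀ᶠ φ) v V = reflects-map
      (mk⇔ (λ a e → Equivalence.from (reflected (sat-reflects φ (e ∷ v) V)) (a e))
           (λ a e → Equivalence.to (reflected (sat-reflects φ (e ∷ v) V)) (a e)))
      (every-elem-reflects firstElem addElem (λ _ _ → refl) N arrangement (colouring v V)
        (recognizer φ))
    sat-reflects (∃ˢ φ) v V = reflects-map
      (mk⇔ (λ (S , a) → S , Equivalence.from (reflected (sat-reflects φ v (S ∷ V))) a)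
           (λ (S , a) → S , Equivalence.to (reflected (sat-reflects φ v (S ∷ V))) a))
      (existential-reflects (recognizer φ) addSet N arrangement (colouring v V))
    sat-reflects (∀ˢ φ) v V = reflects-map
      (mk⇔ (λ ¬∃ S → Equivalence.from (reflected (sat-reflects φ v (S ∷ V)))
              (decidable-stable (_ ≟ᵇ true) (λ ¬a → ¬∃ (S , Equivalence.from not-true ¬a))))
           (λ all (S , a) → Equivalence.to not-true a
              (Equivalence.to (reflected (sat-reflects φ v (S ∷ V))) (all S))))
      (¬-reflects (existential-reflects (complement (recognizer φ)) addSet N arrangement
        (colouring v V)))
    sat-reflects (C[ m , r ] φ) v V =
      modular-reflects m r (recognizer φ) v V (λ e → sat-reflects φ (e ∷ v) V)

-- Free actions of products of cyclic groups

module _ {A : Set} {P R : A → Set} (P? : Decidable P) (R? : Decidable R) where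

  filter-absorb : ∀ xs → (∀ x → P x → R x) → filter P? (filter R? xs) ≡ filter P? xs
  filter-absorb [] _ = refl
  filter-absorb (x ∷ xs) P⊆R with R? x
  ... | no ¬r = trans (filter-absorb xs P⊆R) (sym (Listₚ.filter-reject P? (¬r ∘ P⊆R x)))
  ... | yes _ with does (P? x)
  ... | true  = cong (x ∷_) (filter-absorb xs P⊆R)
  ... | false = filter-absorb xs P⊆R

  length-filter-split : ∀ (xs : List A) →
    length xs ≡ length (filter R? xs) + length (filter (¬? ∘ R?) xs)
  length-filter-split [] = refl
  length-filter-split (x ∷ xs) with does (R? x)
  ... | true  = cong suc (length-filter-split xs)
  ... | false = trans (cong suc (length-filter-split xs)) (sym (ℕₚ.+-suc _ _))

module _ {A : Set} {_~_ : A → A → Set} (_~?_ : ∀ x y → Dec (x ~ y))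
         (~-refl : ∀ x → x ~ x) (~-sym : ∀ {x y} → x ~ y → y ~ x)
         (~-trans : ∀ {x y z} → x ~ y → y ~ z → x ~ z) (d : ℕ) where

  -- The class of the head is split off; by transitivity and symmetry the classes of the remaining
  -- elements survive this intact. The bound `n` makes the recursion structural, as the rest is a
  -- filtered list.
  class-size-divides : ∀ n (xs : List A) → length xs ≤ n →
    (∀ {x} → x ∈ xs → d ℕ∣.∣ length (filter (x ~?_) xs)) → d ℕ∣.∣ length xs
  class-size-divides n [] _ _ = d ℕ∣.∣0
  class-size-divides (suc n) (x ∷ xs) (s≤s len) div =
    subst (d ℕ∣.∣_) (sym (length-filter-split (x ~?_) (x ~?_) (x ∷ xs)))
      (ℕ∣.∣m∣n⇒∣m+n (div (here refl)) (class-size-divides n rest shorter div′))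
    where
    others? : ∀ y → Dec (¬ x ~ y)
    others? y = ¬? (x ~? y)

    rest : List A
    rest = filter others? (x ∷ xs)

    shorter : length rest ≤ n
    shorter = ℕₚ.≤-trans (ℕₚ.≤-reflexive (cong length
        (Listₚ.filter-reject others? (λ ¬r → ¬r (~-refl x)))))
      (ℕₚ.≤-trans (Listₚ.length-filter others? xs) len)

    div′ : ∀ {z} → z ∈ rest → d ℕ∣.∣ length (filter (z ~?_) rest)
    div′ {z} z∈ with ∈-filter⁻ others? {xs = x ∷ xs} z∈
    ... | z∈xs , x≁z = subst (λ ys → d ℕ∣.∣ length ys)
      (sym (filter-absorb (z ~?_) others? (x ∷ xs) (λ y z~y x~y → x≁z (~-trans x~y (~-sym z~y)))))
      (div z∈xs)

length-cartesianProductWith : ∀ {A B C : Set} (f : A → B → C) xs ys →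
  length (cartesianProductWith f xs ys) ≡ length xs * length ys
length-cartesianProductWith f [] ys = refl
length-cartesianProductWith f (x ∷ xs) ys = trans (Listₚ.length-++ (List.map (f x) ys))
  (cong₂ _+_ (Listₚ.length-map (f x) ys) (length-cartesianProductWith f xs ys))

replicate-+ : ∀ {A : Set} a c (t : A) → List.replicate (a + c) t ≡ List.replicate a t ++ List.replicate c t
replicate-+ zero    c t = refl
replicate-+ (suc a) c t = cong (t ∷_) (replicate-+ a c t)

-- A product of cyclic groups of prime orders p i, generated by the σ i, acting
-- on X.  The projections pr i j (where j is suc of an index, or zero) are
-- equivariant, take values on which only the i-th and the j-th factor act
-- non-trivially, and for fixed i jointly detect whether σ i moves a point.
record PairwiseAction (X : Finite) (N : ℕ) : Set where
  field
    p       : Fin N → ℕ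
    p-prime : ∀ i → Prime (p i)
    σ       : Fin N → El X → El X
    σ-comm  : ∀ i j x → σ i (σ j x) ≡ σ j (σ i x)

  act : List (Fin N) → El X → El X
  act w x = List.foldr σ x w

  power : ℕ → Fin N → List (Fin N)
  power a i = List.replicate a i

  field
    σ-order  : ∀ i x → act (power (p i) i) x ≡ x
    pr       : Fin N → Fin (suc N) → El X → El X
    pr-σ     : ∀ i j l x → pr i j (σ l x) ≡ σ l (pr i j x)
    pr-fixed : ∀ i j l x → l ≢ i → suc l ≢ j → σ l (pr i j x) ≡ pr i j x
    pr-moved : ∀ i x → σ i x ≢ x → ∃[ j ] σ i (pr i j x) ≢ pr i j x

  instance
    p-nonZero : ∀ {i} → NonZero (p i)
    p-nonZero {i} = prime⇒nonZero (p-prime i)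

  act-++ : ∀ u w x → act (u ++ w) x ≡ act u (act w x)
  act-++ u w x = Listₚ.foldr-++ σ x u w

  σ-act : ∀ i w x → σ i (act w x) ≡ act w (σ i x)
  σ-act i []      x = refl
  σ-act i (j ∷ w) x = trans (σ-comm i j (act w x)) (cong (σ j) (σ-act i w x))

  act-comm : ∀ u w x → act u (act w x) ≡ act w (act u x)
  act-comm []      w x = refl
  act-comm (i ∷ u) w x = trans (cong (σ i) (act-comm u w x)) (σ-act i w (act u x))

  act-power-+ : ∀ a c i x → act (power (a + c) i) x ≡ act (power a i) (act (power c i) x)
  act-power-+ a c i x =
    trans (cong (λ w → act w x) (replicate-+ a c i)) (act-++ (power a i) (power c i) x)

  act-power-fix : ∀ {a i x} k → act (power a i) x ≡ x → act (power (k * a) i) x ≡ x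
  act-power-fix         zero    fix = refl
  act-power-fix {a} {i} (suc k) fix = trans (act-power-+ a (k * a) i _)
    (trans (cong (act (power a i)) (act-power-fix k fix)) fix)

  act-power-∣ : ∀ {a i} x → p i ℕ∣.∣ a → act (power a i) x ≡ x
  act-power-∣ {i = i} x (ℕ∣.divides-refl k) = act-power-fix k (σ-order i x)

  act-power-% : ∀ a i x → act (power (a % p i) i) x ≡ act (power a i) x
  act-power-% a i x = sym (trans (cong (λ z → act (power z i) x) (m≡m%n+[m/n]*n a (p i)))
    (trans (act-power-+ (a % p i) _ i x)
      (cong (act (power (a % p i) i)) (act-power-∣ x (ℕ∣.n∣m*n (a / p i))))))

  -- Primality enters here: if `p i` did not divide `a`, the two would be coprime, and a Bézout
  -- identity would write `σ i` in terms of powers that fix `z`.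
  moved⇒∣ : ∀ {a i z} → σ i z ≢ z → act (power a i) z ≡ z → p i ℕ∣.∣ a
  moved⇒∣ {a} {i} {z} moved fix with p i ℕ∣.∣? a
  ... | yes p∣a = p∣a
  ... | no  p∤a = ⊥-elim (moved fixed)
    where
    coprime : Coprime (p i) a
    coprime (d∣p , d∣a) with prime⇒irreducible (p-prime i) d∣p
    ... | inj₁ refl = refl
    ... | inj₂ refl = ⊥-elim (p∤a d∣a)

    from-powers : ∀ {u v} → 1 + u ≡ v → act (power u i) z ≡ z → act (power v i) z ≡ z → σ i z ≡ z
    from-powers refl eu ev = trans (cong (σ i) (sym eu)) ev

    fixed : σ i z ≡ z
    fixed with coprime-Bézout coprime
    ... | Bézout.+- x y eq = from-powers eq (act-power-fix y fix) (act-power-fix x (σ-order i z))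
    ... | Bézout.-+ x y eq = from-powers eq (act-power-fix x (σ-order i z)) (act-power-fix y fix)

  act-pr : ∀ i j w x → pr i j (act w x) ≡ act w (pr i j x)
  act-pr i j []      x = refl
  act-pr i j (l ∷ w) x = trans (pr-σ i j l (act w x)) (cong (σ l) (act-pr i j w x))

  Moves : Fin N → Fin (suc N) → El X → Set
  Moves i j x = σ i (pr i j x) ≢ pr i j x

  Moves? : ∀ i j → Decidable (Moves i j)
  Moves? i j x = ¬? (_≟E_ X _ _)

  σ-injective : ∀ i {x y} → σ i x ≡ σ i y → x ≡ y
  σ-injective i {x} {y} eq = trans (sym (back x)) (trans (cong (act (power (p i ∸ 1) i)) eq) (back y))
    where
    back : ∀ z → act (power (p i ∸ 1) i) (σ i z) ≡ z
    back z = trans (sym (σ-act i (power (p i ∸ 1) i) z))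
      (subst (λ k → act (power k i) z ≡ z)
        (sym (ℕₚ.m+[n∸m]≡n (>-nonZero⁻¹ (p i)))) (σ-order i z))

  -- Because the generators commute, being moved is constant on orbits, so splitting an invariant
  -- set by `Moves i j` yields invariant parts.
  Moves-σ : ∀ {i j} l {x} → Moves i j x → Moves i j (σ l x)
  Moves-σ {i} {j} l {x} moved eq = moved (σ-injective l (begin
    σ l (σ i (pr i j x)) ≡⟨ σ-comm l i _ ⟩
    σ i (σ l (pr i j x)) ≡⟨ cong (σ i) (pr-σ i j l x) ⟨
    σ i (pr i j (σ l x)) ≡⟨ eq ⟩
    pr i j (σ l x)       ≡⟨ pr-σ i j l x ⟩
    σ l (pr i j x)       ∎))
    where open ≡-Reasoning

  Chain : Set
  Chain = List (Fin N × Fin (suc N))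

  used : Chain → List (Fin (suc N))
  used []            = []
  used ((i , j) ∷ J) = suc i ∷ j ∷ used J

  -- New pairs are put at the front. Only their block `i` must avoid the earlier pairs; the partner
  -- `j` is dictated by the structure and may coincide with an earlier block or with `suc i`.
  Fresh : Chain → Set
  Fresh []            = ⊤
  Fresh ((i , j) ∷ J) = suc i ∉ used J × Fresh J

  MovesAll : Chain → El X → Set
  MovesAll J x = All (λ (i , j) → Moves i j x) J

  Exponents : Chain → Set
  Exponents J = Vec ℕ (length J)

  word : ∀ J → Exponents J → List (Fin N)
  word []            []       = []
  word ((i , _) ∷ J) (a ∷ as) = power a i ++ word J as

  Trivial : ∀ J → Exponents J → Set
  Trivial []            []       = ⊤
  Trivial ((i , _) ∷ J) (a ∷ as) = p i ℕ∣.∣ a × Trivial J as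

  act-trivial : ∀ J as x → Trivial J as → act (word J as) x ≡ x
  act-trivial []            []       x _         = refl
  act-trivial ((i , _) ∷ J) (a ∷ as) x (d , triv) =
    trans (act-++ (power a i) (word J as) x)
      (trans (cong (act (power a i)) (act-trivial J as x triv)) (act-power-∣ x d))

  -- The hypothesis is strengthened by the word h to make the induction work:
  -- the projection to the pair (i , j) at the head of the chain is not affected
  -- by h, and the tail of the chain is dealt with first.
  stabilizer-trivial : ∀ J → Fresh J → ∀ {x} → MovesAll J x → ∀ h →
    All (λ l → suc l ∉ used J) h → ∀ as → act h (act (word J as) x) ≡ x → Trivial J as
  stabilizer-trivial [] _ _ _ _ [] _ = tt
  stabilizer-trivial ((i , j) ∷ J) (i∉ , fresh) {x} (moved ∷ movesJ) h h∉ (a ∷ as) fix =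
    moved⇒∣ moved fixed , triv
    where
    open ≡-Reasoning

    letters∉ : ∀ a → All (λ l → suc l ∉ used J) (power a i)
    letters∉ zero    = []
    letters∉ (suc a) = i∉ ∷ letters∉ a

    triv : Trivial J as
    triv = stabilizer-trivial J fresh movesJ (h ++ power a i)
      (Allₚ.++⁺ (All.map (λ l∉ → l∉ ∘ there ∘ there) h∉) (letters∉ a)) as (begin
        act (h ++ power a i) (act (word J as) x)    ≡⟨ act-++ h (power a i) _ ⟩
        act h (act (power a i) (act (word J as) x)) ≡⟨ cong (act h) (act-++ (power a i) _ x) ⟨
        act h (act (power a i ++ word J as) x)      ≡⟨ fix ⟩
        x                                           ∎)

    h-fixes : ∀ h → All (λ l → suc l ∉ used ((i , j) ∷ J)) h → act h (pr i j x) ≡ pr i j x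
    h-fixes []      []        = refl
    h-fixes (l ∷ h) (l∉ ∷ h∉) = trans (cong (σ l) (h-fixes h h∉))
      (pr-fixed i j l x (λ { refl → l∉ (here refl) }) (λ { refl → l∉ (there (here refl)) }))

    fixed : act (power a i) (pr i j x) ≡ pr i j x
    fixed = begin
      act (power a i) (pr i j x)                         ≡⟨ cong (act (power a i)) (h-fixes h h∉) ⟨
      act (power a i) (act h (pr i j x))                 ≡⟨ act-comm (power a i) h _ ⟩
      act h (act (power a i) (pr i j x))                 ≡⟨ cong (act h) (act-pr i j (power a i) x) ⟨
      act h (pr i j (act (power a i) x))                 ≡⟨ act-pr i j h _ ⟨
      pr i j (act h (act (power a i) x))                 ≡⟨ cong (pr i j ∘ act h ∘ act (power a i)) (act-trivial J as x triv) ⟨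
      pr i j (act h (act (power a i) (act (word J as) x))) ≡⟨ cong (pr i j ∘ act h) (act-++ (power a i) _ x) ⟨
      pr i j (act h (act (power a i ++ word J as) x))    ≡⟨ cong (pr i j) fix ⟩
      pr i j x                                           ∎

  -- Exponents reduced below the orders of the generators: the elements of the subgroup belonging to
  -- the chain, which list an orbit without repetition once the action on it is free.
  Box : Chain → Finite
  Box []            = fin 1
  Box ((i , _) ∷ J) = fin (p i) ⊗ Box J

  exponents : ∀ J → El (Box J) → Exponents J
  exponents []      _       = []
  exponents (_ ∷ J) (a , e) = toℕ a ∷ exponents J e

  reduce : ∀ J → Exponents J → El (Box J)
  reduce []            []       = zero
  reduce ((i , _) ∷ J) (a ∷ as) = a mod p i , reduce J as

  act-reduce : ∀ J as x → act (word J (exponents J (reduce J as))) x ≡ act (word J as) x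
  act-reduce []            []       x = refl
  act-reduce ((i , _) ∷ J) (a ∷ as) x = begin
    act (power (toℕ (a mod p i)) i ++ word J as′) x      ≡⟨ act-++ (power (toℕ (a mod p i)) i) _ x ⟩
    act (power (toℕ (a mod p i)) i) (act (word J as′) x) ≡⟨ cong₂ (λ k y → act (power k i) y) (toℕ-fromℕ< (m%n<n a (p i))) (act-reduce J as x) ⟩
    act (power (a % p i) i) (act (word J as) x)          ≡⟨ act-power-% a i _ ⟩
    act (power a i) (act (word J as) x)                  ≡⟨ act-++ (power a i) _ x ⟨
    act (power a i ++ word J as) x                       ∎
    where
    open ≡-Reasoning
    as′ = exponents J (reduce J as)

  add : ∀ J → Exponents J → Exponents J → Exponents J
  add J = Vec.zipWith _+_

  act-add : ∀ J as bs x → act (word J (add J as bs)) x ≡ act (word J as) (act (word J bs) x)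
  act-add []            []       []       x = refl
  act-add ((i , _) ∷ J) (a ∷ as) (c ∷ bs) x = begin
    act (power (a + c) i ++ word J (add J as bs)) x
      ≡⟨ act-++ (power (a + c) i) _ x ⟩
    act (power (a + c) i) (act (word J (add J as bs)) x)
      ≡⟨ cong (act (power (a + c) i)) (act-add J as bs x) ⟩
    act (power (a + c) i) (act (word J as) (act (word J bs) x))
      ≡⟨ act-power-+ a c i _ ⟩
    act (power a i) (act (power c i) (act (word J as) (act (word J bs) x)))
      ≡⟨ cong (act (power a i)) (act-comm (power c i) (word J as) _) ⟩
    act (power a i) (act (word J as) (act (power c i) (act (word J bs) x)))
      ≡⟨ act-++ (power a i) _ _ ⟨
    act (power a i ++ word J as) (act (power c i) (act (word J bs) x))
      ≡⟨ cong (act (power a i ++ word J as)) (act-++ (power c i) _ x) ⟨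
    act (power a i ++ word J as) (act (power c i ++ word J bs) x) ∎
    where open ≡-Reasoning

  -- As the generator has order dividing `p i`, the exponent `(p i ∸ 1) * a` inverts `a` without
  -- leaving ℕ.
  negate : ∀ J → Exponents J → Exponents J
  negate []            []       = []
  negate ((i , _) ∷ J) (a ∷ as) = (p i ∸ 1) * a ∷ negate J as

  suc-pred-p : ∀ i a → a + (p i ∸ 1) * a ≡ p i * a
  suc-pred-p i a = cong (_* a) (ℕₚ.m+[n∸m]≡n (>-nonZero⁻¹ (p i)))

  negate-trivial : ∀ J as → Trivial J (add J (negate J as) as)
  negate-trivial []            []       = tt
  negate-trivial ((i , _) ∷ J) (a ∷ as) =
    subst (p i ℕ∣.∣_) (trans (sym (suc-pred-p i a)) (ℕₚ.+-comm a _)) (ℕ∣.m∣m*n a) ,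
    negate-trivial J as

  act-negate : ∀ J as x → act (word J (negate J as)) (act (word J as) x) ≡ x
  act-negate J as x = trans (sym (act-add J (negate J as) as x))
    (act-trivial J _ x (negate-trivial J as))

  trivial-difference : ∀ J e e′ →
    Trivial J (add J (negate J (exponents J e)) (exponents J e′)) → e ≡ e′
  trivial-difference []            zero    zero      _          = refl
  trivial-difference ((i , _) ∷ J) (a , e) (a′ , e′) (d , triv) =
    cong₂ _,_ (toℕ-injective (begin
      toℕ a                                              ≡⟨ m<n⇒m%n≡m (toℕ<n a) ⟨
      -- By `d`, `p i` divides `(p i ∸ 1) * toℕ a + toℕ a′`. Adding `toℕ a` completes the first
      -- summand to a multiple of `p i`, so only `toℕ a′` remains.
      toℕ a % p i                                        ≡⟨ %-remove-+ˡ (toℕ a) d ⟨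
      ((p i ∸ 1) * toℕ a + toℕ a′ + toℕ a) % p i         ≡⟨ cong (_% p i) (rearrange ((p i ∸ 1) * toℕ a) (toℕ a′) (toℕ a)) ⟩
      (toℕ a + (p i ∸ 1) * toℕ a + toℕ a′) % p i         ≡⟨ cong (λ z → (z + toℕ a′) % p i) (suc-pred-p i (toℕ a)) ⟩
      (p i * toℕ a + toℕ a′) % p i                       ≡⟨ %-remove-+ˡ (toℕ a′) (ℕ∣.m∣m*n (toℕ a)) ⟩
      toℕ a′ % p i                                       ≡⟨ m<n⇒m%n≡m (toℕ<n a′) ⟩
      toℕ a′                                             ∎))
    (trivial-difference J e e′ triv)
    where
    open ≡-Reasoning
    open +-*-Solver

    rearrange : ∀ u v w → u + v + w ≡ w + u + v
    rearrange = solve 3 (λ u v w → u :+ v :+ w := w :+ u :+ v) refl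

  actᴮ : ∀ J → El (Box J) → El X → El X
  actᴮ J e = act (word J (exponents J e))

  actᴮ-injective : ∀ J → Fresh J → ∀ {x} → MovesAll J x → ∀ {e e′} →
    actᴮ J e x ≡ actᴮ J e′ x → e ≡ e′
  actᴮ-injective J fresh {x} movesJ {e} {e′} eq = sym (trivial-difference J e′ e
    (stabilizer-trivial J fresh movesJ [] [] _ (begin
      act (word J (add J (negate J as′) as)) x             ≡⟨ act-add J (negate J as′) as x ⟩
      act (word J (negate J as′)) (act (word J as) x)      ≡⟨ cong (act (word J (negate J as′))) eq ⟩
      act (word J (negate J as′)) (act (word J as′) x)     ≡⟨ act-negate J as′ x ⟩
      x                                                    ∎)))
    where
    open ≡-Reasoning
    as  = exponents J e
    as′ = exponents J e′

  _~⟨_⟩_ : El X → Chain → El X → Set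
  x ~⟨ J ⟩ y = ∃[ e ] actᴮ J e x ≡ y

  orbit : ∀ J as {x y} → act (word J as) x ≡ y → x ~⟨ J ⟩ y
  orbit J as {x} eq = reduce J as , trans (act-reduce J as x) eq

  ~-refl : ∀ J x → x ~⟨ J ⟩ x
  ~-refl J x = orbit J (Vec.replicate _ 0) (act-trivial J _ x (zeros J))
    where
    zeros : ∀ J → Trivial J (Vec.replicate _ 0)
    zeros []      = tt
    zeros (_ ∷ J) = (_ ℕ∣.∣0) , zeros J

  ~-sym : ∀ J {x y} → x ~⟨ J ⟩ y → y ~⟨ J ⟩ x
  ~-sym J {x} (e , refl) = orbit J (negate J (exponents J e)) (act-negate J _ x)

  ~-trans : ∀ J {x y z} → x ~⟨ J ⟩ y → y ~⟨ J ⟩ z → x ~⟨ J ⟩ z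
  ~-trans J {x} (e , refl) (e′ , refl) =
    orbit J (add J (exponents J e′) (exponents J e)) (act-add J (exponents J e′) (exponents J e) x)

  Invariant : (El X → Set) → Set
  Invariant Q = ∀ i {x} → Q x → Q (σ i x)

  invariant-act : ∀ {Q} → Invariant Q → ∀ w {x} → Q x → Q (act w x)
  invariant-act inv []      q = q
  invariant-act inv (i ∷ w) q = inv i (invariant-act inv w q)

  -- Trivial stabilizers make `e ↦ actᴮ J e x` a bijection from `Box J` to the orbit of `x`, and
  -- invariance keeps the orbit inside `Q`. All orbits thus have the same size, and they partition
  -- `Q`.
  free-orbits : ∀ J → Fresh J → {Q : El X → Set} (Q? : Decidable Q) → Invariant Q →
    (∀ x → Q x → MovesAll J x) → size (Box J) ℕ∣.∣ count X Q?
  free-orbits J fresh {Q} Q? inv moves =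
    class-size-divides _~?_ (~-refl J) (~-sym J) (~-trans J) (size (Box J)) _ Qs ℕₚ.≤-refl
      (λ x∈ → ℕ∣.∣-reflexive (sym (class-size (proj₂ (∈-filter⁻ Q? {xs = elements X} x∈)))))
    where
    Qs : List (El X)
    Qs = filter Q? (elements X)

    _~?_ : ∀ x y → Dec (x ~⟨ J ⟩ y)
    x ~? y = ∃? (Box J) (λ e → _≟E_ X (actᴮ J e x) y)

    class-size : ∀ {x} → Q x → length (filter (x ~?_) Qs) ≡ size (Box J)
    class-size {x} q = ℕₚ.≤-antisym
      (length-≤ (λ y e → actᴮ J e x ≡ y) (λ { refl refl → refl })
        (Uniqueₚ.filter⁺ (x ~?_) (Uniqueₚ.filter⁺ Q? (unique X)))
        (λ y∈ → let e , eq = proj₂ (∈-filter⁻ (x ~?_) {xs = Qs} y∈) in e , complete (Box J) e , eq))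
      (length-≤ (λ e y → actᴮ J e x ≡ y)
        (λ eq eq′ → actᴮ-injective J fresh (moves x q) (trans eq (sym eq′)))
        (unique (Box J))
        (λ {e} _ → actᴮ J e x ,
          ∈-filter⁺ (x ~?_) (∈-filter⁺ Q? (complete X _) (invariant-act inv (word J _) q)) (e , refl) ,
          refl))

  size-Box-∷ : ∀ i j J → size (Box ((i , j) ∷ J)) ≡ p i * size (Box J)
  size-Box-∷ i j J = trans (length-cartesianProductWith _,_ (allFin (p i)) (elements (Box J)))
    (cong (_* size (Box J)) {length (allFin (p i))} {p i} (Listₚ.length-tabulate id))

  module _ (bound : ℕ) (values : List ℕ)
           (available : ∀ {q} → q ∈ values → ∀ L → length L < bound → ∃[ i ] p i ≡ q × suc i ∉ L) where

    length-used : ∀ J → length (used J) ≡ 2 * length J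
    length-used [] = refl
    length-used (_ ∷ J) = trans (cong (λ z → 2 + z) (length-used J)) (sym (ℕₚ.*-suc 2 (length J)))

    mutual
      -- The next block can be chosen for all of `Q` at once, since every rotation moves every
      -- element of `Q`; only its partner depends on the element, which is why `split-partner` takes
      -- over. A chain uses two indices per pair, so the length bound leaves a block of size `q`
      -- outside `used J`.
      extend-chain : ∀ qs J → (∀ {q} → q ∈ qs → q ∈ values) → Fresh J →
        2 * length J + 2 * length qs ≤ bound → {Q : El X → Set} (Q? : Decidable Q) → Invariant Q →
        (∀ x → Q x → MovesAll J x) → (∀ x → Q x → ∀ i → σ i x ≢ x) →
        size (Box J) * product qs ℕ∣.∣ count X Q?
      extend-chain [] J _ fresh _ Q? inv moves _ =
        subst (ℕ∣._∣ count X Q?) (sym (ℕₚ.*-identityʳ _)) (free-orbits J fresh Q? inv moves)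
      extend-chain (q ∷ qs) J qs⊆ fresh len Q? inv moves all
        with available (qs⊆ (here refl)) (used J) (ℕₚ.<-≤-trans (ℕₚ.≤-<-trans
               (ℕₚ.≤-reflexive (length-used J)) (ℕₚ.m<m+n _ (s≤s z≤n))) len)
      ... | i , refl , i∉ = subst (ℕ∣._∣ count X Q?) (rearrange (size (Box J)) (p i) (product qs))
        (split-partner qs J i (qs⊆ ∘ there) (i∉ , fresh)
          (ℕₚ.≤-trans (ℕₚ.≤-reflexive (shift (length J) (length qs))) len)
          (elements (fin (suc N))) Q? inv moves all
          (λ x q → let j , m = pr-moved i x (all x q i) in Any.map (λ { refl → m }) (complete (fin (suc N)) j)))
        where
        open +-*-Solver
        rearrange : ∀ u v w → v * u * w ≡ u * (v * w)
        rearrange = solve 3 (λ u v w → v :* u :* w := u :* (v :* w)) refl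
        shift : ∀ u v → 2 * suc u + 2 * v ≡ 2 * u + 2 * suc v
        shift = solve 2 (λ u v → con 2 :* (con 1 :+ u) :+ con 2 :* v := con 2 :* u :+ con 2 :* (con 1 :+ v)) refl

      -- The elements for which `j` is a partner of `i` get the chain extended by `(i , j)`; the
      -- others go on to the next candidate. Both parts are invariant, and when the candidates are
      -- exhausted no element is left.
      split-partner : ∀ qs J i → (∀ {q} → q ∈ qs → q ∈ values) →
        suc i ∉ used J × Fresh J → 2 * suc (length J) + 2 * length qs ≤ bound →
        ∀ js {Q : El X → Set} (Q? : Decidable Q) → Invariant Q →
        (∀ x → Q x → MovesAll J x) → (∀ x → Q x → ∀ i → σ i x ≢ x) →
        (∀ x → Q x → Any (λ j → Moves i j x) js) →
        p i * size (Box J) * product qs ℕ∣.∣ count X Q?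
      split-partner qs J i qs⊆ fresh len [] Q? inv moves all some =
        subst (_ ℕ∣.∣_) (sym (count-empty X Q? (λ x q → case some x q of λ ()))) (_ ℕ∣.∣0)
      split-partner qs J i qs⊆ fresh len (j ∷ js) {Q} Q? inv moves all some =
        subst (_ ℕ∣.∣_) (sym (count-split X Q? (Moves? i j)))
          (ℕ∣.∣m∣n⇒∣m+n
            (subst (λ s → s * product qs ℕ∣.∣ _) (size-Box-∷ i j J)
              (extend-chain qs ((i , j) ∷ J) qs⊆ fresh len
                (λ x → Q? x ×-dec Moves? i j x)
                (λ l (q , m) → inv l q , Moves-σ l m)
                (λ x (q , m) → m ∷ moves x q) (λ x → all x ∘ proj₁)))
            (split-partner qs J i qs⊆ fresh len js
              (λ x → Q? x ×-dec ¬? (Moves? i j x))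
              (λ l (q , ¬m) → inv l q , λ m → ¬m (Moves-σ⁻ l m))
              (λ x → moves x ∘ proj₁) (λ x → all x ∘ proj₁)
              (λ x (q , ¬m) → case some x q of λ { (here m) → ⊥-elim (¬m m) ; (there a) → a })))
        where
        Moves-σ⁻ : ∀ l {x} → Moves i j (σ l x) → Moves i j x
        Moves-σ⁻ l {x} moved eq = moved (begin
          σ i (pr i j (σ l x)) ≡⟨ cong (σ i) (pr-σ i j l x) ⟩
          σ i (σ l (pr i j x)) ≡⟨ σ-comm i l _ ⟩
          σ l (σ i (pr i j x)) ≡⟨ cong (σ l) eq ⟩
          σ l (pr i j x)       ≡⟨ pr-σ i j l x ⟨
          pr i j (σ l x)       ∎)
          where open ≡-Reasoning

    count-divisible : 2 * length values ≤ bound → {Q : El X → Set} (Q? : Decidable Q) →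
      Invariant Q → (∀ x → Q x → ∀ i → σ i x ≢ x) → product values ℕ∣.∣ count X Q?
    count-divisible len Q? inv all = subst (ℕ∣._∣ count X Q?) (ℕₚ.*-identityˡ _)
      (extend-chain values [] id tt len Q? inv (λ _ _ → []) all)

-- Blocks of points

iter : {A : Set} → ℕ → (A → A) → A → A
iter zero    f x = x
iter (suc k) f x = iter k f (f x)

iter-∘ : ∀ {A : Set} k (f : A → A) x → iter k f (f x) ≡ f (iter k f x)
iter-∘ zero    f x = refl
iter-∘ (suc k) f x = iter-∘ k f (f x)

iter-commute : ∀ {A B : Set} {f : A → A} {g : B → B} {h : A → B} → (∀ x → h (f x) ≡ g (h x)) →
               ∀ k x → h (iter k f x) ≡ iter k g (h x)
iter-commute         eq zero    x = refl
iter-commute {g = g} eq (suc k) x = trans (iter-commute eq k _) (cong (iter k g) (eq x))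

rotate : ∀ {n} → Fin n → Fin n
rotate {suc n} x = suc (toℕ x) mod suc n

first : ∀ n .{{_ : NonZero n}} → Fin n
first (suc n) = zero

toℕ-iter-rotate : ∀ {n} k (x : Fin (suc n)) → toℕ (iter k rotate x) ≡ (toℕ x + k) % suc n
toℕ-iter-rotate {n} zero x = begin
  toℕ x               ≡⟨ m<n⇒m%n≡m (toℕ<n x) ⟨
  toℕ x % suc n       ≡⟨ cong (_% suc n) (ℕₚ.+-identityʳ (toℕ x)) ⟨
  (toℕ x + 0) % suc n ∎
  where
  open ≡-Reasoning
toℕ-iter-rotate {n} (suc k) x = begin
  toℕ (iter k rotate (rotate x))    ≡⟨ toℕ-iter-rotate k (rotate x) ⟩
  (toℕ (rotate x) + k) % suc n      ≡⟨ cong (λ z → (z + k) % suc n) (toℕ-fromℕ< (m%n<n (suc (toℕ x)) (suc n))) ⟩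
  (suc (toℕ x) % suc n + k) % suc n ≡⟨ %-remove (suc (toℕ x)) k ⟩
  (suc (toℕ x) + k) % suc n         ≡⟨ cong (_% suc n) (ℕₚ.+-suc (toℕ x) k) ⟨
  (toℕ x + suc k) % suc n           ∎
  where
  open ≡-Reasoning
  %-remove : ∀ a c → (a % suc n + c) % suc n ≡ (a + c) % suc n
  %-remove a c = trans (%-distribˡ-+ (a % suc n) c (suc n))
    (trans (cong (λ z → (z + c % suc n) % suc n) (m%n%n≡m%n a (suc n)))
      (sym (%-distribˡ-+ a c (suc n))))

iter-rotate : ∀ {n} (x : Fin n) → iter n rotate x ≡ x
iter-rotate {suc n} x = toℕ-injective (begin
  toℕ (iter (suc n) rotate x) ≡⟨ toℕ-iter-rotate (suc n) x ⟩
  (toℕ x + suc n) % suc n     ≡⟨ [m+n]%n≡m%n (toℕ x) (suc n) ⟩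
  toℕ x % suc n               ≡⟨ m<n⇒m%n≡m (toℕ<n x) ⟩
  toℕ x                       ∎)
  where
  open ≡-Reasoning

-- Rotation is transitive: iterating it leads from `zero` to every point.
rotate-invariant⇒constant : ∀ {A : Set} n .{{_ : NonZero n}} (f : Fin n → A) →
  (∀ x → f (rotate x) ≡ f x) → ∀ x → f x ≡ f (first n)
rotate-invariant⇒constant (suc n) f inv x = trans (cong f (sym reach)) (along (toℕ x) zero)
  where
  along : ∀ k y → f (iter k rotate y) ≡ f y
  along zero    y = refl
  along (suc k) y = trans (along k (rotate y)) (inv y)

  reach : iter (toℕ x) rotate zero ≡ x
  reach = toℕ-injective (trans (toℕ-iter-rotate (toℕ x) zero) (m<n⇒m%n≡m (toℕ<n x)))

-- Since `Q` depends on `x`, the result is a sum and not a product. In the application, the inner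
-- structure of a block determines the label of the point that replaces it.
count-⊗ : ∀ X Y {P : El X → Set} {Q : El X → El Y → Set} (P? : Decidable P) (Q? : ∀ x → Decidable (Q x)) →
  count (X ⊗ Y) (λ (x , y) → P? x ×-dec Q? x y) ≡
  sum (List.map (λ x → count Y (Q? x)) (filter P? (elements X)))
count-⊗ X Y {P} {Q} P? Q? = go (elements X)
  where
  both? : Decidable (λ (x , y) → P x × Q x y)
  both? (x , y) = P? x ×-dec Q? x y

  row : ∀ x ys → P x → length (filter both? (List.map (x ,_) ys)) ≡ length (filter (Q? x) ys)
  row x [] p = refl
  row x (y ∷ ys) p with P? x in eq | Q? x y
  ... | no ¬p | _     = ⊥-elim (¬p p)
  ... | yes _ | yes _ = cong suc (row x ys p)
  ... | yes _ | no  _ = row x ys p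

  go : ∀ xs → length (filter both? (cartesianProductWith _,_ xs (elements Y))) ≡
              sum (List.map (λ x → count Y (Q? x)) (filter P? xs))
  go [] = refl
  go (x ∷ xs) with P? x
  ... | yes p = begin
    length (filter both? (List.map (x ,_) (elements Y) ++ cartesianProductWith _,_ xs (elements Y)))
      ≡⟨ cong length (Listₚ.filter-++ both? (List.map (x ,_) (elements Y)) _) ⟩
    length (filter both? (List.map (x ,_) (elements Y)) ++ filter both? (cartesianProductWith _,_ xs (elements Y)))
      ≡⟨ Listₚ.length-++ (filter both? (List.map (x ,_) (elements Y))) ⟩
    length (filter both? (List.map (x ,_) (elements Y))) + length (filter both? (cartesianProductWith _,_ xs (elements Y)))
      ≡⟨ cong₂ _+_ (row x (elements Y) p) (go xs) ⟩
    count Y (Q? x) + sum (List.map (λ x → count Y (Q? x)) (filter P? xs)) ∎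
    where open ≡-Reasoning
  ... | no ¬p = trans (cong length (begin
    filter both? (List.map (x ,_) (elements Y) ++ cartesianProductWith _,_ xs (elements Y))
      ≡⟨ Listₚ.filter-++ both? (List.map (x ,_) (elements Y)) _ ⟩
    filter both? (List.map (x ,_) (elements Y)) ++ filter both? (cartesianProductWith _,_ xs (elements Y))
      ≡⟨ cong (_++ filter both? (cartesianProductWith _,_ xs (elements Y)))
           (Listₚ.filter-none both? (Allₚ.map⁺ (All.universal (λ _ → ¬p ∘ proj₁) (elements Y)))) ⟩
    filter both? (cartesianProductWith _,_ xs (elements Y)) ∎)) (go xs)
    where
    open ≡-Reasoning

Blocks : ∀ N → (Fin N → ℕ) → Finite → Finite
Blocks zero    p I = I
Blocks (suc N) p I = fin (p zero) ⊕ Blocks N (p ∘ suc) I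

module _ (I : Finite) where

  -- Points outside all blocks are in block zero.
  block : ∀ N p → El (Blocks N p I) → Fin (suc N)
  block zero    p x        = zero
  block (suc N) p (inj₁ x) = suc zero
  block (suc N) p (inj₂ x) = up (block N (p ∘ suc) x)
    where
    up : Fin (suc N) → Fin (suc (suc N))
    up zero    = zero
    up (suc i) = suc (suc i)

  turn : ∀ N p → Fin N → El (Blocks N p I) → El (Blocks N p I)
  turn (suc N) p zero    = Sum.map rotate id
  turn (suc N) p (suc i) = Sum.map id (turn N (p ∘ suc) i)

  turn-comm : ∀ N p i j x → turn N p i (turn N p j x) ≡ turn N p j (turn N p i x)
  turn-comm (suc N) p zero    zero    x        = refl
  turn-comm (suc N) p zero    (suc j) (inj₁ x) = refl
  turn-comm (suc N) p zero    (suc j) (inj₂ x) = refl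
  turn-comm (suc N) p (suc i) zero    (inj₁ x) = refl
  turn-comm (suc N) p (suc i) zero    (inj₂ x) = refl
  turn-comm (suc N) p (suc i) (suc j) (inj₁ x) = refl
  turn-comm (suc N) p (suc i) (suc j) (inj₂ x) = cong inj₂ (turn-comm N (p ∘ suc) i j x)

  iter-id : ∀ {A : Set} k (x : A) → iter k id x ≡ x
  iter-id zero    x = refl
  iter-id (suc k) x = iter-id k x

  iter-turn : ∀ N p i x → iter (p i) (turn N p i) x ≡ x
  iter-turn (suc N) p zero    (inj₁ x) = trans (sym (iter-commute {f = rotate} {h = inj₁} (λ _ → refl) (p zero) x)) (cong inj₁ (iter-rotate x))
  iter-turn (suc N) p zero    (inj₂ x) = trans (sym (iter-commute {f = id} {h = inj₂} (λ _ → refl) (p zero) x)) (cong inj₂ (iter-id (p zero) x))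
  iter-turn (suc N) p (suc i) (inj₁ x) = trans (sym (iter-commute {f = id} {h = inj₁} (λ _ → refl) (p (suc i)) x)) (cong inj₁ (iter-id (p (suc i)) x))
  iter-turn (suc N) p (suc i) (inj₂ x) = trans (sym (iter-commute {f = turn N (p ∘ suc) i} {h = inj₂} (λ _ → refl) (p (suc i)) x)) (cong inj₂ (iter-turn N (p ∘ suc) i x))

  block-turn : ∀ N p i x → block N p (turn N p i x) ≡ block N p x
  block-turn (suc N) p zero    (inj₁ x) = refl
  block-turn (suc N) p zero    (inj₂ x) = refl
  block-turn (suc N) p (suc i) (inj₁ x) = refl
  block-turn (suc N) p (suc i) (inj₂ x) rewrite block-turn N (p ∘ suc) i x = refl

  turn-other : ∀ N p i x → block N p x ≢ suc i → turn N p i x ≡ x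
  turn-other (suc N) p zero    (inj₁ x) ≢i = ⊥-elim (≢i refl)
  turn-other (suc N) p zero    (inj₂ x) ≢i = refl
  turn-other (suc N) p (suc i) (inj₁ x) ≢i = refl
  turn-other (suc N) p (suc i) (inj₂ x) ≢i =
    cong inj₂ (turn-other N (p ∘ suc) i x (λ eq → ≢i (cong-up eq)))
    where
    cong-up : block N (p ∘ suc) x ≡ suc i → block (suc N) p (inj₂ x) ≡ suc (suc i)
    cong-up eq rewrite eq = refl

  turn-≃ : ∀ N p → (∀ i → NonZero (p i)) → Fin N → Blocks N p I ≃ Blocks N p I
  turn-≃ N p nz i = record
    { to = turn N p i
    ; from = iter (pred (p i)) (turn N p i)
    ; from-to = λ x → trans (cong (λ k → iter k (turn N p i) x) (ℕₚ.suc-pred (p i) {{nz i}})) (iter-turn N p i x)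
    ; to-from = λ x → trans (sym (iter-∘ (pred (p i)) (turn N p i) x))
        (trans (cong (λ k → iter k (turn N p i) x) (ℕₚ.suc-pred (p i) {{nz i}})) (iter-turn N p i x))
    }

  labels : ∀ {L : Set} N p → L → (El I → L) → El (Blocks N p I) → L
  labels zero    p t l = l
  labels (suc N) p t l = [ constant t , labels N (p ∘ suc) t l ]′

  labels-turn : ∀ {L : Set} N p (t : L) l i x → labels N p t l (turn N p i x) ≡ labels N p t l x
  labels-turn (suc N) p t l zero    (inj₁ x) = refl
  labels-turn (suc N) p t l zero    (inj₂ x) = refl
  labels-turn (suc N) p t l (suc i) (inj₁ x) = refl
  labels-turn (suc N) p t l (suc i) (inj₂ x) = labels-turn N (p ∘ suc) t l i x

-- The base lies behind all blocks, whereas `count-collapse` treats the summand at the very front;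
-- this brings a summand of the base there.
Blocks-shift : ∀ N p J I → Blocks N p (J ⊕ I) ≃ (J ⊕ Blocks N p I)
Blocks-shift zero    p J I = ≃-refl {J ⊕ I}
Blocks-shift (suc N) p J I = ≃-trans {fin (p zero) ⊕ Blocks N (p ∘ suc) (J ⊕ I)}
    {fin (p zero) ⊕ J ⊕ Blocks N (p ∘ suc) I} {J ⊕ fin (p zero) ⊕ Blocks N (p ∘ suc) I}
  (_⊕≃_ {fin (p zero)} {Blocks N (p ∘ suc) (J ⊕ I)} {fin (p zero)} {J ⊕ Blocks N (p ∘ suc) I}
    (≃-refl {fin (p zero)}) (Blocks-shift N (p ∘ suc) J I))
  (⊕-swap {fin (p zero)} {J} {Blocks N (p ∘ suc) I})

module _ (J I : Finite) where

  shift-turn : ∀ N p i x → to (Blocks-shift N p J I) (turn (J ⊕ I) N p i x) ≡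
                           Sum.map id (turn I N p i) (to (Blocks-shift N p J I) x)
  shift-turn (suc N) p zero    (inj₁ x) = refl
  shift-turn (suc N) p zero    (inj₂ x) with to (Blocks-shift N (p ∘ suc) J I) x
  ... | inj₁ _ = refl
  ... | inj₂ _ = refl
  shift-turn (suc N) p (suc i) (inj₁ x) = refl
  shift-turn (suc N) p (suc i) (inj₂ x)
    rewrite shift-turn N (p ∘ suc) i x with to (Blocks-shift N (p ∘ suc) J I) x
  ... | inj₁ _ = refl
  ... | inj₂ _ = refl

  shift-labels : ∀ {L : Set} N p (t : L) (j : El J → L) l x →
    labels (J ⊕ I) N p t [ j , l ]′ x ≡ [ j , labels I N p t l ]′ (to (Blocks-shift N p J I) x)
  shift-labels zero    p t j l x        = refl
  shift-labels (suc N) p t j l (inj₁ x) = refl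
  shift-labels (suc N) p t j l (inj₂ x)
    rewrite shift-labels N (p ∘ suc) t j l x with to (Blocks-shift N (p ∘ suc) J I) x
  ... | inj₁ _ = refl
  ... | inj₂ _ = refl

-- Counting arrangements

module Matrices (b : ℕ) where
  open TypeAlgebras b

  Mat : Finite → Finite
  Mat I = Table I (Table I (vec bool b))

  zeroes : Bin
  zeroes = Vec.replicate b false

  module _ (I : Finite) where

    abstract
      entry : El (Mat I) → Arrangement I
      entry A x y = _!_ {I} {vec bool b} (_!_ {I} {Table I (vec bool b)} A x) y

      mat : Arrangement I → El (Mat I)
      mat f = tab {I} {Table I (vec bool b)} (λ x → tab {I} {vec bool b} (f x))

      entry-mat : ∀ f x y → entry (mat f) x y ≡ f x y
      entry-mat f x y = trans
        (cong (λ row → _!_ {I} {vec bool b} row y) (!-tab {I} {Table I (vec bool b)} (λ x → tab {I} {vec bool b} (f x)) x))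
        (!-tab {I} {vec bool b} (f x) y)

      entry-ext : ∀ {A A′} → (∀ x y → entry A x y ≡ entry A′ x y) → A ≡ A′
      entry-ext eq = !-ext {I} {Table I (vec bool b)} (λ x → !-ext {I} {vec bool b} (eq x))

    relabel : (El I → El I) → El (Mat I) → El (Mat I)
    relabel f A = mat (λ x y → entry A (f x) (f y))

    entry-relabel : ∀ f A x y → entry (relabel f A) x y ≡ entry A (f x) (f y)
    entry-relabel f A = entry-mat _

    relabel-∘ : ∀ f g A x y → entry (relabel f (relabel g A)) x y ≡ entry A (g (f x)) (g (f y))
    relabel-∘ f g A x y = trans (entry-relabel f _ x y) (entry-relabel g A _ _)

    -- Algebras do not see the diagonal, so it is normalized; otherwise every arrangement would be
    -- counted once for each choice of diagonal.
    ZeroDiagonal : El (Mat I) → Set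
    ZeroDiagonal A = ∀ x → entry A x x ≡ zeroes

    zeroDiagonal? : Decidable ZeroDiagonal
    zeroDiagonal? A = ∀? I (λ x → Vecₚ.≡-dec _≟ᵇ_ (entry A x x) zeroes)

  module _ (N : ℕ) (p : Fin N → ℕ) (p-prime : ∀ i → Prime (p i)) (I : Finite) where
    private
      K = Blocks N p I

      σ : Fin N → El (Mat K) → El (Mat K)
      σ i = relabel K (turn I N p i)

      -- For `j` equal to `zero` these are the entries between block `i` and the points outside all
      -- blocks, for `j` equal to `suc i` those within block `i`. Masking everything else leaves a
      -- matrix that rotations of other blocks cannot change.
      Between : Fin N → Fin (suc N) → El K → El K → Set
      Between i j x y = (block I N p x ≡ suc i × block I N p y ≡ j) ⊎
                        (block I N p x ≡ j × block I N p y ≡ suc i)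

      between? : ∀ i j x y → Dec (Between i j x y)
      between? i j x y = (block I N p x ≟ᶠ suc i ×-dec block I N p y ≟ᶠ j) ⊎-dec
                         (block I N p x ≟ᶠ j ×-dec block I N p y ≟ᶠ suc i)

      between : Fin N → Fin (suc N) → El K → El K → Bool
      between i j x y = does (between? i j x y)

      masked : Bool → Bin → Bin
      masked true  bits = bits
      masked false _    = zeroes

      pr : Fin N → Fin (suc N) → El (Mat K) → El (Mat K)
      pr i j A = mat K (λ x y → masked (between i j x y) (entry K A x y))

      between-turn : ∀ i j l x y → between i j (turn I N p l x) (turn I N p l y) ≡ between i j x y
      between-turn i j l x y rewrite block-turn I N p l x | block-turn I N p l y = refl

      entry-σ-pr : ∀ i j l A x y → entry K (σ l (pr i j A)) x y ≡
        masked (between i j x y) (entry K A (turn I N p l x) (turn I N p l y))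
      entry-σ-pr i j l A x y = trans (entry-relabel K _ (pr i j A) x y)
        (trans (entry-mat K _ _ _)
          (cong (λ β → masked β (entry K A (turn I N p l x) (turn I N p l y))) (between-turn i j l x y)))

      pr-σ : ∀ i j l A → pr i j (σ l A) ≡ σ l (pr i j A)
      pr-σ i j l A = entry-ext K (λ x y → trans (entry-mat K _ x y)
        (trans (cong (masked (between i j x y)) (entry-relabel K _ A x y))
               (sym (entry-σ-pr i j l A x y))))

      fixed-between : ∀ i j l → l ≢ i → suc l ≢ j → ∀ x y → between i j x y ≡ true →
        turn I N p l x ≡ x × turn I N p l y ≡ y
      fixed-between i j l l≢i l≢j x y e
        with from-does (between? i j x y) e
      ... | inj₁ (bx , by) = turn-other I N p l x (λ bx′ → l≢i (Finₚ.suc-injective (trans (sym bx′) bx)))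
                           , turn-other I N p l y (λ by′ → l≢j (trans (sym by′) by))
      ... | inj₂ (bx , by) = turn-other I N p l x (λ bx′ → l≢j (trans (sym bx′) bx))
                           , turn-other I N p l y (λ by′ → l≢i (Finₚ.suc-injective (trans (sym by′) by)))

      pr-fixed : ∀ i j l A → l ≢ i → suc l ≢ j → σ l (pr i j A) ≡ pr i j A
      pr-fixed i j l A l≢i l≢j = entry-ext K (λ x y → trans (entry-σ-pr i j l A x y)
        (trans (masked-cong x y) (sym (entry-mat K _ x y))))
        where
        masked-cong : ∀ x y → masked (between i j x y) (entry K A (turn I N p l x) (turn I N p l y)) ≡
                              masked (between i j x y) (entry K A x y)
        masked-cong x y with between i j x y in e
        ... | false = refl
        ... | true  = let ex , ey = fixed-between i j l l≢i l≢j x y e in cong₂ (entry K A) ex ey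

      -- An entry affected by the rotation has one coordinate in block `i`, and the block of its
      -- other coordinate serves as `j`. That an entry has only two coordinates is essential: it
      -- keeps a witness of being moved within a pair of blocks.
      fixed-by-pr : ∀ i A → (∀ j → σ i (pr i j A) ≡ pr i j A) → σ i A ≡ A
      fixed-by-pr i A fixed = entry-ext K (λ x y → trans (entry-relabel K _ A x y) (go x y))
        where
        unmasked : ∀ j x y → between i j x y ≡ true →
          entry K A (turn I N p i x) (turn I N p i y) ≡ entry K A x y
        unmasked j x y e = begin
          entry K A (turn I N p i x) (turn I N p i y)
            ≡⟨ cong (λ β → masked β (entry K A (turn I N p i x) (turn I N p i y))) e ⟨
          masked (between i j x y) (entry K A (turn I N p i x) (turn I N p i y))
            ≡⟨ entry-σ-pr i j i A x y ⟨
          entry K (σ i (pr i j A)) x y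
            ≡⟨ cong (λ B → entry K B x y) (fixed j) ⟩
          entry K (pr i j A) x y
            ≡⟨ entry-mat K _ x y ⟩
          masked (between i j x y) (entry K A x y)
            ≡⟨ cong (λ β → masked β (entry K A x y)) e ⟩
          entry K A x y ∎
          where open ≡-Reasoning

        go : ∀ x y → entry K A (turn I N p i x) (turn I N p i y) ≡ entry K A x y
        go x y with block I N p x ≟ᶠ suc i | block I N p y ≟ᶠ suc i
        ... | yes bx | _      = unmasked (block I N p y) x y (dec-true (between? i _ x y) (inj₁ (bx , refl)))
        ... | no _   | yes by = unmasked (block I N p x) x y (dec-true (between? i _ x y) (inj₂ (refl , by)))
        ... | no x≢  | no y≢  = cong₂ (entry K A) (turn-other I N p i x x≢) (turn-other I N p i y y≢)

      pr-moved : ∀ i A → σ i A ≢ A → ∃[ j ] σ i (pr i j A) ≢ pr i j A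
      pr-moved i A moved with ∃? (fin (suc N)) (λ j → ¬? (_≟E_ (Mat K) (σ i (pr i j A)) (pr i j A)))
      ... | yes e  = e
      ... | no ¬e = ⊥-elim (moved (fixed-by-pr i A
        (λ j → decidable-stable (_≟E_ (Mat K) _ _) (λ ≢j → ¬e (j , ≢j)))))

      σ-iterate : ∀ i k A x y → entry K (List.foldr σ A (List.replicate k i)) x y ≡
        entry K A (iter k (turn I N p i) x) (iter k (turn I N p i) y)
      σ-iterate i zero    A x y = refl
      σ-iterate i (suc k) A x y = trans (entry-relabel K _ _ x y) (σ-iterate i k A _ _)

    pairwiseAction : PairwiseAction (Mat K) N
    pairwiseAction = record
      { p = p
      ; p-prime = p-prime
      ; σ = σ
      ; σ-comm = λ i j A → entry-ext K (λ x y → trans (relabel-∘ K _ _ A x y)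
          (trans (cong₂ (entry K A) (turn-comm I N p j i x) (turn-comm I N p j i y))
                 (sym (relabel-∘ K _ _ A x y))))
      ; σ-order = λ i A → entry-ext K (λ x y → trans (σ-iterate i (p i) A x y)
          (cong₂ (entry K A) (iter-turn I N p i x) (iter-turn I N p i y)))
      ; pr = pr
      ; pr-σ = pr-σ
      ; pr-fixed = pr-fixed
      ; pr-moved = pr-moved
      }

  module _ (algebra : Algebra) (acc : El (Algebra.T algebra) → Bool) where
    open Algebra algebra

    -- Points carry no loops of their own: those are part of their labels.
    Accepted : ∀ K → (El K → El T) → El (Mat K) → Set
    Accepted K l A = ZeroDiagonal K A × acc (F K (entry K A) l) ≡ true

    accepted? : ∀ K l → Decidable (Accepted K l)
    accepted? K l A = zeroDiagonal? K A ×-dec acc (F K (entry K A) l) ≟ᵇ true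

    Unfixed : ∀ K {N} → (Fin N → El K → El K) → El (Mat K) → Set
    Unfixed K s A = ∀ i → relabel K (s i) A ≢ A

    unfixed? : ∀ K {N} s → Decidable (Unfixed K {N} s)
    unfixed? K {N} s A = ∀? (fin N) (λ i → ¬? (_≟E_ (Mat K) (relabel K (s i) A) A))

    Counted : ∀ K (l : El K → El T) {N} (s : Fin N → El K → El K) → El (Mat K) → Set
    Counted K l s A = Accepted K l A × Unfixed K s A

    counted? : ∀ K l {N} s → Decidable (Counted K l {N} s)
    counted? K l s A = accepted? K l A ×-dec unfixed? K s A

    Count : ∀ K (l : El K → El T) {N} (s : Fin N → El K → El K) → ℕ
    Count K l s = count (Mat K) (counted? K l s)

    Accepted-≃ : ∀ {K K′} (π : K ≃ K′) {l l′} → (∀ x → l x ≡ l′ (to π x)) → ∀ {A A′} →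
      (∀ x y → entry K A x y ≡ entry K′ A′ (to π x) (to π y)) → Accepted K l A → Accepted K′ l′ A′
    Accepted-≃ {K} {K′} π eq {A} {A′} eqA (diag , a) =
      (λ y → trans (cong₂ (entry K′ A′) (sym (to-from π y)) (sym (to-from π y)))
               (trans (sym (eqA (from π y) (from π y))) (diag (from π y)))) ,
      trans (cong acc (sym (F-≃ {K} {K′} π (λ x y _ → eqA x y) eq))) a

    Count-≃ : ∀ {K K′} (π : K ≃ K′) {l l′ N} {s : Fin N → El K → El K} {s′ : Fin N → El K′ → El K′} →
      (∀ x → l x ≡ l′ (to π x)) → (∀ i x → to π (s i x) ≡ s′ i (to π x)) →
      Count K l s ≡ Count K′ l′ s′
    Count-≃ {K} {K′} π {l} {l′} {N} {s} {s′} eq eqs = count-bijection (Mat K) (Mat K′)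
      (counted? K l s) (counted? K′ l′ s′) push pull
      (λ A (a , u) → (Accepted-≃ {K} {K′} π eq (λ x y → sym (entry-push A x y)) a , unfixed-push A u) , pull-push A)
      (λ A (a , u) → (Accepted-≃ {K′} {K} (≃-sym {K} {K′} π) eq⁻ (λ x y → sym (entry-pull⁻ A x y)) a
                     , unfixed-pull A u) , push-pull A)
      where
      push : El (Mat K) → El (Mat K′)
      push A = mat K′ (λ x y → entry K A (from π x) (from π y))

      pull : El (Mat K′) → El (Mat K)
      pull A = mat K (λ x y → entry K′ A (to π x) (to π y))

      entry-push : ∀ A x y → entry K′ (push A) (to π x) (to π y) ≡ entry K A x y
      entry-push A x y = trans (entry-mat K′ _ _ _) (cong₂ (entry K A) (from-to π x) (from-to π y))

      entry-pull⁻ : ∀ A x y → entry K (pull A) (from π x) (from π y) ≡ entry K′ A x y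
      entry-pull⁻ A x y = trans (entry-mat K _ _ _) (cong₂ (entry K′ A) (to-from π x) (to-from π y))

      pull-push : ∀ A → pull (push A) ≡ A
      pull-push A = entry-ext K (λ x y → trans (entry-mat K _ x y) (entry-push A x y))

      push-pull : ∀ A → push (pull A) ≡ A
      push-pull A = entry-ext K′ (λ x y → trans (entry-mat K′ _ x y) (entry-pull⁻ A x y))

      eq⁻ : ∀ y → l′ y ≡ l (from π y)
      eq⁻ y = trans (cong l′ (sym (to-from π y))) (sym (eq (from π y)))

      pull-relabel : ∀ i A → pull (relabel K′ (s′ i) A) ≡ relabel K (s i) (pull A)
      pull-relabel i A = entry-ext K (λ x y → begin
        entry K (pull (relabel K′ (s′ i) A)) x y          ≡⟨ entry-mat K _ x y ⟩
        entry K′ (relabel K′ (s′ i) A) (to π x) (to π y)  ≡⟨ entry-relabel K′ _ A _ _ ⟩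
        entry K′ A (s′ i (to π x)) (s′ i (to π y))        ≡⟨ cong₂ (entry K′ A) (eqs i x) (eqs i y) ⟨
        entry K′ A (to π (s i x)) (to π (s i y))          ≡⟨ entry-mat K _ _ _ ⟨
        entry K (pull A) (s i x) (s i y)                  ≡⟨ entry-relabel K _ (pull A) x y ⟨
        entry K (relabel K (s i) (pull A)) x y            ∎)
        where open ≡-Reasoning

      unfixed-push : ∀ A → Unfixed K s A → Unfixed K′ s′ (push A)
      unfixed-push A u i fix = u i (begin
        relabel K (s i) A                   ≡⟨ cong (relabel K (s i)) (pull-push A) ⟨
        relabel K (s i) (pull (push A))     ≡⟨ pull-relabel i (push A) ⟨
        pull (relabel K′ (s′ i) (push A))   ≡⟨ cong pull fix ⟩
        pull (push A)                       ≡⟨ pull-push A ⟩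
        A                                   ∎)
        where open ≡-Reasoning

      unfixed-pull : ∀ A → Unfixed K′ s′ A → Unfixed K s (pull A)
      unfixed-pull A u i fix = u i (begin
        relabel K′ (s′ i) A                 ≡⟨ push-pull _ ⟨
        push (pull (relabel K′ (s′ i) A))   ≡⟨ cong push (pull-relabel i A) ⟩
        push (relabel K (s i) (pull A))     ≡⟨ cong push fix ⟩
        push (pull A)                       ≡⟨ push-pull A ⟩
        A                                   ∎)
        where open ≡-Reasoning

    Symmetric : ∀ n → El (Mat (fin n)) → Set
    Symmetric n B = ZeroDiagonal (fin n) B × relabel (fin n) rotate B ≡ B

    symmetric? : ∀ n → Decidable (Symmetric n)
    symmetric? n B = zeroDiagonal? (fin n) B ×-dec _≟E_ (Mat (fin n)) (relabel (fin n) rotate B) B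

    symmetrics : ∀ n → List (El (Mat (fin n)))
    symmetrics n = filter (symmetric? n) (elements (Mat (fin n)))

    collapsed : ∀ n → El T → El (Mat (fin n)) → El T
    collapsed n t B = F (fin n) (entry (fin n) B) (λ _ → t)

    extend : ∀ {A B : Set} {N} → (A → A) → (Fin N → B → B) → Fin (suc N) → A ⊎ B → A ⊎ B
    extend f s zero    = Sum.map f id
    extend f s (suc i) = Sum.map id (s i)

    module _ (n : ℕ) .{{_ : NonZero n}} (K : Finite) (t : El T) (l : El K → El T)
             {N : ℕ} (s : Fin N → El K → El K) where
      private
        K⁺ = fin n ⊕ K
        K¹ = fin 1 ⊕ K

        s⁺ : Fin N → El K⁺ → El K⁺
        s⁺ i = Sum.map id (s i)

        s¹ : Fin N → El K¹ → El K¹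
        s¹ i = Sum.map id (s i)

        l⁺ : El K⁺ → El T
        l⁺ = [ constant t , l ]′

        l¹ : El (Mat (fin n)) → El K¹ → El T
        l¹ B = [ constant (collapsed n t B) , l ]′

        ρ : El K⁺ → El K⁺
        ρ = Sum.map rotate id

        glueᵃ : El (Mat (fin n)) → El (Mat K¹) → Arrangement K⁺
        glueᵃ B A (inj₁ x) (inj₁ y) = entry (fin n) B x y
        glueᵃ B A (inj₁ x) (inj₂ y) = entry K¹ A (inj₁ zero) (inj₂ y)
        glueᵃ B A (inj₂ x) (inj₁ y) = entry K¹ A (inj₂ x) (inj₁ zero)
        glueᵃ B A (inj₂ x) (inj₂ y) = entry K¹ A (inj₂ x) (inj₂ y)

        glue : El (Mat (fin n)) × El (Mat K¹) → El (Mat K⁺)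
        glue (B , A) = mat K⁺ (glueᵃ B A)

        entry-glue : ∀ B A x y → entry K⁺ (glue (B , A)) x y ≡ glueᵃ B A x y
        entry-glue B A = entry-mat K⁺ (glueᵃ B A)

        inner : El (Mat K⁺) → El (Mat (fin n))
        inner A = mat (fin n) (λ x y → entry K⁺ A (inj₁ x) (inj₁ y))

        outerᵃ : El (Mat K⁺) → Arrangement K¹
        -- The inner structure of the block passes into the label of the point, whose diagonal entry
        -- takes the value demanded by `ZeroDiagonal`.
        outerᵃ A (inj₁ _) (inj₁ _) = zeroes
        outerᵃ A (inj₁ _) (inj₂ y) = entry K⁺ A (inj₁ (first n)) (inj₂ y)
        outerᵃ A (inj₂ x) (inj₁ _) = entry K⁺ A (inj₂ x) (inj₁ (first n))
        outerᵃ A (inj₂ x) (inj₂ y) = entry K⁺ A (inj₂ x) (inj₂ y)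

        outer : El (Mat K⁺) → El (Mat K¹)
        outer A = mat K¹ (outerᵃ A)

        entry-inner : ∀ A x y → entry (fin n) (inner A) x y ≡ entry K⁺ A (inj₁ x) (inj₁ y)
        entry-inner A = entry-mat (fin n) _

        entry-outer : ∀ A x y → entry K¹ (outer A) x y ≡ outerᵃ A x y
        entry-outer A = entry-mat K¹ (outerᵃ A)

        inner-glue : ∀ B A → inner (glue (B , A)) ≡ B
        inner-glue B A = entry-ext (fin n) (λ x y → trans (entry-inner _ x y) (entry-glue B A _ _))

        outer-glue : ∀ B A → entry K¹ A (inj₁ zero) (inj₁ zero) ≡ zeroes → outer (glue (B , A)) ≡ A
        outer-glue B A diag = entry-ext K¹ (λ x y → trans (entry-outer _ x y) (go x y))
          where
          go : ∀ x y → outerᵃ (glue (B , A)) x y ≡ entry K¹ A x y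
          go (inj₁ zero) (inj₁ zero) = sym diag
          go (inj₁ zero) (inj₂ y)    = entry-glue B A _ _
          go (inj₂ x)    (inj₁ zero) = entry-glue B A _ _
          go (inj₂ x)    (inj₂ y)    = entry-glue B A _ _

        -- `ρ` fixes the points outside the block, so invariance of an entry with one coordinate
        -- there moves the other coordinate alone around the block. Hence the entry may be read off
        -- at `first n`.
        glue-split : ∀ A → relabel K⁺ ρ A ≡ A → glue (inner A , outer A) ≡ A
        glue-split A fix = entry-ext K⁺ (λ x y → trans (entry-glue _ _ x y) (go x y))
          where
          invariant : ∀ x y → entry K⁺ A (ρ x) (ρ y) ≡ entry K⁺ A x y
          invariant x y = trans (sym (entry-relabel K⁺ ρ A x y)) (cong (λ B → entry K⁺ B x y) fix)

          go : ∀ x y → glueᵃ (inner A) (outer A) x y ≡ entry K⁺ A x y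
          go (inj₁ x) (inj₁ y) = entry-inner A x y
          go (inj₁ x) (inj₂ y) = trans (entry-outer A _ _) (sym (rotate-invariant⇒constant n
            (λ z → entry K⁺ A (inj₁ z) (inj₂ y)) (λ z → invariant (inj₁ z) (inj₂ y)) x))
          go (inj₂ x) (inj₁ y) = trans (entry-outer A _ _) (sym (rotate-invariant⇒constant n
            (λ z → entry K⁺ A (inj₂ x) (inj₁ z)) (λ z → invariant (inj₂ x) (inj₁ z)) y))
          go (inj₂ x) (inj₂ y) = entry-outer A _ _

        relabel-s⁺-glue : ∀ i B A → relabel K⁺ (s⁺ i) (glue (B , A)) ≡ glue (B , relabel K¹ (s¹ i) A)
        relabel-s⁺-glue i B A = entry-ext K⁺ (λ x y → trans (entry-relabel K⁺ _ _ x y)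
          (trans (entry-glue B A _ _) (trans (go x y) (sym (entry-glue B _ x y)))))
          where
          go : ∀ x y → glueᵃ B A (s⁺ i x) (s⁺ i y) ≡ glueᵃ B (relabel K¹ (s¹ i) A) x y
          go (inj₁ x) (inj₁ y) = refl
          go (inj₁ x) (inj₂ y) = sym (entry-relabel K¹ _ A _ _)
          go (inj₂ x) (inj₁ y) = sym (entry-relabel K¹ _ A _ _)
          go (inj₂ x) (inj₂ y) = sym (entry-relabel K¹ _ A _ _)

        relabel-ρ-glue : ∀ B A → relabel (fin n) rotate B ≡ B → relabel K⁺ ρ (glue (B , A)) ≡ glue (B , A)
        relabel-ρ-glue B A fix = entry-ext K⁺ (λ x y → trans (entry-relabel K⁺ _ _ x y)
          (trans (entry-glue B A _ _) (trans (go x y) (sym (entry-glue B A x y)))))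
          where
          go : ∀ x y → glueᵃ B A (ρ x) (ρ y) ≡ glueᵃ B A x y
          go (inj₁ x) (inj₁ y) = trans (sym (entry-relabel (fin n) rotate B x y))
                                       (cong (λ C → entry (fin n) C x y) fix)
          go (inj₁ x) (inj₂ y) = refl
          go (inj₂ x) (inj₁ y) = refl
          go (inj₂ x) (inj₂ y) = refl

        F-glue : ∀ B A → F K⁺ (entry K⁺ (glue (B , A))) l⁺ ≡ F K¹ (entry K¹ A) (l¹ B)
        F-glue B A = trans (F-collapse (fin n) K l⁺ (record
            { out-out = λ i j → entry-glue B A _ _
            ; in-out  = λ x j → entry-glue B A _ _
            ; out-in  = λ i y → entry-glue B A _ _ }))
          (F-cong K¹ λ { (inj₁ _) → F-≃ (≃-refl {fin n}) (λ x y _ → entry-glue B A _ _) (λ _ → refl)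
                       ; (inj₂ _) → refl })

        Parts : El (Mat (fin n)) × El (Mat K¹) → Set
        Parts (B , A) = Symmetric n B × Counted K¹ (l¹ B) s¹ A

        parts? : Decidable Parts
        parts? (B , A) = symmetric? n B ×-dec counted? K¹ (l¹ B) s¹ A

        Modular : El (Mat K⁺) → Set
        Modular A = Counted K⁺ l⁺ s⁺ A × ¬ relabel K⁺ ρ A ≢ A

        moves? : ∀ A → Dec (relabel K⁺ ρ A ≢ A)
        moves? A = ¬? (_≟E_ (Mat K⁺) (relabel K⁺ ρ A) A)

        modular? : Decidable Modular
        modular? A = counted? K⁺ l⁺ s⁺ A ×-dec ¬? (moves? A)

        split : El (Mat K⁺) → El (Mat (fin n)) × El (Mat K¹)
        split A = inner A , outer A

        modular⇒parts : ∀ A → Modular A → Parts (split A) × glue (split A) ≡ A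
        modular⇒parts A (((diag , a) , unfixed) , ¬moves) =
          (((diag-inner , symmetric-inner) , (diag-outer , accepted-outer) , unfixed-outer)) , reglue
          where
          fix : relabel K⁺ ρ A ≡ A
          fix = decidable-stable (_≟E_ (Mat K⁺) _ _) ¬moves

          reglue : glue (split A) ≡ A
          reglue = glue-split A fix

          diag-inner : ZeroDiagonal (fin n) (inner A)
          diag-inner x = trans (entry-inner A x x) (diag (inj₁ x))

          symmetric-inner : relabel (fin n) rotate (inner A) ≡ inner A
          symmetric-inner = entry-ext (fin n) (λ x y → trans (entry-relabel (fin n) rotate (inner A) x y)
            (trans (entry-inner A _ _) (trans (sym (entry-relabel K⁺ ρ A (inj₁ x) (inj₁ y)))
              (trans (cong (λ C → entry K⁺ C (inj₁ x) (inj₁ y)) fix) (sym (entry-inner A x y))))))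

          diag-outer : ZeroDiagonal K¹ (outer A)
          diag-outer (inj₁ zero) = entry-outer A _ _
          diag-outer (inj₂ x)    = trans (entry-outer A _ _) (diag (inj₂ x))

          accepted-outer : acc (F K¹ (entry K¹ (outer A)) (l¹ (inner A))) ≡ true
          accepted-outer = trans (cong acc (sym (F-glue (inner A) (outer A))))
            (trans (cong (λ C → acc (F K⁺ (entry K⁺ C) l⁺)) reglue) a)

          unfixed-outer : Unfixed K¹ s¹ (outer A)
          unfixed-outer i eq = unfixed i (begin
            relabel K⁺ (s⁺ i) A                        ≡⟨ cong (relabel K⁺ (s⁺ i)) reglue ⟨
            relabel K⁺ (s⁺ i) (glue (split A))         ≡⟨ relabel-s⁺-glue i (inner A) (outer A) ⟩
            glue (inner A , relabel K¹ (s¹ i) (outer A)) ≡⟨ cong (λ C → glue (inner A , C)) eq ⟩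
            glue (split A)                             ≡⟨ reglue ⟩
            A                                          ∎)
            where open ≡-Reasoning

        parts⇒modular : ∀ BA → Parts BA → Modular (glue BA) × split (glue BA) ≡ BA
        parts⇒modular (B , A) ((diagB , symB) , (diagA , a) , unfixed) =
          (((diag , trans (cong acc (F-glue B A)) a) , unfixed-glue) ,
           λ moves → moves (relabel-ρ-glue B A symB)) ,
          cong₂ _,_ (inner-glue B A) (outer-glue B A (diagA (inj₁ zero)))
          where
          diag : ZeroDiagonal K⁺ (glue (B , A))
          diag (inj₁ x) = trans (entry-glue B A _ _) (diagB x)
          diag (inj₂ x) = trans (entry-glue B A _ _) (diagA (inj₂ x))

          unfixed-glue : Unfixed K⁺ s⁺ (glue (B , A))
          unfixed-glue i eq = unfixed i (begin
            relabel K¹ (s¹ i) A                        ≡⟨ outer-glue B _ (trans (entry-relabel K¹ (s¹ i) A _ _) (diagA (inj₁ zero))) ⟨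
            outer (glue (B , relabel K¹ (s¹ i) A))     ≡⟨ cong outer (relabel-s⁺-glue i B A) ⟨
            outer (relabel K⁺ (s⁺ i) (glue (B , A)))   ≡⟨ cong outer eq ⟩
            outer (glue (B , A))                       ≡⟨ outer-glue B A (diagA (inj₁ zero)) ⟩
            A                                          ∎)
            where open ≡-Reasoning

      -- One step of inclusion and exclusion: the arrangements unfixed by `s` either are moved by
      -- the rotation of the new block as well, or come from a unique pair of a symmetric block and
      -- an arrangement with one point in its place. The other rotations commute with `glue`, so
      -- being unfixed by them carries over in both directions.
      count-collapse : Count (fin n ⊕ K) [ constant t , l ]′ (λ i → Sum.map id (s i)) ≡
        Count (fin n ⊕ K) [ constant t , l ]′ (extend rotate s) +
        sum (List.map (λ B → Count (fin 1 ⊕ K) [ constant (collapsed n t B) , l ]′ (λ i → Sum.map id (s i)))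
                      (symmetrics n))
      count-collapse = begin
        Count K⁺ l⁺ s⁺
          ≡⟨ count-split (Mat K⁺) (counted? K⁺ l⁺ s⁺) moves? ⟩
        count (Mat K⁺) (λ A → counted? K⁺ l⁺ s⁺ A ×-dec moves? A) + count (Mat K⁺) modular?
          ≡⟨ cong₂ _+_
               (count-cong (Mat K⁺) (λ A → counted? K⁺ l⁺ s⁺ A ×-dec moves? A)
                 (counted? K⁺ l⁺ (extend rotate s)) (λ A → mk⇔
                   (λ ((a , u) , m) → a , λ { zero → m ; (suc i) → u i })
                   (λ (a , u) → (a , u ∘ suc) , u zero)))
               (trans (count-bijection (Mat K⁺) (Mat (fin n) ⊗ Mat K¹) modular? parts? split glue
                        modular⇒parts parts⇒modular)
                      (count-⊗ (Mat (fin n)) (Mat K¹) (symmetric? n) (λ B → counted? K¹ (l¹ B) s¹))) ⟩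
        Count K⁺ l⁺ (extend rotate s) + sum (List.map (λ B → Count K¹ (l¹ B) s¹) (symmetrics n)) ∎
        where open ≡-Reasoning

-- Linear recurrences for functionals of words

sumℤ : List ℤ → ℤ
sumℤ = List.foldr ℤ._+_ ℤ.0ℤ

sumℤ-pos : ∀ {A : Set} (f : A → ℕ) xs → sumℤ (List.map (λ x → + f x) xs) ≡ + sum (List.map f xs)
sumℤ-pos f []       = refl
sumℤ-pos f (x ∷ xs) = cong (λ z → + f x ℤ.+ z) (sumℤ-pos f xs)

sumℤ-linear : ∀ {A : Set} c (f g : A → ℤ) xs → sumℤ (List.map (λ x → f x ℤ.+ c ℤ.* g x) xs) ≡
              sumℤ (List.map f xs) ℤ.+ c ℤ.* sumℤ (List.map g xs)
sumℤ-linear c f g []       = sym (trans (ℤₚ.+-identityˡ _) (ℤₚ.*-zeroʳ c))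
sumℤ-linear c f g (x ∷ xs) = trans (cong (λ z → (f x ℤ.+ c ℤ.* g x) ℤ.+ z) (sumℤ-linear c f g xs))
  (rearrange c (f x) (g x) (sumℤ (List.map f xs)) (sumℤ (List.map g xs)))
  where
  rearrange : ∀ c u v s t → (u ℤ.+ c ℤ.* v) ℤ.+ (s ℤ.+ c ℤ.* t) ≡ (u ℤ.+ s) ℤ.+ c ℤ.* (v ℤ.+ t)
  rearrange = solve-∀

∣-sumℤ : ∀ {A : Set} {m} (f : A → ℤ) xs → (∀ x → m ℤ∣.∣ f x) → m ℤ∣.∣ sumℤ (List.map f xs)
∣-sumℤ     f []       d = ℤ∣.divides ℤ.0ℤ refl
∣-sumℤ {m = m} f (x ∷ xs) d = ℤ∣.∣m∣n⇒∣m+n {m = f x} (d x) (∣-sumℤ f xs d)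

sum-cartesianProductWith : ∀ {A B C : Set} (f : A → B → C) (h : C → ℕ) xs ys →
  sum (List.map h (cartesianProductWith f xs ys)) ≡
  sum (List.map (λ x → sum (List.map (λ y → h (f x y)) ys)) xs)
sum-cartesianProductWith f h []       ys = refl
sum-cartesianProductWith f h (x ∷ xs) ys = begin
  sum (List.map h (List.map (f x) ys ++ cartesianProductWith f xs ys))
    ≡⟨ cong sum (Listₚ.map-++ h (List.map (f x) ys) _) ⟩
  sum (List.map h (List.map (f x) ys) ++ List.map h (cartesianProductWith f xs ys))
    ≡⟨ Sumₚ.sum-++ (List.map h (List.map (f x) ys)) _ ⟩
  sum (List.map h (List.map (f x) ys)) + sum (List.map h (cartesianProductWith f xs ys))
    ≡⟨ cong₂ (λ u v → sum u + v) (sym (Listₚ.map-∘ ys)) (sum-cartesianProductWith f h xs ys) ⟩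
  sum (List.map (λ y → h (f x y)) ys) + sum (List.map (λ x → sum (List.map (λ y → h (f x y)) ys)) xs) ∎
  where open ≡-Reasoning

total : ∀ N → (Fin N → ℕ) → ℕ
total zero    p = 0
total (suc N) p = p zero + total N (p ∘ suc)

-- Difference operators on functionals of words: the word tⁿ at the front is
-- compared with the letters c n t, for c in a finite list of substitutes.
module Differences {L : Set} (substitutes : ℕ → L → List L) where

  D : ℕ → L → (List L → ℤ) → List L → ℤ
  D n t h ts = h (List.replicate n t ++ ts) ℤ.- sumℤ (List.map (λ c → h (c ∷ ts)) (substitutes n t))

  Ds : ∀ N → (Fin N → ℕ) → L → (List L → ℤ) → List L → ℤ
  Ds zero    p t h = h
  Ds (suc N) p t h = D (p zero) t (Ds N (p ∘ suc) t h)

  D-cong : ∀ n t {h h′} → (∀ ts → h ts ≡ h′ ts) → ∀ ts → D n t h ts ≡ D n t h′ ts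
  D-cong n t eq ts = cong₂ ℤ._-_ (eq _) (cong sumℤ (Listₚ.map-cong (λ c → eq (c ∷ ts)) (substitutes n t)))

  D-linear : ∀ n t c h h′ ts → D n t (λ us → h us ℤ.+ c ℤ.* h′ us) ts ≡ D n t h ts ℤ.+ c ℤ.* D n t h′ ts
  D-linear n t c h h′ ts = trans
    (cong (λ z → (h us ℤ.+ c ℤ.* h′ us) ℤ.- z)
      (sumℤ-linear c (λ s → h (s ∷ ts)) (λ s → h′ (s ∷ ts)) (substitutes n t)))
    (rearrange c (h us) (h′ us) _ _)
    where
    us = List.replicate n t ++ ts
    rearrange : ∀ c u v x y → (u ℤ.+ c ℤ.* v) ℤ.- (x ℤ.+ c ℤ.* y) ≡ (u ℤ.- x) ℤ.+ c ℤ.* (v ℤ.- y)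
    rearrange = solve-∀

  Ds-linear : ∀ N p t c h h′ ts →
    Ds N p t (λ us → h us ℤ.+ c ℤ.* h′ us) ts ≡ Ds N p t h ts ℤ.+ c ℤ.* Ds N p t h′ ts
  Ds-linear zero    p t c h h′ ts = refl
  Ds-linear (suc N) p t c h h′ ts = trans (D-cong (p zero) t (Ds-linear N (p ∘ suc) t c h h′) ts)
    (D-linear (p zero) t c (Ds N (p ∘ suc) t h) (Ds N (p ∘ suc) t h′) ts)

  Ds-suffix : ∀ N p t h w ts → Ds N p t (λ us → h (us ++ w)) ts ≡ Ds N p t h (ts ++ w)
  Ds-suffix zero    p t h w ts = refl
  Ds-suffix (suc N) p t h w ts = trans (D-cong (p zero) t (Ds-suffix N (p ∘ suc) t h w) ts)
    (cong (λ z → Ds N (p ∘ suc) t h z ℤ.-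
      sumℤ (List.map (λ s → Ds N (p ∘ suc) t h (s ∷ ts ++ w)) (substitutes (p zero) t)))
      (Listₚ.++-assoc (List.replicate (p zero) t) ts w))

  Ds-zero : ∀ N p t ts → Ds N p t (λ _ → ℤ.0ℤ) ts ≡ ℤ.0ℤ
  Ds-zero zero    p t ts = refl
  Ds-zero (suc N) p t ts = trans (D-cong (p zero) t (Ds-zero N (p ∘ suc) t) ts)
    (cong (λ z → ℤ.0ℤ ℤ.- z) (zeros (substitutes (p zero) t)))
    where
    zeros : ∀ (cs : List L) → sumℤ (List.map (λ _ → ℤ.0ℤ) cs) ≡ ℤ.0ℤ
    zeros []       = refl
    zeros (_ ∷ cs) = trans (ℤₚ.+-identityˡ _) (zeros cs)

  module _ (m : ℕ) (N : ℕ) (p : Fin N → ℕ) where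

    Killed : (List L → ℤ) → Set
    Killed h = ∀ t ts → (+ m) ℤ∣.∣ Ds N p t h ts

    Killed-linear : ∀ c {h h′} → Killed h → Killed h′ → Killed (λ us → h us ℤ.+ c ℤ.* h′ us)
    Killed-linear c {h} {h′} k k′ t ts = subst ((+ m) ℤ∣.∣_) (sym (Ds-linear N p t c h h′ ts))
      (ℤ∣.∣m∣n⇒∣m+n {m = Ds N p t h ts} (k t ts) (ℤ∣.∣n⇒∣m*n c {n = Ds N p t h′ ts} (k′ t ts)))

    Killed-cong : ∀ {h h′} → (∀ us → h us ≡ h′ us) → Killed h → Killed h′
    Killed-cong {h} {h′} eq k t ts = subst ((+ m) ℤ∣.∣_) (go N p t ts) (k t ts)
      where
      go : ∀ N p t ts → Ds N p t h ts ≡ Ds N p t h′ ts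
      go zero    p t ts = eq ts
      go (suc N) p t ts = D-cong (p zero) t (go N (p ∘ suc) t) ts

    -- The difference operators work at the front of a word, so appending a fixed suffix is
    -- harmless, and they are linear. This transfers the recurrences from counts for single words to
    -- the sums that make up the number of structures.
    Killed-suffixes : ∀ {A : Set} (h : List L → ℕ) → Killed (λ us → + h us) → (w : A → List L) → ∀ xs →
      Killed (λ us → + sum (List.map (λ x → h (us ++ w x)) xs))
    Killed-suffixes h k w [] t ts = subst ((+ m) ℤ∣.∣_) (sym (Ds-zero N p t ts)) (ℤ∣.divides ℤ.0ℤ refl)
    Killed-suffixes h k w (x ∷ xs) = Killed-cong
      (λ us → cong (λ z → + h (us ++ w x) ℤ.+ z)
        (ℤₚ.*-identityˡ (+ sum (List.map (λ x → h (us ++ w x)) xs))))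
      (Killed-linear (+ 1) {λ us → + h (us ++ w x)}
        (λ t ts → subst ((+ m) ℤ∣.∣_) (sym (Ds-suffix N p t (λ us → + h us) (w x) ts)) (k t (ts ++ w x)))
        (Killed-suffixes h k w xs))

  -- All terms of Ds h ts except the leading one have shorter arguments.
  Ds-leading : ∀ (m : ℤ) N p → (∀ i → 2 ≤ p i) → ∀ t h ts →
    (∀ us → length us < total N p + length ts → m ℤ∣.∣ h us) →
    m ℤ∣.∣ Ds N p t h ts ℤ.- h (List.replicate (total N p) t ++ ts)
  Ds-leading m zero    p p≥2 t h ts small = subst (m ℤ∣.∣_) (sym (ℤₚ.+-inverseʳ (h ts))) (ℤ∣.divides ℤ.0ℤ refl)
  Ds-leading m (suc N) p p≥2 t h ts small = subst (m ℤ∣.∣_) (rearrange front (h lead) rest)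
    (ℤ∣.∣m∣n⇒∣m-n {m = front ℤ.- h lead}
      (subst (λ us → m ℤ∣.∣ front ℤ.- h us) lead≡
        (Ds-leading m N (p ∘ suc) (p≥2 ∘ suc) t h (List.replicate n t ++ ts)
          (λ us len → small us (ℕₚ.<-≤-trans len (ℕₚ.≤-reflexive front-length)))))
      (∣-sumℤ _ (substitutes n t) rest-divisible))
    where
    n = p zero
    M = total N (p ∘ suc)
    front = Ds N (p ∘ suc) t h (List.replicate n t ++ ts)
    rest = sumℤ (List.map (λ c → Ds N (p ∘ suc) t h (c ∷ ts)) (substitutes n t))
    lead = List.replicate (n + M) t ++ ts

    open +-*-Solver

    lead≡ : List.replicate M t ++ List.replicate n t ++ ts ≡ lead
    lead≡ = trans (sym (Listₚ.++-assoc (List.replicate M t) (List.replicate n t) ts))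
      (cong (_++ ts) (trans (sym (replicate-+ M n t)) (cong (λ k → List.replicate k t) (ℕₚ.+-comm M n))))

    front-length : M + length (List.replicate n t ++ ts) ≡ n + M + length ts
    front-length = trans (cong (λ k → M + k) (trans (Listₚ.length-++ (List.replicate n t))
        (cong (_+ length ts) (Listₚ.length-replicate n))))
      (solve 3 (λ M n l → M :+ (n :+ l) := n :+ M :+ l) refl M n (length ts))

    -- One letter `c` stands in for `n` letters, so `2 ≤ n` makes the word strictly shorter.
    shorter : M + suc (length ts) < n + M + length ts
    shorter = ℕₚ.<-≤-trans
      (ℕₚ.≤-reflexive (solve 2 (λ M l → con 1 :+ (M :+ (con 1 :+ l)) := con 2 :+ M :+ l) refl M (length ts)))
      (ℕₚ.+-monoˡ-≤ (length ts) (ℕₚ.+-monoˡ-≤ M (p≥2 zero)))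

    rest-divisible : ∀ c → m ℤ∣.∣ Ds N (p ∘ suc) t h (c ∷ ts)
    rest-divisible c = subst (m ℤ∣.∣_) (restore (Ds N (p ∘ suc) t h (c ∷ ts)) (h word))
      (ℤ∣.∣m∣n⇒∣m+n {m = Ds N (p ∘ suc) t h (c ∷ ts) ℤ.- h word}
        (Ds-leading m N (p ∘ suc) (p≥2 ∘ suc) t h (c ∷ ts) (λ us len → small us (ℕₚ.<-trans len shorter)))
        (small word (ℕₚ.≤-<-trans (ℕₚ.≤-reflexive (trans (Listₚ.length-++ (List.replicate M t))
          (cong (_+ suc (length ts)) (Listₚ.length-replicate M)))) shorter)))
      where
      word = List.replicate M t ++ c ∷ ts
      restore : ∀ x y → (x ℤ.- y) ℤ.+ y ≡ x
      restore = solve-∀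

    rearrange : ∀ x y z → (x ℤ.- y) ℤ.- z ≡ (x ℤ.- z) ℤ.- y
    rearrange = solve-∀

module _ {A : Set} {P R : A → Set} (P? : Decidable P) (R? : Decidable R) where

  length-filter-filter : ∀ xs → length (filter P? (filter R? xs)) ≤ length (filter P? xs)
  length-filter-filter [] = z≤n
  length-filter-filter (x ∷ xs) with does (R? x)
  length-filter-filter (x ∷ xs) | true with does (P? x)
  ... | true  = s≤s (length-filter-filter xs)
  ... | false = length-filter-filter xs
  length-filter-filter (x ∷ xs) | false with does (P? x)
  ... | true  = ℕₚ.≤-trans (length-filter-filter xs) (ℕₚ.n≤1+n _)
  ... | false = length-filter-filter xs

module _ (T : Finite) where

  occurrences : El T → List (El T) → ℕ
  occurrences t us = length (filter (_≟E_ T t) us)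

  extract : ∀ t M us → M ≤ occurrences t us → ∃[ ts ] us ↭ List.replicate M t ++ ts
  extract t zero    us       _   = us , ↭-refl
  extract t (suc M) (u ∷ us) M<o with _≟E_ T t u
  ... | yes refl = let ts , perm = extract t M us (ℕₚ.≤-pred M<o) in ts , ↭.prep t perm
  ... | no _ = let ts , perm = extract t (suc M) us M<o in
    u ∷ ts , ↭-trans (↭.prep u perm) (↭-sym (↭ₚ.shift u (List.replicate (suc M) t) ts))

  length≤occurrences : ∀ M us → (∀ t → occurrences t us ≤ M) → length us ≤ size T * M
  length≤occurrences M us few = go (elements T) us (λ {t} _ → complete T t) few
    where
    go : ∀ xs us → (∀ {t} → t ∈ us → t ∈ xs) → (∀ t → occurrences t us ≤ M) → length us ≤ length xs * M
    go []       []       _   _   = z≤n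
    go []       (u ∷ us) us⊆ _   with us⊆ (here refl)
    ... | ()
    go (x ∷ xs) us       us⊆ few = ℕₚ.≤-trans
      (ℕₚ.≤-reflexive (length-filter-split (_≟E_ T x) (_≟E_ T x) us))
      (ℕₚ.+-mono-≤ (few x) (go xs others (λ t∈ → member (∈-filter⁻ other? {xs = us} t∈))
        (λ t → ℕₚ.≤-trans (length-filter-filter (_≟E_ T t) other? us) (few t))))
      where
      other? : ∀ t → Dec (x ≢ t)
      other? t = ¬? (_≟E_ T x t)

      others : List (El T)
      others = filter other? us

      member : ∀ {t} → t ∈ us × x ≢ t → t ∈ xs
      member (t∈ , x≢t) with us⊆ t∈
      ... | here refl = ⊥-elim (x≢t refl)
      ... | there t∈xs = t∈xs

  repeated : ∀ M us → size T * M < length us → ∃[ t ] ∃[ ts ] us ↭ List.replicate M t ++ ts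
  repeated M us long with ∃? T (λ t → M ≤? occurrences t us)
  ... | yes (t , M≤o) = t , extract t M us M≤o
  ... | no none = ⊥-elim (ℕₚ.<⇒≱ long (length≤occurrences M us
    (λ t → ℕₚ.<⇒≤ (ℕₚ.≰⇒> (λ M≤o → none (t , M≤o))))))

  short : ℕ → List (List (El T))
  short zero    = [] ∷ []
  short (suc k) = [] ∷ cartesianProductWith _∷_ (elements T) (short k)

  ∈-short : ∀ k us → length us ≤ k → us ∈ short k
  ∈-short zero    []       _       = here refl
  ∈-short (suc k) []       _       = here refl
  ∈-short (suc k) (u ∷ us) (s≤s l) =
    there (∈-cartesianProductWith⁺ _∷_ (complete T u) (∈-short k us l))

  module _ (substitutes : ℕ → El T → List (El T)) (m : ℕ) (N : ℕ) (p : Fin N → ℕ) (p≥2 : ∀ i → 2 ≤ p i) where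
    open Differences substitutes

    -- By the pigeonhole principle a longer word contains some letter `total N p` times, and by
    -- symmetry these copies can be moved to the front. There the recurrence, whose leading
    -- coefficient is 1, expresses the value through shorter words.
    vanish : ∀ h → (∀ {us vs} → us ↭ vs → h us ≡ h vs) → Killed m N p h →
      (∀ us → length us ≤ size T * total N p → (+ m) ℤ∣.∣ h us) → ∀ us → (+ m) ℤ∣.∣ h us
    vanish h h-perm killed small us = go (length us) us ℕₚ.≤-refl
      where
      M = total N p

      go : ∀ n us → length us ≤ n → (+ m) ℤ∣.∣ h us
      go n us len with length us ≤? size T * M
      go n us len | yes l = small us l
      go zero us len | no long = ⊥-elim (long (ℕₚ.≤-trans len z≤n))
      go (suc n) us len | no long with repeated M us (ℕₚ.≰⇒> long)
      ... | t , ts , perm = subst ((+ m) ℤ∣.∣_) (sym (h-perm perm))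
        (subst ((+ m) ℤ∣.∣_) (cancel (Ds N p t h ts) _)
          (ℤ∣.∣m∣n⇒∣m-n {m = Ds N p t h ts} (killed t ts)
            (Ds-leading (+ m) N p p≥2 t h ts (λ vs vs< → go n vs (ℕₚ.≤-pred (ℕₚ.≤-trans vs<
              (ℕₚ.≤-trans (ℕₚ.≤-reflexive (sym us-length)) len)))))))
        where
        us-length : length us ≡ M + length ts
        us-length = trans (↭ₚ.↭-length perm) (trans (Listₚ.length-++ (List.replicate M t))
          (cong (_+ length ts) (Listₚ.length-replicate M)))

        cancel : ∀ x y → x ℤ.- (x ℤ.- y) ≡ y
        cancel = solve-∀

-- Recurrences for labelled counting

Blocks-map : ∀ N p {I J} → I ≃ J → Blocks N p I ≃ Blocks N p J
Blocks-map zero    p         π = π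
Blocks-map (suc N) p {I} {J} π = _⊕≃_ {fin (p zero)} {Blocks N (p ∘ suc) I} {fin (p zero)}
  {Blocks N (p ∘ suc) J} (≃-refl {fin (p zero)}) (Blocks-map N (p ∘ suc) {I} {J} π)

module _ {I J : Finite} (π : I ≃ J) where

  map-turn : ∀ N p i x → to (Blocks-map N p {I} {J} π) (turn I N p i x) ≡
                         turn J N p i (to (Blocks-map N p {I} {J} π) x)
  map-turn (suc N) p zero    (inj₁ x) = refl
  map-turn (suc N) p zero    (inj₂ x) = refl
  map-turn (suc N) p (suc i) (inj₁ x) = refl
  map-turn (suc N) p (suc i) (inj₂ x) = cong inj₂ (map-turn N (p ∘ suc) i x)

  map-labels : ∀ {L : Set} N p (t : L) {l : El I → L} {l′ : El J → L} → (∀ x → l x ≡ l′ (to π x)) →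
    ∀ x → labels I N p t l x ≡ labels J N p t l′ (to (Blocks-map N p {I} {J} π) x)
  map-labels zero    p t eq x        = eq x
  map-labels (suc N) p t eq (inj₁ x) = refl
  map-labels (suc N) p t eq (inj₂ x) = map-labels N (p ∘ suc) t eq x

cons-≃ : ∀ n → fin (suc n) ≃ (fin 1 ⊕ fin n)
cons-≃ n = record
  { to      = λ { zero → inj₁ zero ; (suc i) → inj₂ i }
  ; from    = λ { (inj₁ _) → zero ; (inj₂ i) → suc i }
  ; from-to = λ { zero → refl ; (suc i) → refl }
  ; to-from = λ { (inj₁ zero) → refl ; (inj₂ i) → refl }
  }

module _ {L : Set} (t : L) (ts : List L) where

  split-replicate : ∀ n → Fin (length (List.replicate n t ++ ts)) → Fin n ⊎ Fin (length ts)
  split-replicate zero    i       = inj₂ i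
  split-replicate (suc n) zero    = inj₁ zero
  split-replicate (suc n) (suc i) = Sum.map suc id (split-replicate n i)

  join-replicate : ∀ n → Fin n ⊎ Fin (length ts) → Fin (length (List.replicate n t ++ ts))
  join-replicate zero    (inj₂ i)       = i
  join-replicate (suc n) (inj₁ zero)    = zero
  join-replicate (suc n) (inj₁ (suc i)) = suc (join-replicate n (inj₁ i))
  join-replicate (suc n) (inj₂ i)       = suc (join-replicate n (inj₂ i))

  join-split : ∀ n i → join-replicate n (split-replicate n i) ≡ i
  join-split zero    i       = refl
  join-split (suc n) zero    = refl
  join-split (suc n) (suc i) with split-replicate n i | join-split n i
  ... | inj₁ j | eq = cong suc eq
  ... | inj₂ j | eq = cong suc eq

  split-join : ∀ n i → split-replicate n (join-replicate n i) ≡ i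
  split-join zero    (inj₂ i)       = refl
  split-join (suc n) (inj₁ zero)    = refl
  split-join (suc n) (inj₁ (suc i)) rewrite split-join n (inj₁ i) = refl
  split-join (suc n) (inj₂ i)       rewrite split-join n (inj₂ i) = refl

  replicate-≃ : ∀ n → fin (length (List.replicate n t ++ ts)) ≃ (fin n ⊕ fin (length ts))
  replicate-≃ n = record
    { to = split-replicate n ; from = join-replicate n
    ; from-to = join-split n ; to-from = split-join n }

  lookup-replicate : ∀ n i → List.lookup (List.replicate n t ++ ts) i ≡
                             [ constant t , List.lookup ts ]′ (split-replicate n i)
  lookup-replicate zero    i       = refl
  lookup-replicate (suc n) zero    = refl
  lookup-replicate (suc n) (suc i) with split-replicate n i | lookup-replicate n i
  ... | inj₁ j | eq = eq
  ... | inj₂ j | eq = eq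

module WordCounts (b : ℕ) (algebra : TypeAlgebras.Algebra b)
                  (acc : El (TypeAlgebras.Algebra.T algebra) → Bool) where
  open TypeAlgebras b
  open Matrices b
  open Algebra algebra

  private
    Countᴬ : ∀ K (l : El K → El T) {N} (s : Fin N → El K → El K) → ℕ
    Countᴬ = Count algebra acc

    coll : ∀ n → El T → El (Mat (fin n)) → El T
    coll = collapsed algebra acc

    syms : ∀ n → List (El (Mat (fin n)))
    syms = symmetrics algebra acc

  -- With no rotations at all the condition of being unfixed is vacuous, so every accepted
  -- arrangement is counted.
  g : List (El T) → ℕ
  g ts = Countᴬ (fin (length ts)) (List.lookup ts) {0} (λ ())

  g-↭ : ∀ {us vs} → us ↭ vs → g us ≡ g vs
  g-↭ {us} {vs} perm = Count-≃ algebra acc {fin (length us)} {fin (length vs)} (record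
      { to = Inverse.to π ; from = Inverse.from π
      ; from-to = Inverse.strictlyInverseʳ π ; to-from = Inverse.strictlyInverseˡ π })
    (↭ₛₚ.onIndices-lookup (setoid (El T)) (↭.↭⇒↭ₛ perm)) (λ ())
    where
    π = onIndices (↭.↭⇒↭ₛ perm)

  -- A type is listed once for each symmetric block that collapses to it; these multiplicities are
  -- the coefficients of the recurrence.
  substitutes : ℕ → El T → List (El T)
  substitutes n t = List.map (coll n t) (syms n)

  open Differences substitutes

  BlockCount : ∀ N → (Fin N → ℕ) → El T → (I : Finite) → (El I → El T) → ℕ
  BlockCount N p t I l = Countᴬ (Blocks N p I) (labels I N p t l) (turn I N p)

  BlockCount-≃ : ∀ N p t {I J} (π : I ≃ J) {l l′} → (∀ x → l x ≡ l′ (to π x)) →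
                 BlockCount N p t I l ≡ BlockCount N p t J l′
  BlockCount-≃ N p t {I} {J} π eq = Count-≃ algebra acc {Blocks N p I} {Blocks N p J}
    (Blocks-map N p {I} {J} π) (map-labels {I} {J} π N p t eq) (map-turn {I} {J} π N p)

  BlockCount-shift : ∀ N p t J I (j : El J → El T) l → BlockCount N p t (J ⊕ I) [ j , l ]′ ≡
    Countᴬ (J ⊕ Blocks N p I) [ j , labels I N p t l ]′ (λ i → Sum.map id (turn I N p i))
  BlockCount-shift N p t J I j l = Count-≃ algebra acc {Blocks N p (J ⊕ I)} {J ⊕ Blocks N p I}
    (Blocks-shift N p J I) (shift-labels J I N p t j l) (shift-turn J I N p)

  BlockCount-suc : ∀ N p t I l → (∀ i → NonZero (p i)) →
    BlockCount N (p ∘ suc) t (fin (p zero) ⊕ I) [ constant t , l ]′ ≡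
    BlockCount (suc N) p t I l +
    sum (List.map (λ B → BlockCount N (p ∘ suc) t (fin 1 ⊕ I) [ constant (coll (p zero) t B) , l ]′)
                  (syms (p zero)))
  BlockCount-suc N p t I l nz = begin
    BlockCount N p′ t (fin n ⊕ I) [ constant t , l ]′
      ≡⟨ BlockCount-shift N p′ t (fin n) I (constant t) l ⟩
    Countᴬ (fin n ⊕ K) [ constant t , lᴷ ]′ (λ i → Sum.map id (turn I N p′ i))
      ≡⟨ count-collapse algebra acc n {{nz zero}} K t lᴷ (turn I N p′) ⟩
    Countᴬ (fin n ⊕ K) [ constant t , lᴷ ]′ (extend algebra acc rotate (turn I N p′)) +
    sum (List.map (λ B → Countᴬ (fin 1 ⊕ K) [ constant (coll n t B) , lᴷ ]′
      (λ i → Sum.map id (turn I N p′ i))) (syms n))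
      ≡⟨ cong₂ _+_
           (Count-≃ algebra acc {fin n ⊕ K} {fin n ⊕ K} (≃-refl {fin n ⊕ K}) (λ _ → refl)
             (λ { zero _ → refl ; (suc i) _ → refl }))
           (cong sum (Listₚ.map-cong
             (λ B → sym (BlockCount-shift N p′ t (fin 1) I (constant (coll n t B)) l)) (syms n))) ⟩
    BlockCount (suc N) p t I l +
    sum (List.map (λ B → BlockCount N p′ t (fin 1 ⊕ I) [ constant (coll n t B) , l ]′) (syms n)) ∎
    where
    open ≡-Reasoning
    n  = p zero
    p′ = p ∘ suc
    K  = Blocks N p′ I
    lᴷ = labels I N p′ t l

  -- Solving `BlockCount-suc` for its first summand gives the recursion that defines `Ds`. So the
  -- alternating expression in values of `g` counts actual structures, on which a group can act.
  Ds-g : ∀ N p → (∀ i → NonZero (p i)) → ∀ t ts →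
    Ds N p t (λ us → + g us) ts ≡ + BlockCount N p t (fin (length ts)) (List.lookup ts)
  Ds-g zero    p nz t ts = cong +_ (Count-≃ algebra acc {fin (length ts)} {fin (length ts)}
    (≃-refl {fin (length ts)}) (λ _ → refl) (λ ()))
  Ds-g (suc N) p nz t ts = begin
    Ds N p′ t g⁺ (List.replicate n t ++ ts) ℤ.-
    sumℤ (List.map (λ c → Ds N p′ t g⁺ (c ∷ ts)) (substitutes n t))
      ≡⟨ cong₂ ℤ._-_ (trans (Ds-g N p′ (nz ∘ suc) t (List.replicate n t ++ ts)) (cong +_
             (BlockCount-≃ N p′ t {fin (length (List.replicate n t ++ ts))} {fin n ⊕ I}
               (replicate-≃ t ts n) (lookup-replicate t ts n))))
           (cong sumℤ (trans (sym (Listₚ.map-∘ (syms n))) (Listₚ.map-cong term (syms n)))) ⟩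
    + BlockCount N p′ t (fin n ⊕ I) [ constant t , l ]′ ℤ.-
    sumℤ (List.map (λ B → + rest B) (syms n))
      ≡⟨ cong₂ (λ u v → + u ℤ.- v) (BlockCount-suc N p t I l nz) (sumℤ-pos rest (syms n)) ⟩
    + (BlockCount (suc N) p t I l + sum (List.map rest (syms n))) ℤ.- + sum (List.map rest (syms n))
      ≡⟨ cancel (+ BlockCount (suc N) p t I l) (+ sum (List.map rest (syms n))) ⟩
    + BlockCount (suc N) p t I l ∎
    where
    open ≡-Reasoning
    n  = p zero
    p′ = p ∘ suc
    I  = fin (length ts)
    l  = List.lookup ts
    g⁺ : List (El T) → ℤ
    g⁺ us = + g us

    rest : El (Mat (fin n)) → ℕ
    rest B = BlockCount N p′ t (fin 1 ⊕ I) [ constant (coll n t B) , l ]′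

    term : ∀ B → Ds N p′ t g⁺ (coll n t B ∷ ts) ≡ + rest B
    term B = trans (Ds-g N p′ (nz ∘ suc) t (coll n t B ∷ ts)) (cong +_
      (BlockCount-≃ N p′ t {fin (suc (length ts))} {fin 1 ⊕ I} (cons-≃ (length ts))
        (λ { zero → refl ; (suc i) → refl })))

    cancel : ∀ x y → (x ℤ.+ y) ℤ.- y ≡ x
    cancel = solve-∀

  module _ (bound : ℕ) (values : List ℕ) (2∣values∣≤bound : 2 * length values ≤ bound)
           (N : ℕ) (p : Fin N → ℕ) (p-prime : ∀ i → Prime (p i))
           (available : ∀ {q} → q ∈ values → ∀ L → length L < bound → ∃[ i ] p i ≡ q × suc i ∉ L) where

    BlockCount-divisible : ∀ t I l → product values ℕ∣.∣ BlockCount N p t I l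
    BlockCount-divisible t I l = count-divisible bound values available 2∣values∣≤bound
      (counted? algebra acc K lᴷ (turn I N p)) invariant (λ A → proj₂)
      where
      open PairwiseAction (pairwiseAction N p p-prime I) hiding (p; p-prime)
      K  = Blocks N p I
      lᴷ = labels I N p t l

      -- All points of a block carry the same label, so a rotation is an isomorphism of labelled
      -- arrangements. As rotations commute and are injective, an arrangement moved by all of them
      -- stays so.
      invariant : Invariant (Counted algebra acc K lᴷ (turn I N p))
      invariant i {A} (accepted , unfixed) =
        Accepted-≃ algebra acc {K} {K} (≃-sym {K} {K} τ) eq (λ x y → sym (trans (entry-relabel K _ A _ _)
          (cong₂ (entry K A) (to-from τ x) (to-from τ y)))) accepted ,
        λ j fix → unfixed j (σ-injective i (trans (σ-comm i j A) fix))
        where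
        τ = turn-≃ I N p (λ i → prime⇒nonZero (p-prime i)) i
        eq : ∀ x → lᴷ x ≡ lᴷ (from τ x)
        eq x = trans (cong lᴷ (sym (to-from τ x))) (labels-turn I N p t l i (from τ x))

    g-killed : Killed (product values) N p (λ us → + g us)
    g-killed t ts = subst ((+ product values) ℤ∣.∣_)
      (sym (Ds-g N p (λ i → prime⇒nonZero (p-prime i)) t ts))
      (ℤ∣.∣ᵤ⇒∣ (BlockCount-divisible t (fin (length ts)) (List.lookup ts)))

-- Periodicity

-- The blocks are indexed so that every entry of a list of primes is the size of
-- sufficiently many of them.
module _ (qs : List ℕ) (c : ℕ) where

  sizes : Fin (length qs * c) → ℕ
  sizes i = List.lookup qs (proj₁ (remQuot c i))

  sizes-prime : All Prime qs → ∀ i → Prime (sizes i)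
  sizes-prime primes i = All.lookup primes (∈-lookup (proj₁ (remQuot c i)))

  -- Each entry of `qs` owns `c` indices. If all of them occurred in the shorter list `L`, two would
  -- share a position.
  sizes-available : ∀ {q} → q ∈ qs → ∀ L → length L < c → ∃[ i ] sizes i ≡ q × suc i ∉ L
  sizes-available {q} q∈ L L<c with ∃? (fin c) (λ j → ¬? (Any.any? (suc (Fin.combine (Any.index q∈) j) ≟ᶠ_) L))
  ... | yes (j , j∉) = Fin.combine (Any.index q∈) j ,
    trans (cong (List.lookup qs ∘ proj₁) (Finₚ.remQuot-combine (Any.index q∈) j))
          (sym (Anyₚ.lookup-index q∈)) , j∉
  ... | no all = ⊥-elim (ℕₚ.<⇒≢ i<j (cong toℕ (Finₚ.combine-injectiveʳ (Any.index q∈) i (Any.index q∈) j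
      (Finₚ.suc-injective (begin
        suc (Fin.combine (Any.index q∈) i)     ≡⟨ Anyₚ.lookup-index (member i) ⟩
        List.lookup L (Any.index (member i)) ≡⟨ cong (List.lookup L) eq ⟩
        List.lookup L (Any.index (member j)) ≡⟨ Anyₚ.lookup-index (member j) ⟨
        suc (Fin.combine (Any.index q∈) j)     ∎)))))
    where
    open ≡-Reasoning
    member : ∀ j → suc (Fin.combine (Any.index q∈) j) ∈ L
    member j = decidable-stable (Any.any? (suc (Fin.combine (Any.index q∈) j) ≟ᶠ_) L) (λ j∉ → all (j , j∉))

    collision = Finₚ.pigeonhole L<c (λ j → Any.index (member j))
    i   = proj₁ collision
    j   = proj₁ (proj₂ collision)
    i<j = proj₁ (proj₂ (proj₂ collision))
    eq  = proj₂ (proj₂ (proj₂ collision))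

module Periodicity
  (T : Finite) (substitutes : ℕ → El T → List (El T))
  (m : ℕ) .{{_ : NonZero m}} (N : ℕ) (p : Fin N → ℕ) (p≥2 : ∀ i → 2 ≤ p i)
  {Γ : Set} (letters : List Γ) (label : Γ → El T) (H : ℕ → List (El T) → ℕ)
  (H-↭ : ∀ n {us vs} → us ↭ vs → H n us ≡ H n vs)
  (H-killed : ∀ n → Differences.Killed substitutes m N p (λ us → + H n us))
  (H-suc : ∀ n us → H (suc n) us ≡ sum (List.map (λ γ → H n (label γ ∷ us)) letters))
  where
  open Differences substitutes

  Congruent : ℕ → ℕ → Set
  Congruent n n′ = ∀ us → (+ H n us) ≡ (+ H n′ us) [mod m ]

  congruent-suc : ∀ {n n′} → Congruent n n′ → Congruent (suc n) (suc n′)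
  congruent-suc {n} {n′} cong-n us rewrite H-suc n us | H-suc n′ us = go letters
    where
    go : ∀ γs → (+ sum (List.map (λ γ → H n (label γ ∷ us)) γs)) ≡
                (+ sum (List.map (λ γ → H n′ (label γ ∷ us)) γs)) [mod m ]
    go []       = ℤ∣.divides ℤ.0ℤ refl
    go (γ ∷ γs) = subst ((+ m) ℤ∣.∣_)
      (rearrange (+ H n (label γ ∷ us)) (+ H n′ (label γ ∷ us))
                 (+ sum (List.map (λ γ → H n (label γ ∷ us)) γs))
                 (+ sum (List.map (λ γ → H n′ (label γ ∷ us)) γs)))
      (ℤ∣.∣m∣n⇒∣m+n (cong-n (label γ ∷ us)) (go γs))
      where
      rearrange : ∀ a b x y → (a ℤ.- b) ℤ.+ (x ℤ.- y) ≡ (a ℤ.+ x) ℤ.- (b ℤ.+ y)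
      rearrange = solve-∀

  shorts : List (List (El T))
  shorts = short T (size T * total N p)

  -- The difference of two symmetric killed functionals is again symmetric and killed, so `vanish`
  -- applies to it. It is written with the coefficient -1 to fit `Killed-linear`.
  congruent-short : ∀ n n′ → (∀ {us} → us ∈ shorts → (+ H n us) ≡ (+ H n′ us) [mod m ]) → Congruent n n′
  congruent-short n n′ eq us = subst ((+ m) ℤ∣.∣_) (sym (minus us))
    (vanish T substitutes m N p p≥2 (λ us → + H n us ℤ.+ (ℤ.- (+ 1)) ℤ.* + H n′ us)
      (λ perm → cong₂ (λ x y → + x ℤ.+ (ℤ.- (+ 1)) ℤ.* + y) (H-↭ n perm) (H-↭ n′ perm))
      (Killed-linear m N p (ℤ.- (+ 1)) {λ us → + H n us} {λ us → + H n′ us} (H-killed n) (H-killed n′))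
      (λ us len → subst ((+ m) ℤ∣.∣_) (minus us) (eq (∈-short T _ us len))) us)
    where
    minus : ∀ us → + H n us ℤ.- + H n′ us ≡ + H n us ℤ.+ (ℤ.- (+ 1)) ℤ.* + H n′ us
    minus us = solveℤ (+ H n us) (+ H n′ us)
      where
      solveℤ : ∀ x y → x ℤ.- y ≡ x ℤ.+ (ℤ.- (+ 1)) ℤ.* y
      solveℤ = solve-∀

  residues : ℕ → Fin (length shorts) → Fin m
  residues n k = H n (List.lookup shorts k) mod m

  congruent-residues : ∀ n n′ → funToFin (residues n) ≡ funToFin (residues n′) → Congruent n n′
  congruent-residues n n′ eq = congruent-short n n′ (λ {us} us∈ →
    subst (λ vs → (+ H n vs) ≡ (+ H n′ vs) [mod m ]) (sym (Anyₚ.lookup-index us∈))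
      (Equivalence.from (≡[mod]⇔% m _ _) (begin
        H n (List.lookup shorts (Any.index us∈)) % m       ≡⟨ toℕ-fromℕ< _ ⟨
        toℕ (residues n (Any.index us∈))                   ≡⟨ cong toℕ (same (Any.index us∈)) ⟩
        toℕ (residues n′ (Any.index us∈))                  ≡⟨ toℕ-fromℕ< _ ⟩
        H n′ (List.lookup shorts (Any.index us∈)) % m      ∎)))
    where
    open ≡-Reasoning
    same : ∀ k → residues n k ≡ residues n′ k
    same k = trans (sym (Finₚ.finToFun-funToFin (residues n) k))
      (trans (cong (λ e → finToFun e k) eq) (Finₚ.finToFun-funToFin (residues n′) k))

  -- There are at most `m ^ length shorts` vectors of residues on short words, so two of them
  -- coincide. As the functional for `n` determines the one for `suc n` modulo `m`, the coincidence
  -- propagates to all later indices.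
  eventually-periodic : ∃[ r ] ∃[ d ] 0 < d × (∀ n → r ≤ n → Congruent (n + d) n)
  eventually-periodic with Finₚ.pigeonhole (ℕₚ.n<1+n (m ^ length shorts)) (λ n → funToFin (residues (toℕ n)))
  ... | i , j , i<j , eq = toℕ i , toℕ j ∸ toℕ i , ℕₚ.m<n⇒0<n∸m i<j , periodic
    where
    later : ∀ k → Congruent (k + toℕ j) (k + toℕ i)
    later zero    = congruent-residues (toℕ j) (toℕ i) (sym eq)
    later (suc k) = congruent-suc {k + toℕ j} {k + toℕ i} (later k)

    periodic : ∀ n → toℕ i ≤ n → Congruent (n + (toℕ j ∸ toℕ i)) n
    periodic n i≤n = subst₂ Congruent
      (begin
        (n ∸ toℕ i) + toℕ j                         ≡⟨ cong (λ z → (n ∸ toℕ i) + z) (ℕₚ.m+[n∸m]≡n (ℕₚ.<⇒≤ i<j)) ⟨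
        (n ∸ toℕ i) + (toℕ i + (toℕ j ∸ toℕ i))     ≡⟨ ℕₚ.+-assoc (n ∸ toℕ i) (toℕ i) _ ⟨
        (n ∸ toℕ i) + toℕ i + (toℕ j ∸ toℕ i)       ≡⟨ cong (_+ (toℕ j ∸ toℕ i)) (ℕₚ.m∸n+n≡m i≤n) ⟩
        n + (toℕ j ∸ toℕ i)                         ∎)
      (ℕₚ.m∸n+n≡m i≤n) (later (n ∸ toℕ i))
      where open ≡-Reasoning

eventually-periodic⇒MCFinite : (s : ℕ → ℤ) →
  (∀ m .{{_ : NonZero m}} → ∃[ r ] ∃[ d ] 0 < d × (∀ n → r ≤ n → s (n + d) ≡ s n [mod m ])) →
  MCFinite s
eventually-periodic⇒MCFinite s periodic m with periodic m
-- `MCFinite` requires `0 < p`, hence a recurrence of order at least 2, while the period `suc d` may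
-- be 1. Two periods are used: with `d + suc d` for `p`, the index `n + p + 1` lies two periods
-- after `n`, and only the coefficient at `n` is nonzero. The threshold `suc r` makes it positive.
... | r , suc d , _ , step = suc r , d + suc d , s≤s z≤n , ℕₚ.<-≤-trans (s≤s z≤n) (ℕₚ.m≤n+m (suc d) d) , α ,
      λ n r<n → subst₂ (λ x y → x ≡ y [mod m ]) (cong s (twice-d n)) (sym (recurrence n))
        (twice n (ℕₚ.<⇒≤ r<n))
  where
  open +-*-Solver

  α : Fin (suc (d + suc d)) → ℤ
  α zero    = + 1
  α (suc _) = + 0

  twice-d : ∀ n → n + suc d + suc d ≡ n + (d + suc d) + 1
  twice-d n = solve 2 (λ n d → n :+ (con 1 :+ d) :+ (con 1 :+ d) := n :+ (d :+ (con 1 :+ d)) :+ con 1) refl n d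

  vanishing : ∀ k (f : Fin k → ℤ) → sumᵛ (λ i → + 0 ℤ.* f i) ≡ + 0
  vanishing zero    f = refl
  vanishing (suc k) f = trans (cong (λ z → + 0 ℤ.* f zero ℤ.+ z) (vanishing k (f ∘ suc)))
    (trans (ℤₚ.+-identityʳ _) (ℤₚ.*-zeroˡ (f zero)))

  recurrence : ∀ n → sumᵛ (λ i → α i ℤ.* s (n + toℕ i)) ≡ s n
  recurrence n = trans (cong₂ ℤ._+_ (trans (ℤₚ.*-identityˡ _) (cong s (ℕₚ.+-identityʳ n)))
      (vanishing (d + suc d) (λ i → s (n + suc (toℕ i)))))
    (ℤₚ.+-identityʳ (s n))

  twice : ∀ n → r ≤ n → s (n + suc d + suc d) ≡ s n [mod m ]
  twice n r≤n = subst ((+ m) ℤ∣.∣_) (telescope (s (n + suc d + suc d)) (s (n + suc d)) (s n))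
    (ℤ∣.∣m∣n⇒∣m+n (step (n + suc d) (ℕₚ.≤-trans r≤n (ℕₚ.m≤m+n n (suc d)))) (step n r≤n))
    where
    telescope : ∀ x y z → (x ℤ.- y) ℤ.+ (y ℤ.- z) ≡ x ℤ.- z
    telescope = solve-∀

-- The number of structures

tabulate-≃ : ∀ {L : Set} {n} (f : Fin n → L) → fin n ≃ fin (length (List.tabulate f))
tabulate-≃ f = record
  { to = Fin.cast (sym len) ; from = Fin.cast len
  ; from-to = λ x → Finₚ.cast-involutive len (sym len) x
  ; to-from = λ y → Finₚ.cast-involutive (sym len) len y }
  where len = Listₚ.length-tabulate f

lookup-ext : ∀ {A : Set} {n} {u v : Vec A n} → (∀ i → lookup u i ≡ lookup v i) → u ≡ v
lookup-ext {u = u} {v} eq = trans (sym (Vecₚ.tabulate∘lookup u))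
  (trans (Vecₚ.tabulate-cong eq) (Vecₚ.tabulate∘lookup v))

module _ (τ : Vocabulary) where
  private
    b = #binary τ
    c = #constants τ

  open Semantics τ
  open TypeAlgebras b
  open Matrices b

  allRelationsᶠ : ∀ N → Finite
  allRelationsᶠ N = record
    { El = Relations τ N ; elements = allRelations τ N
    ; unique = allRelations-unique τ N ; complete = allRelations-complete }

  -- The unary predicates and the loops of a point.
  Data : Finite
  Data = vec bool (#unary τ) ⊗ vec bool b

  module _ {N : ℕ} where

    off-diagonal : Fin N → Fin N → Bin → Bin → Bin
    off-diagonal x y on off = if does (x ≟ᶠ y) then on else off

    off-diagonal-≡ : ∀ x on off → off-diagonal x x on off ≡ on
    off-diagonal-≡ x on off with x ≟ᶠ x
    ... | yes _ = refl
    ... | no x≢ = ⊥-elim (x≢ refl)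

    off-diagonal-≢ : ∀ {x y} on off → x ≢ y → off-diagonal x y on off ≡ off
    off-diagonal-≢ {x} {y} on off x≢y with x ≟ᶠ y
    ... | yes eq = ⊥-elim (x≢y eq)
    ... | no _   = refl

    bits : Relations τ N → Fin N → Fin N → Bin
    bits R x y = Vec.map (λ B → lookup (lookup B x) y) (Relations.binary R)

    -- Loops are moved to the point data and erased from the matrix, so that the encoding is a
    -- bijection onto the pairs with `ZeroDiagonal`.
    encode : Relations τ N → El (vec Data N ⊗ Mat (fin N))
    encode R =
      tabulate (λ x → Vec.map (λ U → lookup U x) (Relations.unary R) , bits R x x) ,
      mat (fin N) (λ x y → off-diagonal x y zeroes (bits R x y))

    decode : El (vec Data N ⊗ Mat (fin N)) → Relations τ N
    decode (γ , A) = mkRelations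
      (tabulate (λ U → tabulate (λ x → lookup (proj₁ (lookup γ x)) U)))
      (tabulate (λ B → tabulate (λ x → tabulate (λ y →
        lookup (off-diagonal x y (proj₂ (lookup γ x)) (entry (fin N) A x y)) B))))

    decode-bits : ∀ γA x y → bits (decode γA) x y ≡
      off-diagonal x y (proj₂ (lookup (proj₁ γA) x)) (entry (fin N) (proj₂ γA) x y)
    decode-bits (γ , A) x y = lookup-ext (λ B → trans (Vecₚ.lookup-map B _ (Relations.binary (decode (γ , A))))
      (trans (cong (λ r → lookup (lookup r x) y) (Vecₚ.lookup∘tabulate _ B))
        (trans (cong (λ r → lookup r y) (Vecₚ.lookup∘tabulate _ x)) (Vecₚ.lookup∘tabulate _ y))))

    encode-diagonal : ∀ R → ZeroDiagonal (fin N) (proj₂ (encode R))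
    encode-diagonal R x = trans (entry-mat (fin N) _ x x) (off-diagonal-≡ x zeroes (bits R x x))

    encode-entry : ∀ R {x y} → x ≢ y → entry (fin N) (proj₂ (encode R)) x y ≡ bits R x y
    encode-entry R {x} {y} x≢y = trans (entry-mat (fin N) _ x y) (off-diagonal-≢ zeroes _ x≢y)

    decode-encode : ∀ R → decode (encode R) ≡ R
    decode-encode R@(mkRelations us bs) = cong₂ mkRelations
      (lookup-ext (λ U → lookup-ext (λ x → begin
        lookup (lookup (Relations.unary (decode (encode R))) U) x
          ≡⟨ cong (λ r → lookup r x) (Vecₚ.lookup∘tabulate _ U) ⟩
        lookup (tabulate (λ x → lookup (proj₁ (lookup (proj₁ (encode R)) x)) U)) x
          ≡⟨ Vecₚ.lookup∘tabulate _ x ⟩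
        lookup (proj₁ (lookup (proj₁ (encode R)) x)) U
          ≡⟨ cong (λ d → lookup (proj₁ d) U) (Vecₚ.lookup∘tabulate _ x) ⟩
        lookup (Vec.map (λ U → lookup U x) us) U
          ≡⟨ Vecₚ.lookup-map U _ us ⟩
        lookup (lookup us U) x ∎)))
      (lookup-ext (λ B → lookup-ext (λ x → lookup-ext (λ y → begin
        lookup (lookup (lookup (Relations.binary (decode (encode R))) B) x) y
          ≡⟨ Vecₚ.lookup-map B (λ B → lookup (lookup B x) y) (Relations.binary (decode (encode R))) ⟨
        lookup (bits (decode (encode R)) x y) B
          ≡⟨ cong (λ v → lookup v B) (trans (decode-bits (encode R) x y) (same x y)) ⟩
        lookup (bits R x y) B
          ≡⟨ Vecₚ.lookup-map B _ bs ⟩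
        lookup (lookup (lookup bs B) x) y ∎))))
      where
      open ≡-Reasoning
      same : ∀ x y → off-diagonal x y (proj₂ (lookup (proj₁ (encode R)) x))
                       (entry (fin N) (proj₂ (encode R)) x y) ≡ bits R x y
      same x y with x ≟ᶠ y
      ... | yes refl = cong proj₂ (Vecₚ.lookup∘tabulate _ x)
      ... | no x≢y   = encode-entry R x≢y

    encode-decode : ∀ γ A → ZeroDiagonal (fin N) A → encode (decode (γ , A)) ≡ (γ , A)
    encode-decode γ A diag = cong₂ _,_
      (lookup-ext (λ x → trans (Vecₚ.lookup∘tabulate _ x) (cong₂ _,_
        (lookup-ext (λ U → trans (Vecₚ.lookup-map U _ (Relations.unary (decode (γ , A))))
          (trans (cong (λ r → lookup r x) (Vecₚ.lookup∘tabulate _ U)) (Vecₚ.lookup∘tabulate _ x))))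
        (trans (decode-bits (γ , A) x x) (off-diagonal-≡ x _ _)))))
      (entry-ext (fin N) (λ x y → trans (entry-mat (fin N) _ x y) (same x y)))
      where
      same : ∀ x y → off-diagonal x y zeroes (bits (decode (γ , A)) x y) ≡ entry (fin N) A x y
      same x y with x ≟ᶠ y
      ... | yes refl = sym (diag x)
      ... | no x≢y   = trans (decode-bits (γ , A) x y) (off-diagonal-≢ _ _ x≢y)

  module _ (C : Class τ) (definable : CMSOLDefinable C) where
    private
      φ = proj₁ definable
      C? = definable⇒decidable definable

    open Recognizer (recognizer φ) using (algebra; sing; acc; T; F; F-≃)
    open WordCounts b algebra acc

    label : ∀ n → Fin (n + c) → El Data → El T
    label n x (us , ls) = sing (colour us ls (tabulate (λ e → does ((n ↑ʳ e) ≟ᶠ x))) [] [])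

    word : ∀ n → Vec (El Data) (n + c) → List (El T)
    word n γ = List.tabulate (λ x → label n x (lookup γ x))

    freeLabel : El Data → El T
    freeLabel (us , ls) = sing (colour us ls (tabulate (λ _ → false)) [] [])

    -- The number of structures with additional points of prescribed types `us`. This parameter is
    -- what makes the passage from `n` to `suc n` linear; the sequence itself is the value at the
    -- empty word.
    H : ℕ → List (El T) → ℕ
    H n us = sum (List.map (λ γ → g (us ++ word n γ)) (allVecs (elements Data) (n + c)))

    H-↭ : ∀ n {us vs} → us ↭ vs → H n us ≡ H n vs
    H-↭ n perm = cong sum (Listₚ.map-cong (λ γ → g-↭ (↭ₚ.++⁺ʳ (word n γ) perm))
      (allVecs (elements Data) (n + c)))

    -- The constants denote the last `c` points, so the point gained in passing to `suc n` is a new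
    -- first one, denoted by no constant, and the labels of the old points are unchanged. Symmetry
    -- of `g` moves the new letter to the front of `us`.
    H-suc : ∀ n us → H (suc n) us ≡ sum (List.map (λ γ → H n (freeLabel γ ∷ us)) (elements Data))
    H-suc n us = trans
      (sum-cartesianProductWith _∷_ (λ γ → g (us ++ word (suc n) γ)) (elements Data) (allVecs (elements Data) (n + c)))
      (cong sum (Listₚ.map-cong (λ γ → cong sum (Listₚ.map-cong
        (λ γs → g-↭ (↭ₚ.shift (freeLabel γ) us (word n γs))) (allVecs (elements Data) (n + c)))) (elements Data)))

    module _ (n : ℕ) where
      private
        N = n + c

        l : Vec (El Data) N → Fin N → El T
        l γ x = label n x (lookup γ x)

      satisfies⇔accepted : ∀ R → C N (hardWired n R) ⇔
        Accepted algebra acc (fin N) (l (proj₁ (encode R))) (proj₂ (encode R))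
      satisfies⇔accepted R = mk⇔
        (λ s → encode-diagonal R , trans (sym same) (Equivalence.to sat (Equivalence.to models s)))
        (λ (_ , a) → Equivalence.from models (Equivalence.from sat (trans same a)))
        where
        M = hardWired n R
        models = proj₂ definable N M
        sat = reflected (sat-reflects M φ [] [])

        same : accepts (recognizer φ) (fin N) (arrangement M) (colouring M [] []) ≡
               acc (F (fin N) (entry (fin N) (proj₂ (encode R))) (l (proj₁ (encode R))))
        same = cong acc (F-≃ (≃-refl {fin N}) (λ x y x≢y → sym (encode-entry R x≢y))
          (λ x → trans
            (cong (λ k → sing (colour (Vec.map (λ U → lookup U x) (Relations.unary R)) (bits R x x) k [] []))
              (sym (Vecₚ.tabulate-∘ (λ e → does (e ≟ᶠ x)) (n ↑ʳ_))))
            (cong (label n x) (sym (Vecₚ.lookup∘tabulate _ x)))))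

      always? : Decidable (λ (_ : Vec (El Data) N) → ⊤)
      always? _ = yes tt

      acceptedᵞ? : ∀ γ → Decidable (Accepted algebra acc (fin N) (l γ))
      acceptedᵞ? γ = accepted? algebra acc (fin N) (l γ)

      count-word : ∀ γ → count (Mat (fin N)) (acceptedᵞ? γ) ≡ g (word n γ)
      count-word γ = trans
        (count-cong (Mat (fin N)) (acceptedᵞ? γ) (counted? algebra acc (fin N) (l γ) {0} (λ ()))
          (λ A → mk⇔ (λ a → a , λ ()) proj₁))
        (Count-≃ algebra acc {fin N} {fin (length (word n γ))} (tabulate-≃ (l γ))
          (λ x → sym (Listₚ.lookup-tabulate (l γ) x)) (λ ()))

      Sp≡H : Sp C C? n ≡ H n []
      Sp≡H = begin
        count (allRelationsᶠ N) P?
          ≡⟨ count-bijection (allRelationsᶠ N) (vec Data N ⊗ Mat (fin N)) P?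
               (λ (γ , A) → always? γ ×-dec acceptedᵞ? γ A) encode decode
               (λ R s → (tt , Equivalence.to (satisfies⇔accepted R) s) , decode-encode R)
               (λ (γ , A) (_ , a) → let eq = encode-decode γ A (proj₁ a) in
                 Equivalence.from (satisfies⇔accepted (decode (γ , A)))
                   (subst (λ (γ , A) → Accepted algebra acc (fin N) (l γ) A) (sym eq) a) ,
                 eq) ⟩
        count (vec Data N ⊗ Mat (fin N)) (λ (γ , A) → always? γ ×-dec acceptedᵞ? γ A)
          ≡⟨ count-⊗ (vec Data N) (Mat (fin N)) always? acceptedᵞ? ⟩
        sum (List.map (λ γ → count (Mat (fin N)) (acceptedᵞ? γ)) (filter always? (elements (vec Data N))))
          ≡⟨ cong (sum ∘ List.map _) (Listₚ.filter-all always? (All.universal _ (elements (vec Data N)))) ⟩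
        sum (List.map (λ γ → count (Mat (fin N)) (acceptedᵞ? γ)) (elements (vec Data N)))
          ≡⟨ cong sum (Listₚ.map-cong count-word (elements (vec Data N))) ⟩
        H n [] ∎
        where
        open ≡-Reasoning
        P? : Decidable (λ R → C N (hardWired n R))
        P? R = C? N (hardWired n R)

    Sp-periodic : ∀ m .{{_ : NonZero m}} → ∃[ r ] ∃[ d ] 0 < d ×
      (∀ n → r ≤ n → (+ Sp C C? (n + d)) ≡ (+ Sp C C? n) [mod m ])
    Sp-periodic m with factorise m
    ... | record { factors = qs ; isFactorisation = refl ; factorsPrime = primes } =
      let r , d , 0<d , periodic = eventually-periodic in
      r , d , 0<d , λ n r≤n → subst₂ (λ x y → (+ x) ≡ (+ y) [mod product qs ])
        (sym (Sp≡H (n + d))) (sym (Sp≡H n)) (periodic n r≤n [])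
      where
      -- A chain has one pair for each prime factor, counted with multiplicity, and each pair
      -- occupies two indices.
      copies = 2 * length qs

      size-prime : ∀ i → Prime (sizes qs copies i)
      size-prime = sizes-prime qs copies primes

      size≥2 : ∀ i → 2 ≤ sizes qs copies i
      size≥2 i = nonTrivial⇒n>1 _ {{prime⇒nonTrivial (size-prime i)}}

      killed : ∀ n → Differences.Killed substitutes (product qs) (length qs * copies) (sizes qs copies)
                       (λ us → + H n us)
      killed n = Differences.Killed-suffixes substitutes (product qs) (length qs * copies) (sizes qs copies) g
        (g-killed copies qs ℕₚ.≤-refl (length qs * copies) (sizes qs copies) size-prime
          (sizes-available qs copies))
        (word n) (allVecs (elements Data) (n + c))

      open Periodicity T substitutes (product qs) (length qs * copies) (sizes qs copies)
        size≥2
        (elements Data) freeLabel H H-↭ killed H-suc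

corollary6p2 :
    (τ : Vocabulary) (C : Class τ) (C-definable : CMSOLDefinable C) →
    MCFinite (λ n → + Sp C (definable⇒decidable C-definable) n)
corollary6p2 τ C C-definable =
  eventually-periodic⇒MCFinite (λ n → + Sp C (definable⇒decidable C-definable) n)
    (Sp-periodic τ C C-definable)
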